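{- For $n\in\{0,1,2,\dots\}$ define \[ b_n=\frac14\frac{(-1)^n}{n!}\sum_{k=0}^{n}(-1)^kS(n,k)(2k-1)!!, \] \[ c_n=\frac{(-1)^{n+1}}{n!}\sum_{k=1}^{n}(-1)^kS(n,k)\frac{k!}{2^k}\sum_{\ell=1}^{k}(-1)^{\ell}\binom{2k-\ell}{k}\frac{2^{\ell/2}}{\ell}\sin\frac{3\ell\pi}{4}. \] Then $\lim_{n\to\infty}b_n=+\infty$, $\lim_{n\to\infty}\frac{c_n}{b_n}=\pi$, and consequently $\lim_{n\to\infty}c_n=+\infty$.
   Context: $S(n,k)$ are the Stirling numbers of the second kind, given by $\frac{(e^x-1)^k}{k!}=\sum_{n\ge k}S(n,k)\frac{x^n}{n!}$. $(2k-1)!!=1\cdot3\cdots(2k-1)$ for $k\ge1$, and $(-1)!!=1$. These $b_n,c_n$ satisfy $W(z)=\sum_n(b_n\pi-c_n)z^n$ for $|z|<\ln2$, where $W(z)=\frac{\arctan\sqrt{2e^{ -z}-1}}{\sqrt{2e^{ -z}-1}}$ with principal branches. -}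

module Defs where

open import Level using (Level; _⊔_; suc)
open import Algebra.Bundles using (CommutativeRing)
open import Algebra.Apartness.Bundles using (HeytingField; HeytingCommutativeRing)
import Algebra.Apartness.Properties.HeytingCommutativeRing as HeytingProperties
import Algebra.Properties.Ring as RingProperties
import Algebra.Properties.Semiring.Exp as Exp
import Algebra.Properties.Semiring.Mult as Mult
import Algebra.Properties.Semiring.Sum as Sum
open import Data.Fin.Base using (toℕ)
open import Data.Nat.Base as ℕ using (ℕ; zero; NonZero; _∸_; _!)
open import Data.Nat.Combinatorics using (_C_)
open import Data.Nat.Properties using (_!≢0; m^n≢0)
open import Data.Product.Base using (_×_; _,_; proj₁; ∃)
open import Data.Sum.Base using (_⊎_; inj₁; inj₂)
open import Relation.Binary.Core using (Rel)
open import Relation.Binary.Structures using (IsStrictPartialOrder)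
open import Relation.Nullary.Negation using (¬_)

-- An ordered Heyting field whose apartness is the one induced by the order.
-- Comparability (x < y → x < z ⊎ z < y) follows from cotransitivity of _#_.
record OrderedField c ℓ₁ ℓ₂ ℓ₃ : Set (suc (c ⊔ ℓ₁ ⊔ ℓ₂ ⊔ ℓ₃)) where
  infix 4 _<_
  field
    heytingField : HeytingField c ℓ₁ ℓ₂

  open HeytingField heytingField public

  field
    _<_                  : Rel Carrier ℓ₃
    isStrictPartialOrder : IsStrictPartialOrder _≈_ _<_
    #⇒<⊎>                : ∀ {x y} → x # y → x < y ⊎ y < x
    <⇒#                  : ∀ {x y} → x < y → x # y
    +-monoˡ-<            : ∀ z {x y} → x < y → x + z < y + z
    *-pos                : ∀ {x y} → 0# < x → 0# < y → 0# < x * y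

  open IsStrictPartialOrder isStrictPartialOrder public
    using (<-resp-≈; <-respˡ-≈; <-respʳ-≈)
    renaming (trans to <-trans; irrefl to <-irrefl; asym to <-asym)

  private
    module R = CommutativeRing
      (HeytingCommutativeRing.commutativeRing heytingCommutativeRing)

  open Exp  R.semiring public using (_^_)
  open Mult R.semiring public using () renaming (_×_ to _·_)
  open Sum  R.semiring public using (sum)

  fromℕ : ℕ → Carrier
  fromℕ n = n · 1#

  -- ∣ x - y ∣ < ε
  Within : Carrier → Carrier → Carrier → Set ℓ₃
  Within ε x y = - ε < x - y × x - y < ε

  infix 4 _⟶_ _⟶+∞

  _⟶_ : (ℕ → Carrier) → Carrier → Set (c ⊔ ℓ₃)
  s ⟶ l = ∀ ε → 0# < ε → ∃ λ N → ∀ n → N ℕ.≤ n → Within ε (s n) l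

  _⟶+∞ : (ℕ → Carrier) → Set (c ⊔ ℓ₃)
  s ⟶+∞ = ∀ M → ∃ λ N → ∀ n → N ℕ.≤ n → M < s n

  Cauchy : (ℕ → Carrier) → Set (c ⊔ ℓ₃)
  Cauchy s = ∀ ε → 0# < ε →
    ∃ λ N → ∀ m n → N ℕ.≤ m → N ℕ.≤ n → Within ε (s m) (s n)

-- The real numbers, axiomatised as a Cauchy-complete Archimedean ordered field.
-- Because ∃ is Σ, a Cauchy sequence carries a modulus; so the Cauchy
-- (Bishop) reals satisfy these axioms constructively. With excluded middle
-- they characterise ℝ up to isomorphism.
record RealField c ℓ₁ ℓ₂ ℓ₃ : Set (suc (c ⊔ ℓ₁ ⊔ ℓ₂ ⊔ ℓ₃)) where
  field
    orderedField : OrderedField c ℓ₁ ℓ₂ ℓ₃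

  open OrderedField orderedField public

  field
    archimedean : ∀ x → ∃ λ n → x < fromℕ n
    complete    : ∀ s → Cauchy s → ∃ λ l → s ⟶ l

module Reals {c ℓ₁ ℓ₂ ℓ₃} (realField : RealField c ℓ₁ ℓ₂ ℓ₃) where

  open RealField realField public

  private
    open HeytingProperties heytingCommutativeRing using (1#0)
    module R = CommutativeRing
      (HeytingCommutativeRing.commutativeRing heytingCommutativeRing)
    open RingProperties R.ring
      using (-‿distribˡ-*; -‿distribʳ-*; -‿involutive)

  ℝ : Set c
  ℝ = Carrier

  0<1 : 0# < 1#
  0<1 with #⇒<⊎> 1#0
  ... | inj₂ 0<1 = 0<1
  ... | inj₁ 1<0 = <-respʳ-≈ square (*-pos 0<-1 0<-1)
    where
    0<-1 : 0# < - 1#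
    0<-1 = <-respˡ-≈ (-‿inverseʳ 1#)
             (<-respʳ-≈ (+-identityˡ (- 1#)) (+-monoˡ-< (- 1#) 1<0))

    square : - 1# * - 1# ≈ 1#
    square = trans (sym (-‿distribˡ-* 1# (- 1#)))
             (trans (-‿cong (*-identityˡ (- 1#))) (-‿involutive 1#))

  fromℕ-pos : ∀ n → 0# < fromℕ (ℕ.suc n)
  fromℕ-pos zero      = <-respʳ-≈ (sym (+-identityʳ 1#)) 0<1
  fromℕ-pos (ℕ.suc n) = <-trans (fromℕ-pos n)
    (<-respˡ-≈ (+-identityˡ _) (+-monoˡ-< (fromℕ (ℕ.suc n)) 0<1))

  fromℕ#0 : ∀ n → .{{NonZero n}} → fromℕ n # 0#
  fromℕ#0 (ℕ.suc n) = #-sym (<⇒# (fromℕ-pos n))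

  -- #⇒invertible provides an inverse of y - 0#, which is ≈ y.
  divide : (x y : ℝ) → y # 0# → ℝ
  divide x y y#0 = x * proj₁ (#⇒invertible y#0)

  infixl 7 _/_

  _/_ : ℝ → (n : ℕ) → .{{NonZero n}} → ℝ
  x / n = divide x (fromℕ n) (fromℕ#0 n)

  infixl 7 _/!_

  _/!_ : ℝ → ℕ → ℝ
  x /! n = (x / (n !)) {{n !≢0}}

  infixl 7 _/2^_

  _/2^_ : ℝ → ℕ → ℝ
  x /2^ n = (x / (2 ℕ.^ n)) {{m^n≢0 2 n}}

  -1^_ : ℕ → ℝ
  -1^ n = (- 1#) ^ n

  -- ∑₀ n f = f 0 + ⋯ + f n, while ∑₁ n f = f 1 + ⋯ + f n. In ∑₁ the summand
  -- may use that its index is nonzero.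
  ∑₀ : ℕ → (ℕ → ℝ) → ℝ
  ∑₀ n f = sum {ℕ.suc n} λ i → f (toℕ i)

  ∑₁ : ℕ → ((k : ℕ) → .{{NonZero k}} → ℝ) → ℝ
  ∑₁ n f = sum {n} λ i → f (ℕ.suc (toℕ i))

  -- Formal power series in x, given by their coefficients.
  Series : Set c
  Series = ℕ → ℝ

  infixl 7 _⊛_

  _⊛_ : Series → Series → Series
  (f ⊛ g) n = ∑₀ n λ i → f i * g (n ∸ i)

  one : Series
  one zero      = 1#
  one (ℕ.suc n) = 0#

  power : Series → ℕ → Series
  power f zero      = one
  power f (ℕ.suc k) = f ⊛ power f k

  -- e^x - 1
  expm1 : Series
  expm1 zero      = 0#
  expm1 (ℕ.suc n) = 1# /! ℕ.suc n

  -- The Stirling numbers of the second kind: S n k is n! times the coefficient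
  -- of x^n in (e^x - 1)^k / k!.
  S : ℕ → ℕ → ℝ
  S n k = fromℕ (n !) * (power expm1 k n /! k)

  -- oddDoubleFactorial k = (2k-1)!!
  oddDoubleFactorial : ℕ → ℕ
  oddDoubleFactorial zero      = 1
  oddDoubleFactorial (ℕ.suc k) = oddDoubleFactorial k ℕ.* ℕ.suc (2 ℕ.* k)

  IsSine : (ℝ → ℝ) → Set (c ⊔ ℓ₃)
  IsSine sin = ∀ x →
    (λ n → ∑₀ n λ k → -1^ k * (x ^ ℕ.suc (2 ℕ.* k) /! ℕ.suc (2 ℕ.* k))) ⟶ sin x

  -- π is the least positive zero of the sine function.
  record IsPi (sin : ℝ → ℝ) (π : ℝ) : Set (c ⊔ ℓ₁ ⊔ ℓ₃) where
    field
      positive : 0# < π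
      zero-sin : sin π ≈ 0#
      least    : ∀ x → 0# < x → sin x ≈ 0# → ¬ (x < π)

  record IsSqrt (x y : ℝ) : Set (ℓ₁ ⊔ ℓ₃) where
    field
      positive : 0# < y
      square   : y * y ≈ x

  b : ℕ → ℝ
  b n = 1# / 4 * (-1^ n /! n) *
        ∑₀ n λ k → -1^ k * S n k * fromℕ (oddDoubleFactorial k)

  -- √2 ^ ℓ stands for 2^(ℓ/2).
  module _ (sin : ℝ → ℝ) (π √2 : ℝ) where

    c-inner : ℕ → ℝ
    c-inner k = ∑₁ k λ ℓ →
      -1^ ℓ * fromℕ ((2 ℕ.* k ∸ ℓ) C k) * (√2 ^ ℓ / ℓ) * sin ((3 ℕ.* ℓ) · π / 4)

    c-seq : ℕ → ℝ
    c-seq n = (-1^ ℕ.suc n /! n) *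
              ∑₁ n λ k → -1^ k * S n k * (fromℕ (k !) /2^ k) * c-inner k

module Submission where

-- With x = e^z - 1, an Euler transform turns the alternating sums defining b and c into
--   ∑ bₙ zⁿ = ¼ (1 + x) ∑ wₖ x^k  and  ∑ cₙ zⁿ = ½ (1 + x) ∑ vₖ x^k,
-- where wₖ = (2/π) Iₖ for even k, vₖ = Iₖ for odd k (both 0 otherwise) and Iₖ is the Wallis integral
-- of cosᵏ over [0, π/2].  All coefficients are now nonnegative, and as
-- (k + 1)(Iₖ - Iₖ₊₁) ≤ Iₖ₊₁, the Stirling recurrence gives n |π bₙ - cₙ| ≤ 2π bₙ.  Growth of b follows
-- from (2 - e^z) B′(z) = B(z).  On the analytic side, π/2 is identified with the limit of
-- the iteration x ↦ x + cos x, which gives sin at the multiples of 3π/4 and the monotonicity of Iₖ.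

open import Defs
open import Level using (_⊔_)
open import Algebra.Apartness.Bundles using (HeytingCommutativeRing)
import Algebra.Apartness.Properties.HeytingCommutativeRing as HeytingProperties
open import Algebra.Bundles using (CommutativeRing)
import Algebra.Properties.Ring as RingProperties
import Algebra.Properties.Semiring.Mult as Mult
import Algebra.Solver.Ring as RingSolver
open import Algebra.Solver.Ring.AlmostCommutativeRing using (fromCommutativeRing; _-Raw-AlmostCommutative⟶_)
open import Data.Empty using (⊥-elim)
open import Data.Fin.Base using (toℕ)
open import Data.Integer.Base as ℤ using (ℤ; +_; -[1+_]; _⊖_; +-*-rawRing)
import Data.Integer.Properties as ℤ
open import Data.Maybe.Base using (Maybe; just; nothing)
open import Data.Nat.Base as ℕ using (ℕ; zero; suc; NonZero; z≤n; s≤s; z<s; s<s)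
open import Data.Nat.Combinatorics using (_C_; nCn≡1; nC1≡n; nCk≡nC[n∸k]; nCk+nC[k+1]≡[n+1]C[k+1]; k>n⇒nCk≡0)
import Data.Nat.Properties as ℕ
open import Data.Nat.Solver using (module +-*-Solver)
open import Data.Product.Base using (Σ; ∃; _×_; _,_; proj₁; proj₂)
open import Data.Sum.Base using (_⊎_; inj₁; inj₂)
open import Function.Base using (_∘_)
import Relation.Binary.PropositionalEquality as ≡
open ≡ using (_≡_)
import Relation.Binary.Reasoning.Setoid as ≈-Reasoning
open import Relation.Nullary.Decidable.Core using (yes; no)
open import Relation.Nullary.Negation using (¬_)

-- Both defining sums alternate, with cancellation that hides even their sign. The substitution
-- helps because `2 e^(-z) - 1 = (1 - x)/(1 + x)`: the generating function of `b` becomes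
-- `¼ √((1 + x)/(1 - x))`, and that of `π bₙ - cₙ` becomes `½ (1 + x) arccos x / √(1 - x²) = ½ (1 +
-- x) ∑ (-1)^k Iₖ x^k`. The first blows up at `x = 1`, that is at `z = log 2`, while the second
-- stays regular there; this is why the ratio tends to `π`. Singularity analysis is replaced by a
-- comparison of coefficients: neighbouring `Iₖ` agree up to a relative error of order `1/k`, and
-- `d/dz = (1 + x) d/dx` converts a gain in `k` into a gain in `n`. On the analytic side `π` is
-- known only as the least positive zero of a function given by its series. The values and signs of
-- sine and cosine on the first quarter period are therefore first proved for a constructed zero of
-- the cosine. Integrals occur only as explicit antiderivatives. Since the order is not decidable,
-- strict inequalities need explicit positive lower bounds.

-- A ring solver with integer coefficients.

module IntegerSolver {c ℓ} (R : CommutativeRing c ℓ) where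

  open CommutativeRing R
  open RingProperties ring
    using (-0#≈0#; -‿distribˡ-*; -‿distribʳ-*; -‿involutive; -‿+-comm)
  open Mult semiring using (×-homo-+; ×1-homo-*) renaming (_×_ to _·_)
  open ≈-Reasoning setoid

  -- Unlike n · 1#, this interprets the numeral 1 as 1# itself.
  ⟦_⟧ : ℤ → Carrier
  ⟦ + 0 ⟧           = 0#
  ⟦ + 1 ⟧           = 1#
  ⟦ + suc (suc n) ⟧ = suc (suc n) · 1#
  ⟦ -[1+ 0 ] ⟧      = - 1#
  ⟦ -[1+ suc n ] ⟧  = - (suc (suc n) · 1#)

  ⟦+⟧ : ∀ n → ⟦ + n ⟧ ≈ n · 1#
  ⟦+⟧ 0             = refl
  ⟦+⟧ 1             = sym (+-identityʳ 1#)
  ⟦+⟧ (suc (suc n)) = refl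

  ⟦-⟧ : ∀ n → ⟦ -[1+ n ] ⟧ ≈ - (suc n · 1#)
  ⟦-⟧ 0       = -‿cong (sym (+-identityʳ 1#))
  ⟦-⟧ (suc n) = refl

  cancel : ∀ x y z → (x + y) - (x + z) ≈ y - z
  cancel x y z = begin
    (x + y) - (x + z)         ≈⟨ +-cong (+-comm x y) (sym (-‿+-comm x z)) ⟩
    (y + x) + (- x + - z)     ≈⟨ +-assoc y x _ ⟩
    y + (x + (- x + - z))     ≈⟨ +-congˡ (+-assoc x (- x) (- z)) ⟨
    y + ((x - x) + - z)       ≈⟨ +-congˡ (+-congʳ (-‿inverseʳ x)) ⟩
    y + (0# + - z)            ≈⟨ +-congˡ (+-identityˡ (- z)) ⟩
    y - z                     ∎

  ⟦⊖⟧ : ∀ m n → ⟦ m ⊖ n ⟧ ≈ m · 1# - n · 1#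
  ⟦⊖⟧ zero    zero    = sym (-‿inverseʳ 0#)
  ⟦⊖⟧ zero    (suc n) = trans (⟦-⟧ n) (sym (+-identityˡ _))
  ⟦⊖⟧ (suc m) zero    = trans (⟦+⟧ (suc m)) (sym (trans (+-congˡ -0#≈0#) (+-identityʳ _)))
  ⟦⊖⟧ (suc m) (suc n) = begin
    ⟦ suc m ⊖ suc n ⟧          ≡⟨ ≡.cong ⟦_⟧ (ℤ.[1+m]⊖[1+n]≡m⊖n m n) ⟩
    ⟦ m ⊖ n ⟧                  ≈⟨ ⟦⊖⟧ m n ⟩
    m · 1# - n · 1#            ≈⟨ cancel 1# _ _ ⟨
    suc m · 1# - suc n · 1#    ∎

  neg-homo : ∀ i → ⟦ ℤ.- i ⟧ ≈ - ⟦ i ⟧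
  neg-homo (+ zero)  = sym -0#≈0#
  neg-homo (+ suc n) = trans (⟦-⟧ n) (-‿cong (sym (⟦+⟧ (suc n))))
  neg-homo -[1+ n ]  = trans (⟦+⟧ (suc n)) (trans (sym (-‿involutive _)) (-‿cong (sym (⟦-⟧ n))))

  +-homo : ∀ i j → ⟦ i ℤ.+ j ⟧ ≈ ⟦ i ⟧ + ⟦ j ⟧
  +-homo (+ m)    (+ n)    = trans (⟦+⟧ (m ℕ.+ n))
    (trans (×-homo-+ 1# m n) (sym (+-cong (⟦+⟧ m) (⟦+⟧ n))))
  +-homo (+ m)    -[1+ n ] = trans (⟦⊖⟧ m (suc n)) (sym (+-cong (⟦+⟧ m) (⟦-⟧ n)))
  +-homo -[1+ m ] (+ n)    = trans (⟦⊖⟧ n (suc m))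
    (trans (+-comm _ _) (sym (+-cong (⟦-⟧ m) (⟦+⟧ n))))
  +-homo -[1+ m ] -[1+ n ] = begin
    - (suc (suc (m ℕ.+ n)) · 1#)             ≈⟨ -‿cong (+-congˡ (×-homo-+ 1# (suc m) n)) ⟩
    - (1# + (suc m · 1# + n · 1#))           ≈⟨ -‿cong (+-comm _ _) ⟩
    - ((suc m · 1# + n · 1#) + 1#)           ≈⟨ -‿cong (+-assoc _ _ _) ⟩
    - (suc m · 1# + (n · 1# + 1#))           ≈⟨ -‿cong (+-congˡ (+-comm _ _)) ⟩
    - (suc m · 1# + suc n · 1#)              ≈⟨ -‿+-comm _ _ ⟨
    - (suc m · 1#) + - (suc n · 1#)          ≈⟨ +-cong (⟦-⟧ m) (⟦-⟧ n) ⟨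
    ⟦ -[1+ m ] ⟧ + ⟦ -[1+ n ] ⟧              ∎

  +*-homo : ∀ m n → ⟦ + (m ℕ.* n) ⟧ ≈ (m · 1#) * (n · 1#)
  +*-homo m n = trans (⟦+⟧ (m ℕ.* n)) (×1-homo-* m n)

  *-homo : ∀ i j → ⟦ i ℤ.* j ⟧ ≈ ⟦ i ⟧ * ⟦ j ⟧
  *-homo (+ m)    (+ n)    = begin
    ⟦ + m ℤ.* + n ⟧          ≡⟨ ≡.cong ⟦_⟧ (ℤ.+◃n≡+n (m ℕ.* n)) ⟩
    ⟦ + (m ℕ.* n) ⟧          ≈⟨ +*-homo m n ⟩
    (m · 1#) * (n · 1#)      ≈⟨ *-cong (⟦+⟧ m) (⟦+⟧ n) ⟨
    ⟦ + m ⟧ * ⟦ + n ⟧        ∎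
  *-homo (+ m)    -[1+ n ] = begin
    ⟦ + m ℤ.* -[1+ n ] ⟧          ≡⟨ ≡.cong ⟦_⟧ (ℤ.-◃n≡-n (m ℕ.* suc n)) ⟩
    ⟦ ℤ.- (+ (m ℕ.* suc n)) ⟧     ≈⟨ neg-homo (+ (m ℕ.* suc n)) ⟩
    - ⟦ + (m ℕ.* suc n) ⟧         ≈⟨ -‿cong (+*-homo m (suc n)) ⟩
    - ((m · 1#) * (suc n · 1#))   ≈⟨ -‿distribʳ-* _ _ ⟩
    (m · 1#) * - (suc n · 1#)     ≈⟨ *-cong (⟦+⟧ m) (⟦-⟧ n) ⟨
    ⟦ + m ⟧ * ⟦ -[1+ n ] ⟧        ∎
  *-homo -[1+ m ] (+ n)    = begin
    ⟦ -[1+ m ] ℤ.* + n ⟧          ≡⟨ ≡.cong ⟦_⟧ (ℤ.-◃n≡-n (suc m ℕ.* n)) ⟩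
    ⟦ ℤ.- (+ (suc m ℕ.* n)) ⟧     ≈⟨ neg-homo (+ (suc m ℕ.* n)) ⟩
    - ⟦ + (suc m ℕ.* n) ⟧         ≈⟨ -‿cong (+*-homo (suc m) n) ⟩
    - ((suc m · 1#) * (n · 1#))   ≈⟨ -‿distribˡ-* _ _ ⟩
    - (suc m · 1#) * (n · 1#)     ≈⟨ *-cong (⟦-⟧ m) (⟦+⟧ n) ⟨
    ⟦ -[1+ m ] ⟧ * ⟦ + n ⟧        ∎
  *-homo -[1+ m ] -[1+ n ] = begin
    ⟦ -[1+ m ] ℤ.* -[1+ n ] ⟧             ≡⟨ ≡.cong ⟦_⟧ (ℤ.+◃n≡+n (suc m ℕ.* suc n)) ⟩
    ⟦ + (suc m ℕ.* suc n) ⟧               ≈⟨ +*-homo (suc m) (suc n) ⟩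
    (suc m · 1#) * (suc n · 1#)           ≈⟨ -‿involutive _ ⟨
    - - ((suc m · 1#) * (suc n · 1#))     ≈⟨ -‿cong (-‿distribʳ-* _ _) ⟩
    - ((suc m · 1#) * - (suc n · 1#))     ≈⟨ -‿distribˡ-* _ _ ⟩
    - (suc m · 1#) * - (suc n · 1#)       ≈⟨ *-cong (⟦-⟧ m) (⟦-⟧ n) ⟨
    ⟦ -[1+ m ] ⟧ * ⟦ -[1+ n ] ⟧           ∎

  -- Equality in the field is not decidable, so normal forms are computed over `ℤ`, where
  -- coefficients can be compared, and mapped back.
  homomorphism : +-*-rawRing -Raw-AlmostCommutative⟶ fromCommutativeRing R
  homomorphism = record
    { ⟦_⟧    = ⟦_⟧
    ; +-homo = +-homo
    ; *-homo = *-homo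
    ; -‿homo = neg-homo
    ; 0-homo = refl
    ; 1-homo = refl
    }

  ⟦⟧-≟ : ∀ i j → Maybe (⟦ i ⟧ ≈ ⟦ j ⟧)
  ⟦⟧-≟ i j with i ℤ.≟ j
  ... | yes i≡j = just (reflexive (≡.cong ⟦_⟧ i≡j))
  ... | no _    = nothing

  open RingSolver +-*-rawRing (fromCommutativeRing R) homomorphism ⟦⟧-≟ public
    hiding (⟦_⟧)

-- Constructive order arithmetic.

module Inequalities {c ℓ₁ ℓ₂ ℓ₃} (R : RealField c ℓ₁ ℓ₂ ℓ₃) where

  open Reals R hiding (zero)
  open HeytingCommutativeRing heytingCommutativeRing using (commutativeRing)
  open CommutativeRing commutativeRing using (semiring)
  open HeytingProperties heytingCommutativeRing using (1#0; x-0≈x; invertibleˡ⇒#)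
  open Mult semiring using (×-homo-+; ×1-homo-*)
  open IntegerSolver commutativeRing public using (solve; _:=_; _:+_; _:*_; _:-_; :-_; con)
  open ≈-Reasoning setoid

  infix 4 _≤_ ∣_∣≤_

  -- As a negation, this relation can be proved by contradiction; it yields no decision between
  -- `x < y` and `x ≈ y`.
  _≤_ : ℝ → ℝ → Set ℓ₃
  x ≤ y = ¬ (y < x)

  -- Cotransitivity of apartness separates `z` from `x` or from `y`. If the separation has the
  -- unwanted direction, transitivity with `x < y` gives the other alternative.
  <-cotrans : ∀ {x y} z → x < y → x < z ⊎ z < y
  <-cotrans z x<y with #-cotrans (<⇒# x<y) z
  ... | inj₁ x#z with #⇒<⊎> x#z
  ...   | inj₁ x<z = inj₁ x<z
  ...   | inj₂ z<x = inj₂ (<-trans z<x x<y)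
  <-cotrans z x<y | inj₂ z#y with #⇒<⊎> z#y
  ...   | inj₁ z<y = inj₂ z<y
  ...   | inj₂ y<z = inj₁ (<-trans x<y y<z)

  <⇒≤ : ∀ {x y} → x < y → x ≤ y
  <⇒≤ x<y y<x = <-asym x<y y<x

  ≈⇒≤ : ∀ {x y} → x ≈ y → x ≤ y
  ≈⇒≤ x≈y = <-irrefl (sym x≈y)

  ≤-refl : ∀ {x} → x ≤ x
  ≤-refl = ≈⇒≤ refl

  <-≤-trans : ∀ {x y z} → x < y → y ≤ z → x < z
  <-≤-trans {z = z} x<y y≤z with <-cotrans z x<y
  ... | inj₁ x<z = x<z
  ... | inj₂ z<y = ⊥-elim (y≤z z<y)

  ≤-<-trans : ∀ {x y z} → x ≤ y → y < z → x < z
  ≤-<-trans {x} x≤y y<z with <-cotrans x y<z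
  ... | inj₁ y<x = ⊥-elim (x≤y y<x)
  ... | inj₂ x<z = x<z

  ≤-trans : ∀ {x y z} → x ≤ y → y ≤ z → x ≤ z
  ≤-trans x≤y y≤z z<x = y≤z (<-≤-trans z<x x≤y)

  ≤-resp : ∀ {x x′ y y′} → x ≈ x′ → y ≈ y′ → x ≤ y → x′ ≤ y′
  ≤-resp x≈x′ y≈y′ x≤y = ≤-trans (≈⇒≤ (sym x≈x′)) (≤-trans x≤y (≈⇒≤ y≈y′))

  ≤-respˡ : ∀ {x x′ y} → x ≈ x′ → x ≤ y → x′ ≤ y
  ≤-respˡ x≈x′ = ≤-resp x≈x′ refl

  ≤-respʳ : ∀ {x y y′} → y ≈ y′ → x ≤ y → x ≤ y′
  ≤-respʳ = ≤-resp refl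

  ≮⇒≈ : ∀ {x y} → x ≤ y → y ≤ x → x ≈ y
  ≮⇒≈ {x} {y} x≤y y≤x = proj₁ (tight x y) λ x#y → case (#⇒<⊎> x#y)
    where
    case : x < y ⊎ y < x → _
    case (inj₁ x<y) = y≤x x<y
    case (inj₂ y<x) = x≤y y<x

  <⇒0<- : ∀ {x y} → x < y → 0# < y - x
  <⇒0<- {x} x<y = <-respˡ-≈ (-‿inverseʳ x) (+-monoˡ-< (- x) x<y)

  0<-⇒< : ∀ {x y} → 0# < y - x → x < y
  0<-⇒< {x} {y} p = <-respˡ-≈ (+-identityˡ x)
    (<-respʳ-≈ (solve 2 (λ x y → (y :- x) :+ x := y) refl x y) (+-monoˡ-< x p))

  -- With `≤-by`, the standard way to certify an inequality here: the difference of the two sides is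
  -- written as an expression with visible sign, and the ring solver checks the identity.
  <-by : ∀ {x y e} → 0# < e → y - x ≈ e → x < y
  <-by 0<e eq = 0<-⇒< (<-respʳ-≈ (sym eq) 0<e)

  ≤-by : ∀ {x y e} → 0# ≤ e → y - x ≈ e → x ≤ y
  ≤-by {x} {y} 0≤e eq y<x = 0≤e (<-by (<⇒0<- y<x)
    (trans (+-congˡ (-‿cong (sym eq))) (solve 2 (λ x y → con (+ 0) :- (y :- x) := x :- y) refl x y)))

  ≤⇒0≤- : ∀ {x y} → x ≤ y → 0# ≤ y - x
  ≤⇒0≤- {x} {y} x≤y p = x≤y (<-by (<⇒0<- p) (solve 2 (λ x y → x :- y := con (+ 0) :- (y :- x)) refl x y))

  +-mono-≤ : ∀ {x y u v} → x ≤ y → u ≤ v → x + u ≤ y + v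
  +-mono-≤ {x} {y} {u} {v} x≤y u≤v = ≤-trans
    (≤-by (≤⇒0≤- x≤y) (solve 3 (λ x y u → (y :+ u) :- (x :+ u) := y :- x) refl x y u))
    (≤-by (≤⇒0≤- u≤v) (solve 3 (λ y u v → (y :+ v) :- (y :+ u) := v :- u) refl y u v))

  +-mono-<-≤ : ∀ {x y u v} → x < y → u ≤ v → x + u < y + v
  +-mono-<-≤ {x} {y} {u} {v} x<y u≤v = <-≤-trans (+-monoˡ-< u x<y) (+-mono-≤ ≤-refl u≤v)

  0≤+ : ∀ {x y} → 0# ≤ x → 0# ≤ y → 0# ≤ x + y
  0≤+ 0≤x 0≤y = ≤-respˡ (+-identityˡ 0#) (+-mono-≤ 0≤x 0≤y)

  0<+ : ∀ {x y} → 0# < x → 0# ≤ y → 0# < x + y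
  0<+ 0<x 0≤y = <-respˡ-≈ (+-identityˡ 0#) (+-mono-<-≤ 0<x 0≤y)

  neg-mono-≤ : ∀ {x y} → x ≤ y → - y ≤ - x
  neg-mono-≤ {x} {y} x≤y = ≤-by (≤⇒0≤- x≤y) (solve 2 (λ x y → :- x :- :- y := y :- x) refl x y)

  recip : ∀ {y} → y # 0# → ℝ
  recip y#0 = proj₁ (#⇒invertible y#0)

  recip-inverseʳ : ∀ {y} (y#0 : y # 0#) → y * recip y#0 ≈ 1#
  recip-inverseʳ y#0 = trans (*-congʳ (sym (x-0≈x _))) (proj₂ (proj₂ (#⇒invertible y#0)))

  divide-cancel : ∀ x {y} (y#0 : y # 0#) → divide x y y#0 * y ≈ x
  divide-cancel x {y} y#0 = begin
    (x * recip y#0) * y   ≈⟨ solve 3 (λ x y z → (x :* z) :* y := (y :* z) :* x) refl x y (recip y#0) ⟩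
    (y * recip y#0) * x   ≈⟨ *-congʳ (recip-inverseʳ y#0) ⟩
    1# * x                ≈⟨ *-identityˡ x ⟩
    x                     ∎

  >⇒#0 : ∀ {x} → 0# < x → x # 0#
  >⇒#0 0<x = #-sym (<⇒# 0<x)

  *-cancelˡ : ∀ x {y z} → x # 0# → x * y ≈ x * z → y ≈ z
  *-cancelˡ x {y} {z} x#0 eq = begin
    y                    ≈⟨ unit y ⟩
    recip x#0 * (x * y)  ≈⟨ *-congˡ eq ⟩
    recip x#0 * (x * z)  ≈⟨ unit z ⟨
    z                    ∎
    where
    unit : ∀ y → y ≈ recip x#0 * (x * y)
    unit y = begin
      y                    ≈⟨ *-identityˡ y ⟨
      1# * y               ≈⟨ *-congʳ (recip-inverseʳ x#0) ⟨
      (x * recip x#0) * y  ≈⟨ solve 3 (λ x y z → (x :* z) :* y := z :* (x :* y)) refl x y (recip x#0) ⟩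
      recip x#0 * (x * y)  ∎

  -- A factor of an invertible element is invertible, the inverse of `x` being `y / (x y)`.
  *#0⇒#0 : ∀ x y → x * y # 0# → x # 0#
  *#0⇒#0 x y xy#0 = invertibleˡ⇒# (y * recip xy#0 , (begin
    (y * recip xy#0) * (x - 0#)  ≈⟨ *-congˡ (x-0≈x x) ⟩
    (y * recip xy#0) * x         ≈⟨ solve 3 (λ x y z → (y :* z) :* x := (x :* y) :* z) refl x y (recip xy#0) ⟩
    (x * y) * recip xy#0         ≈⟨ recip-inverseʳ xy#0 ⟩
    1#                           ∎))

  -- Were the product negative, both factors would be apart from zero, hence strictly positive, and
  -- `*-pos` would contradict the assumption.
  0≤* : ∀ {x y} → 0# ≤ x → 0# ≤ y → 0# ≤ x * y
  0≤* {x} {y} 0≤x 0≤y xy<0 = <-asym xy<0 (*-pos (pos 0≤x (*#0⇒#0 x y (<⇒# xy<0)))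
    (pos 0≤y (*#0⇒#0 y x (<⇒# (<-respˡ-≈ (*-comm x y) xy<0)))))
    where
    pos : ∀ {z} → 0# ≤ z → z # 0# → 0# < z
    pos 0≤z z#0 with #⇒<⊎> z#0
    ... | inj₁ z<0 = ⊥-elim (0≤z z<0)
    ... | inj₂ 0<z = 0<z

  *-monoʳ-≤ : ∀ z {x y} → 0# ≤ z → x ≤ y → z * x ≤ z * y
  *-monoʳ-≤ z {x} {y} 0≤z x≤y = ≤-by (0≤* 0≤z (≤⇒0≤- x≤y))
    (solve 3 (λ x y z → z :* y :- z :* x := z :* (y :- x)) refl x y z)

  *-monoˡ-≤ : ∀ z {x y} → 0# ≤ z → x ≤ y → x * z ≤ y * z
  *-monoˡ-≤ z 0≤z x≤y = ≤-resp (*-comm z _) (*-comm z _) (*-monoʳ-≤ z 0≤z x≤y)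

  *-mono-≤ : ∀ {x y u v} → 0# ≤ u → 0# ≤ y → x ≤ y → u ≤ v → x * u ≤ y * v
  *-mono-≤ {y = y} {u} 0≤u 0≤y x≤y u≤v = ≤-trans (*-monoˡ-≤ u 0≤u x≤y) (*-monoʳ-≤ y 0≤y u≤v)

  *-monoʳ-< : ∀ z {x y} → 0# < z → x < y → z * x < z * y
  *-monoʳ-< z {x} {y} 0<z x<y = <-by (*-pos 0<z (<⇒0<- x<y))
    (solve 3 (λ x y z → z :* y :- z :* x := z :* (y :- x)) refl x y z)

  *-cancelˡ-≤ : ∀ z {x y} → 0# < z → z * x ≤ z * y → x ≤ y
  *-cancelˡ-≤ z 0<z zx≤zy y<x = zx≤zy (*-monoʳ-< z 0<z y<x)

  -- The order cannot be decided, but positivity of `(y - x) z` makes `y - x` apart from zero, and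
  -- an element apart from zero has a sign.
  *-cancelˡ-< : ∀ z {x y} → 0# < z → z * x < z * y → x < y
  *-cancelˡ-< z {x} {y} 0<z zx<zy = case (#⇒<⊎> (*#0⇒#0 (y - x) z (>⇒#0 0<[y-x]z)))
    where
    0<[y-x]z : 0# < (y - x) * z
    0<[y-x]z = <-respʳ-≈ (solve 3 (λ x y z → z :* y :- z :* x := (y :- x) :* z) refl x y z) (<⇒0<- zx<zy)

    case : y - x < 0# ⊎ 0# < y - x → x < y
    case (inj₂ p) = 0<-⇒< p
    case (inj₁ p) = ⊥-elim (<-asym zx<zy (*-monoʳ-< z 0<z (<-by (<⇒0<- p)
      (solve 2 (λ x y → x :- y := con (+ 0) :- (y :- x)) refl x y))))

  0<recip : ∀ {x} (x#0 : x # 0#) → 0# < x → 0# < recip x#0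
  0<recip {x} x#0 0<x = *-cancelˡ-< x 0<x
    (<-respˡ-≈ (sym (zeroʳ x)) (<-respʳ-≈ (sym (recip-inverseʳ x#0)) 0<1))

  0≤square : ∀ x → 0# ≤ x * x
  0≤square x xx<0 with #⇒<⊎> (*#0⇒#0 x x (<⇒# xx<0))
  ... | inj₂ 0<x = <-asym xx<0 (*-pos 0<x 0<x)
  ... | inj₁ x<0 = <-asym xx<0 (<-respʳ-≈ (solve 1 (λ x → (con (+ 0) :- x) :* (con (+ 0) :- x) := x :* x) refl x)
                     (*-pos (<⇒0<- x<0) (<⇒0<- x<0)))

  -- A case distinction that is sound although the order is undecidable: the conclusion is a
  -- negation, so a counterexample `v < u` refutes `y < x` through `g`, which is exactly the
  -- hypothesis of `f`.
  ≤-cases : ∀ x y {u v} → (x ≤ y → u ≤ v) → (y ≤ x → u ≤ v) → u ≤ v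
  ≤-cases x y f g v<u = f (λ y<x → g (<⇒≤ y<x) v<u) v<u

  0≤1 : 0# ≤ 1#
  0≤1 = <⇒≤ 0<1

  fromℕ-+ : ∀ m n → fromℕ (m ℕ.+ n) ≈ fromℕ m + fromℕ n
  fromℕ-+ = ×-homo-+ 1#

  fromℕ-* : ∀ m n → fromℕ (m ℕ.* n) ≈ fromℕ m * fromℕ n
  fromℕ-* = ×1-homo-*

  0≤fromℕ : ∀ n → 0# ≤ fromℕ n
  0≤fromℕ zero    = ≤-refl
  0≤fromℕ (suc n) = <⇒≤ (fromℕ-pos n)

  fromℕ-mono : ∀ {m n} → m ℕ.≤ n → fromℕ m ≤ fromℕ n
  fromℕ-mono {n = n} z≤n = 0≤fromℕ n
  fromℕ-mono (s≤s m≤n)   = +-mono-≤ ≤-refl (fromℕ-mono m≤n)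

  fromℕ-suc#0 : ∀ n → fromℕ (suc n) # 0#
  fromℕ-suc#0 n = >⇒#0 (fromℕ-pos n)

  /-cancel : ∀ x n .{{_ : NonZero n}} → (x / n) * fromℕ n ≈ x
  /-cancel x n = divide-cancel x (fromℕ#0 n)

  -- If `x` were positive, some natural number would exceed `K / x`. This replaces many passages to
  -- the limit: an estimate of order `1/n` is multiplied out instead.
  bounded-multiples : ∀ x K → (∀ n → fromℕ n * x ≤ K) → x ≤ 0#
  bounded-multiples x K nx≤K 0<x with archimedean (K * recip (>⇒#0 0<x))
  ... | n , K/x<n = nx≤K n (<-respˡ-≈ eq (<-respʳ-≈ (*-comm x _) (*-monoʳ-< x 0<x K/x<n)))
    where
    eq : x * (K * recip (>⇒#0 0<x)) ≈ K
    eq = trans (*-comm x _) (divide-cancel K (>⇒#0 0<x))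

  -- Absolute values occur only inside bounds, so a pair of inequalities suffices and no maximum has
  -- to be constructed.
  ∣_∣≤_ : ℝ → ℝ → Set ℓ₃
  ∣ x ∣≤ a = - a ≤ x × x ≤ a

  ∣∣≤-resp : ∀ {x y a b} → x ≈ y → a ≈ b → ∣ x ∣≤ a → ∣ y ∣≤ b
  ∣∣≤-resp x≈y a≈b (p , q) = ≤-resp (-‿cong a≈b) x≈y p , ≤-resp x≈y a≈b q

  ∣∣≤-weaken : ∀ {x a b} → a ≤ b → ∣ x ∣≤ a → ∣ x ∣≤ b
  ∣∣≤-weaken a≤b (p , q) = ≤-trans (neg-mono-≤ a≤b) p , ≤-trans q a≤b

  ∣+∣≤ : ∀ {x y a b} → ∣ x ∣≤ a → ∣ y ∣≤ b → ∣ x + y ∣≤ a + b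
  ∣+∣≤ {x} {y} {a} {b} (p , q) (r , s) =
    ≤-respˡ (solve 2 (λ a b → :- a :+ :- b := :- (a :+ b)) refl a b) (+-mono-≤ p r) , +-mono-≤ q s

  ∣-∣≤ : ∀ {x a} → ∣ x ∣≤ a → ∣ - x ∣≤ a
  ∣-∣≤ {x} {a} (p , q) = neg-mono-≤ q ,
    ≤-by (≤⇒0≤- p) (solve 2 (λ x a → a :- :- x := x :- :- a) refl x a)

  -- No signs are inspected: `2 (a b + x y) = (a + x)(b + y) + (a - x)(b - y)`, and similarly for `2
  -- (a b - x y)`, with every factor nonnegative.
  ∣*∣≤ : ∀ {x y a b} → ∣ x ∣≤ a → ∣ y ∣≤ b → ∣ x * y ∣≤ a * b
  ∣*∣≤ {x} {y} {a} {b} (p , q) (r , s) = half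
    (≤-by (0≤+ (0≤* (≤⇒0≤- p) (≤⇒0≤- r)) (0≤* (≤⇒0≤- q) (≤⇒0≤- s)))
      (solve 4 (λ x y a b → con (+ 2) :* (x :* y) :- con (+ 2) :* (:- (a :* b))
        := (x :- :- a) :* (y :- :- b) :+ (a :- x) :* (b :- y)) refl x y a b)) ,
    half (≤-by (0≤+ (0≤* (≤⇒0≤- p) (≤⇒0≤- s)) (0≤* (≤⇒0≤- q) (≤⇒0≤- r)))
      (solve 4 (λ x y a b → con (+ 2) :* (a :* b) :- con (+ 2) :* (x :* y)
        := (x :- :- a) :* (b :- y) :+ (a :- x) :* (y :- :- b)) refl x y a b))
    where
    half : ∀ {u v} → fromℕ 2 * u ≤ fromℕ 2 * v → u ≤ v
    half = *-cancelˡ-≤ (fromℕ 2) (fromℕ-pos 1)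

  0≤⇒∣∣≤ : ∀ {x} → 0# ≤ x → ∣ x ∣≤ x
  0≤⇒∣∣≤ {x} 0≤x = ≤-by (0≤+ 0≤x 0≤x) (solve 1 (λ x → x :- :- x := x :+ x) refl x) , ≤-refl

  ∣∣≤⇒0≤ : ∀ {x a} → ∣ x ∣≤ a → 0# ≤ a
  ∣∣≤⇒0≤ {x} {a} (p , q) = *-cancelˡ-≤ (fromℕ 2) (fromℕ-pos 1) (≤-by (0≤+ (≤⇒0≤- p) (≤⇒0≤- q))
    (solve 2 (λ x a → con (+ 2) :* a :- con (+ 2) :* con (+ 0) := (x :- :- a) :+ (a :- x)) refl x a))

  -- A bound on the size of `x` that is a polynomial in `x`, because
  -- `2 + 2x² ∓ 2x = 1 + x² + (1 ∓ x)²`.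
  ∣∣≤1+square : ∀ x → ∣ x ∣≤ 1# + x * x
  ∣∣≤1+square x = half (≤-by (0≤+ 0≤1 (0≤+ (0≤square x) (0≤square (1# + x))))
      (solve 1 (λ x → con (+ 2) :* x :- con (+ 2) :* (:- (con (+ 1) :+ x :* x))
        := con (+ 1) :+ (x :* x :+ (con (+ 1) :+ x) :* (con (+ 1) :+ x))) refl x)) ,
    half (≤-by (0≤+ 0≤1 (0≤+ (0≤square x) (0≤square (1# - x))))
      (solve 1 (λ x → con (+ 2) :* (con (+ 1) :+ x :* x) :- con (+ 2) :* x
        := con (+ 1) :+ (x :* x :+ (con (+ 1) :- x) :* (con (+ 1) :- x))) refl x))
    where
    half : ∀ {u v} → fromℕ 2 * u ≤ fromℕ 2 * v → u ≤ v
    half = *-cancelˡ-≤ (fromℕ 2) (fromℕ-pos 1)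

  0<1+square : ∀ x → 0# < 1# + x * x
  0<1+square x = 0<+ 0<1 (0≤square x)

-- Finite sums and limits of sequences.

module SumsAndLimits {c ℓ₁ ℓ₂ ℓ₃} (R : RealField c ℓ₁ ℓ₂ ℓ₃) where

  open Reals R hiding (zero)
  open Inequalities R
  open ≈-Reasoning setoid

  -- Opaque, so that the summand can be inferred from the sum.
  opaque
    ∑< : ℕ → (ℕ → ℝ) → ℝ
    ∑< n f = sum {n} λ i → f (toℕ i)

    ∑-unfold : ∀ n (f : ℕ → ℝ) → sum {n} (λ i → f (toℕ i)) ≈ ∑< n f
    ∑-unfold n f = refl

    ∑-empty : ∀ (f : ℕ → ℝ) → ∑< zero f ≈ 0#
    ∑-empty f = refl

    ∑-first : ∀ n (f : ℕ → ℝ) → ∑< (suc n) f ≈ f 0 + ∑< n (f ∘ suc)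
    ∑-first n f = refl

    ∑-cong< : ∀ n {f g : ℕ → ℝ} → (∀ k → k ℕ.< n → f k ≈ g k) → ∑< n f ≈ ∑< n g
    ∑-cong< zero    f≈g = refl
    ∑-cong< (suc n) {f} {g} f≈g = +-cong (f≈g 0 z<s) (∑-cong< n {f ∘ suc} {g ∘ suc} λ k k<n → f≈g (suc k) (s<s k<n))

    ∑-last : ∀ n (f : ℕ → ℝ) → ∑< (suc n) f ≈ ∑< n f + f n
    ∑-last zero    f = +-comm (f 0) 0#
    ∑-last (suc n) f = trans (+-congˡ (∑-last n (f ∘ suc))) (sym (+-assoc _ _ _))

    ∑-+ : ∀ n (f g : ℕ → ℝ) → ∑< n (λ k → f k + g k) ≈ ∑< n f + ∑< n g
    ∑-+ zero    f g = sym (+-identityˡ 0#)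
    ∑-+ (suc n) f g = trans (+-congˡ (∑-+ n (f ∘ suc) (g ∘ suc)))
      (solve 4 (λ a b c d → (a :+ b) :+ (c :+ d) := (a :+ c) :+ (b :+ d)) refl _ _ _ _)

    ∑-*ˡ : ∀ n x (f : ℕ → ℝ) → ∑< n (λ k → x * f k) ≈ x * ∑< n f
    ∑-*ˡ zero    x f = sym (zeroʳ x)
    ∑-*ˡ (suc n) x f = trans (+-congˡ (∑-*ˡ n x (f ∘ suc))) (sym (distribˡ x _ _))

    ∑-zero : ∀ n {f : ℕ → ℝ} → (∀ k → f k ≈ 0#) → ∑< n f ≈ 0#
    ∑-zero zero    f≈0 = refl
    ∑-zero (suc n) {f} f≈0 = trans (+-cong (f≈0 0) (∑-zero n {f ∘ suc} (f≈0 ∘ suc))) (+-identityˡ 0#)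

    ∑-mono : ∀ n {f g : ℕ → ℝ} → (∀ k → f k ≤ g k) → ∑< n f ≤ ∑< n g
    ∑-mono zero    f≤g = ≤-refl
    ∑-mono (suc n) {f} {g} f≤g = +-mono-≤ (f≤g 0) (∑-mono n {f ∘ suc} {g ∘ suc} (f≤g ∘ suc))

    0≤∑ : ∀ n {f : ℕ → ℝ} → (∀ k → 0# ≤ f k) → 0# ≤ ∑< n f
    0≤∑ zero    0≤f = ≤-refl
    0≤∑ (suc n) {f} 0≤f = 0≤+ (0≤f 0) (0≤∑ n {f ∘ suc} (0≤f ∘ suc))

    ∣∑∣≤ : ∀ n {f g : ℕ → ℝ} → (∀ k → ∣ f k ∣≤ g k) → ∣ ∑< n f ∣≤ ∑< n g
    ∣∑∣≤ zero    f≤g = 0≤⇒∣∣≤ ≤-refl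
    ∣∑∣≤ (suc n) {f} {g} f≤g = ∣+∣≤ (f≤g 0) (∣∑∣≤ n {f ∘ suc} {g ∘ suc} (f≤g ∘ suc))

    ∑-mono-bound : ∀ {m n} {f : ℕ → ℝ} → (∀ k → 0# ≤ f k) → m ℕ.≤ n → ∑< m f ≤ ∑< n f
    ∑-mono-bound {n = n} {f} 0≤f z≤n = 0≤∑ n {f} 0≤f
    ∑-mono-bound {f = f} 0≤f (s≤s m≤n) = +-mono-≤ ≤-refl (∑-mono-bound {f = f ∘ suc} (0≤f ∘ suc) m≤n)

  ∑-cong : ∀ n {f g : ℕ → ℝ} → (∀ k → f k ≈ g k) → ∑< n f ≈ ∑< n g
  ∑-cong n f≈g = ∑-cong< n λ k _ → f≈g k

  ∑-+* : ∀ n x (f g : ℕ → ℝ) → ∑< n (λ k → f k + x * g k) ≈ ∑< n f + x * ∑< n g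
  ∑-+* n x f g = trans (∑-+ n f (λ k → x * g k)) (+-congˡ (∑-*ˡ n x g))

  lim-≤ : ∀ {u : ℕ → ℝ} {l b} → u ⟶ l → ∀ N → (∀ n → N ℕ.≤ n → u n ≤ b) → l ≤ b
  lim-≤ {u} {l} {b} u⟶l N u≤b b<l = u≤b n N≤n b<un
    where
    close = u⟶l (l - b) (<⇒0<- b<l)
    n     = N ℕ.⊔ proj₁ close
    N≤n   = ℕ.m≤m⊔n N (proj₁ close)

    b<un : b < u n
    b<un = <-by (<⇒0<- (proj₁ (proj₂ close n (ℕ.m≤n⊔m N (proj₁ close)))))
      (solve 3 (λ u l b → u :- b := (u :- l) :- (:- (l :- b))) refl (u n) l b)

  lim-+* : ∀ {u v : ℕ → ℝ} {l m} k → u ⟶ l → v ⟶ m → (λ n → u n + k * v n) ⟶ l + k * m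
  lim-+* {u} {v} {l} {m} k u⟶l v⟶m ε 0<ε = N , close
    where
    -- `H` bounds the size of `k`, so a tolerance `δ` with `δ + H δ = ε` serves both sequences.
    H = 1# + k * k
    0<1+H : 0# < 1# + H
    0<1+H = 0<+ 0<1 (<⇒≤ (0<1+square k))
    δ = divide ε (1# + H) (>⇒#0 0<1+H)
    0<δ : 0# < δ
    0<δ = *-pos 0<ε (0<recip (>⇒#0 0<1+H) 0<1+H)
    δ+Hδ≈ε : δ + H * δ ≈ ε
    δ+Hδ≈ε = trans (solve 2 (λ d h → d :+ h :* d := d :* (con (+ 1) :+ h)) refl δ H)
      (divide-cancel ε (>⇒#0 0<1+H))
    N = proj₁ (u⟶l δ 0<δ) ℕ.⊔ proj₁ (v⟶m δ 0<δ)

    close : ∀ n → N ℕ.≤ n → Within ε (u n + k * v n) (l + k * m)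
    close n N≤n = lower , upper
      where
      cu = proj₂ (u⟶l δ 0<δ) n (ℕ.m⊔n≤o⇒m≤o _ _ N≤n)
      cv = proj₂ (v⟶m δ 0<δ) n (ℕ.m⊔n≤o⇒n≤o _ _ N≤n)
      kv : ∣ k * (v n - m) ∣≤ H * δ
      kv = ∣*∣≤ (∣∣≤1+square k) (<⇒≤ (proj₁ cv) , <⇒≤ (proj₂ cv))
      split : (u n - l) + k * (v n - m) ≈ (u n + k * v n) - (l + k * m)
      split = solve 5 (λ u v l m k → (u :- l) :+ k :* (v :- m) := (u :+ k :* v) :- (l :+ k :* m))
        refl (u n) (v n) l m k
      lower : - ε < (u n + k * v n) - (l + k * m)
      lower = <-respˡ-≈ (trans (solve 2 (λ d h → :- d :+ :- (h :* d) := :- (d :+ h :* d)) refl δ H) (-‿cong δ+Hδ≈ε))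
        (<-respʳ-≈ split (+-mono-<-≤ (proj₁ cu) (proj₁ kv)))
      upper : (u n + k * v n) - (l + k * m) < ε
      upper = <-respˡ-≈ split (<-respʳ-≈ δ+Hδ≈ε (+-mono-<-≤ (proj₂ cu) (proj₂ kv)))

  lim-const : ∀ x → (λ _ → x) ⟶ x
  lim-const x ε 0<ε = 0 , λ _ _ →
    <-respʳ-≈ (sym (-‿inverseʳ x)) (<-by 0<ε (solve 1 (λ e → con (+ 0) :- :- e := e) refl ε)) ,
    <-respˡ-≈ (sym (-‿inverseʳ x)) 0<ε

  lim-cong : ∀ {u v : ℕ → ℝ} {l} → (∀ n → u n ≈ v n) → u ⟶ l → v ⟶ l
  lim-cong u≈v u⟶l ε 0<ε with u⟶l ε 0<ε
  ... | N , close = N , λ n N≤n → <-respʳ-≈ (+-congʳ (u≈v n)) (proj₁ (close n N≤n)) ,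
                                  <-respˡ-≈ (+-congʳ (u≈v n)) (proj₂ (close n N≤n))

  lim-subsequence : ∀ {u : ℕ → ℝ} {l} (φ : ℕ → ℕ) → (∀ n → n ℕ.≤ φ n) → u ⟶ l → (u ∘ φ) ⟶ l
  lim-subsequence φ n≤φn u⟶l ε 0<ε with u⟶l ε 0<ε
  ... | N , close = N , λ n N≤n → close (φ n) (ℕ.≤-trans N≤n (n≤φn n))

  lim-neg : ∀ {u : ℕ → ℝ} {l} → u ⟶ l → (λ n → - u n) ⟶ - l
  lim-neg {u} {l} u⟶l ε 0<ε with u⟶l ε 0<ε
  ... | N , close = N , λ n N≤n →
    <-by (<⇒0<- (proj₂ (close n N≤n))) (solve 3 (λ u l e → (:- u :- :- l) :- :- e := e :- (u :- l)) refl (u n) l ε) ,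
    <-by (<⇒0<- (proj₁ (close n N≤n))) (solve 3 (λ u l e → e :- (:- u :- :- l) := (u :- l) :- :- e) refl (u n) l ε)

  lim-≥ : ∀ {u : ℕ → ℝ} {l b} → u ⟶ l → ∀ N → (∀ n → N ℕ.≤ n → b ≤ u n) → b ≤ l
  lim-≥ {u} {l} {b} u⟶l N b≤u = ≤-resp (involutive b) (involutive l)
    (neg-mono-≤ (lim-≤ (lim-neg u⟶l) N λ n N≤n → neg-mono-≤ (b≤u n N≤n)))
    where
    involutive : ∀ x → - - x ≈ x
    involutive = solve 1 (λ x → :- :- x := x) refl

  lim-∣∣≤ : ∀ {u : ℕ → ℝ} {l b} → u ⟶ l → ∀ N → (∀ n → N ℕ.≤ n → ∣ u n ∣≤ b) → ∣ l ∣≤ b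
  lim-∣∣≤ u⟶l N u≤b = lim-≥ u⟶l N (λ n N≤n → proj₁ (u≤b n N≤n)) , lim-≤ u⟶l N (λ n N≤n → proj₂ (u≤b n N≤n))

  -- Both differences of the limits are limits of the zero sequence, hence nonnegative.
  lim-unique : ∀ {u : ℕ → ℝ} {l m} → u ⟶ l → u ⟶ m → l ≈ m
  lim-unique {u} {l} {m} u⟶l u⟶m = ≮⇒≈
    (≤-by (lim-≥ (lim-+* (- 1#) u⟶m u⟶l) 0 λ n _ → ≈⇒≤ (sym (zero-diff (u n)))) (diff m l))
    (≤-by (lim-≥ (lim-+* (- 1#) u⟶l u⟶m) 0 λ n _ → ≈⇒≤ (sym (zero-diff (u n)))) (diff l m))
    where
    zero-diff : ∀ x → x + - 1# * x ≈ 0#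
    zero-diff = solve 1 (λ x → x :+ :- con (+ 1) :* x := con (+ 0)) refl
    diff : ∀ x y → x - y ≈ x + - 1# * y
    diff = solve 2 (λ x y → x :- y := x :+ :- con (+ 1) :* y) refl

-- Formal power series and scaled Stirling numbers.

module StirlingTransforms {c ℓ₁ ℓ₂ ℓ₃} (R : RealField c ℓ₁ ℓ₂ ℓ₃) where

  open Reals R hiding (zero)
  open Inequalities R
  open SumsAndLimits R
  open ≈-Reasoning setoid

  fromℕ-!#0 : ∀ n → fromℕ (n ℕ.!) # 0#
  fromℕ-!#0 n = fromℕ#0 (n ℕ.!) {{n ℕ.!≢0}}

  /!-cancel : ∀ x n → (x /! n) * fromℕ (n ℕ.!) ≈ x
  /!-cancel x n = /-cancel x (n ℕ.!) {{n ℕ.!≢0}}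

  /!-suc : ∀ x n → fromℕ (suc n) * (x /! suc n) ≈ x /! n
  /!-suc x n = *-cancelˡ (fromℕ (n ℕ.!)) (fromℕ-!#0 n) (begin
    fromℕ (n ℕ.!) * (fromℕ (suc n) * (x /! suc n))
      ≈⟨ solve 3 (λ a b c → a :* (b :* c) := c :* (b :* a)) refl _ _ _ ⟩
    (x /! suc n) * (fromℕ (suc n) * fromℕ (n ℕ.!))  ≈⟨ *-congˡ (fromℕ-* (suc n) (n ℕ.!)) ⟨
    (x /! suc n) * fromℕ (suc n ℕ.!)                ≈⟨ /!-cancel x (suc n) ⟩
    x                                               ≈⟨ /!-cancel x n ⟨
    (x /! n) * fromℕ (n ℕ.!)                        ≈⟨ *-comm _ _ ⟩
    fromℕ (n ℕ.!) * (x /! n)                        ∎)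

  x/!0≈x : ∀ x → x /! 0 ≈ x
  x/!0≈x x = trans (solve 1 (λ y → y := y :* (con (+ 1) :+ con (+ 0))) refl (x /! 0)) (/!-cancel x 0)

  0≤/! : ∀ {x} n → 0# ≤ x → 0# ≤ x /! n
  0≤/! {x} n 0≤x = 0≤* 0≤x (<⇒≤ (0<recip (fromℕ-!#0 n)
    (<-≤-trans 0<1 (≤-respˡ (+-identityʳ 1#) (fromℕ-mono (ℕ.1≤n! n))))))

  ∂ : Series → Series
  ∂ f n = fromℕ (suc n) * f (suc n)

  ⊛-∑ : ∀ f g n → (f ⊛ g) n ≈ ∑< (suc n) (λ i → f i * g (n ℕ.∸ i))
  ⊛-∑ f g n = ∑-unfold (suc n) λ i → f i * g (n ℕ.∸ i)

  one-⊛ : ∀ f n → (one ⊛ f) n ≈ f n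
  one-⊛ f n = begin
    (one ⊛ f) n                               ≈⟨ ⊛-∑ one f n ⟩
    ∑< (suc n) (λ i → one i * f (n ℕ.∸ i))    ≈⟨ ∑-first n _ ⟩
    1# * f n + ∑< n (λ i → 0# * f (n ℕ.∸ suc i))
      ≈⟨ +-cong (*-identityˡ (f n)) (∑-zero n λ i → zeroˡ (f (n ℕ.∸ suc i))) ⟩
    f n + 0#                                  ≈⟨ +-identityʳ (f n) ⟩
    f n                                       ∎

  -- The Leibniz rule: in each term the factor `n + 1` splits as `i + (n + 1 - i)`. The first sum
  -- then loses its term at `i = 0` and the second its term at `i = n + 1`.
  ∂-⊛ : ∀ f g n → ∂ (f ⊛ g) n ≈ (∂ f ⊛ g) n + (f ⊛ ∂ g) n
  ∂-⊛ f g n = begin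
    fromℕ (suc n) * (f ⊛ g) (suc n)
      ≈⟨ *-congˡ (⊛-∑ f g (suc n)) ⟩
    fromℕ (suc n) * ∑< (suc (suc n)) (λ i → f i * g (suc n ℕ.∸ i))
      ≈⟨ ∑-*ˡ (suc (suc n)) (fromℕ (suc n)) _ ⟨
    ∑< (suc (suc n)) (λ i → fromℕ (suc n) * (f i * g (suc n ℕ.∸ i)))
      ≈⟨ ∑-cong< (suc (suc n)) split ⟩
    ∑< (suc (suc n)) (λ i → onLeft i + onRight i)
      ≈⟨ ∑-+ (suc (suc n)) onLeft onRight ⟩
    ∑< (suc (suc n)) onLeft + ∑< (suc (suc n)) onRight
      ≈⟨ +-cong left right ⟩
    (∂ f ⊛ g) n + (f ⊛ ∂ g) n ∎
    where
    onLeft onRight : ℕ → ℝ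
    onLeft  i = (fromℕ i * f i) * g (suc n ℕ.∸ i)
    onRight i = f i * (fromℕ (suc n ℕ.∸ i) * g (suc n ℕ.∸ i))

    split : ∀ i → i ℕ.< suc (suc n) → fromℕ (suc n) * (f i * g (suc n ℕ.∸ i)) ≈ onLeft i + onRight i
    split i (s≤s i≤1+n) = trans
      (*-congʳ (trans (reflexive (≡.cong fromℕ (≡.sym (ℕ.m+[n∸m]≡n i≤1+n)))) (fromℕ-+ i (suc n ℕ.∸ i))))
      (solve 4 (λ a b x y → (a :+ b) :* (x :* y) := (a :* x) :* y :+ x :* (b :* y)) refl _ _ _ _)

    left : ∑< (suc (suc n)) onLeft ≈ (∂ f ⊛ g) n
    left = begin
      ∑< (suc (suc n)) onLeft                ≈⟨ ∑-first (suc n) onLeft ⟩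
      onLeft 0 + ∑< (suc n) (onLeft ∘ suc)   ≈⟨ +-congʳ (trans (*-congʳ (zeroˡ (f 0))) (zeroˡ _)) ⟩
      0# + ∑< (suc n) (onLeft ∘ suc)         ≈⟨ +-identityˡ _ ⟩
      ∑< (suc n) (onLeft ∘ suc)              ≈⟨ ⊛-∑ (∂ f) g n ⟨
      (∂ f ⊛ g) n                            ∎

    right : ∑< (suc (suc n)) onRight ≈ (f ⊛ ∂ g) n
    right = begin
      ∑< (suc (suc n)) onRight            ≈⟨ ∑-last (suc n) onRight ⟩
      ∑< (suc n) onRight + onRight (suc n)
        ≈⟨ +-congˡ (trans (*-congˡ (trans (*-congʳ (reflexive (≡.cong fromℕ (ℕ.n∸n≡0 n)))) (zeroˡ _))) (zeroʳ _)) ⟩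
      ∑< (suc n) onRight + 0#             ≈⟨ +-identityʳ _ ⟩
      ∑< (suc n) onRight                  ≈⟨ ∑-cong< (suc n) (λ { i (s≤s i≤n) →
        *-congˡ (reflexive (≡.cong (λ m → fromℕ m * g m) (ℕ.+-∸-assoc 1 i≤n))) }) ⟩
      ∑< (suc n) (λ i → f i * ∂ g (n ℕ.∸ i)) ≈⟨ ⊛-∑ f (∂ g) n ⟨
      (f ⊛ ∂ g) n                         ∎

  -- k! S(n,k) / n!
  σ : ℕ → ℕ → ℝ
  σ n k = power expm1 k n

  σ-suc : ∀ n k → σ n (suc k) ≈ ∑< (suc n) (λ i → expm1 i * σ (n ℕ.∸ i) k)
  σ-suc n k = ⊛-∑ expm1 (power expm1 k) n

  ∂-expm1 : ∀ n → ∂ expm1 n ≈ one n + expm1 n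
  ∂-expm1 zero    = trans (/!-suc 1# 0) (trans (x/!0≈x 1#) (sym (+-identityʳ 1#)))
  ∂-expm1 (suc n) = trans (/!-suc 1# (suc n)) (sym (+-identityˡ _))

  -- The recurrence `S(n+1,k+1) = (k+1) S(n,k+1) + S(n,k)` after rescaling. It is obtained by
  -- differentiating `(e^x - 1)^(k+1)`, where the derivative of `e^x - 1` is `1 + (e^x - 1)`, by
  -- induction on the exponent.
  σ-recurrence : ∀ n k → fromℕ (suc n) * σ (suc n) (suc k) ≈ fromℕ (suc k) * (σ n (suc k) + σ n k)
  σ-recurrence n k = begin
    ∂ (expm1 ⊛ power expm1 k) n
      ≈⟨ ∂-⊛ expm1 (power expm1 k) n ⟩
    (∂ expm1 ⊛ power expm1 k) n + (expm1 ⊛ ∂ (power expm1 k)) n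
      ≈⟨ +-cong first (second k) ⟩
    (σ n k + σ n (suc k)) + fromℕ k * (σ n (suc k) + σ n k)
      ≈⟨ solve 3 (λ x y k → (x :+ y) :+ k :* (y :+ x) := (con (+ 1) :+ k) :* (y :+ x)) refl _ _ _ ⟩
    fromℕ (suc k) * (σ n (suc k) + σ n k) ∎
    where
    first : (∂ expm1 ⊛ power expm1 k) n ≈ σ n k + σ n (suc k)
    first = begin
      (∂ expm1 ⊛ power expm1 k) n
        ≈⟨ ⊛-∑ (∂ expm1) (power expm1 k) n ⟩
      ∑< (suc n) (λ i → ∂ expm1 i * σ (n ℕ.∸ i) k)
        ≈⟨ ∑-cong (suc n) (λ i → trans (*-congʳ (∂-expm1 i)) (distribʳ _ _ _)) ⟩
      ∑< (suc n) (λ i → one i * σ (n ℕ.∸ i) k + expm1 i * σ (n ℕ.∸ i) k)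
        ≈⟨ ∑-+ (suc n) (λ i → one i * σ (n ℕ.∸ i) k) (λ i → expm1 i * σ (n ℕ.∸ i) k) ⟩
      ∑< (suc n) (λ i → one i * σ (n ℕ.∸ i) k) + ∑< (suc n) (λ i → expm1 i * σ (n ℕ.∸ i) k)
        ≈⟨ +-cong (⊛-∑ one (power expm1 k) n) (σ-suc n k) ⟨
      (one ⊛ power expm1 k) n + σ n (suc k)
        ≈⟨ +-congʳ (one-⊛ (power expm1 k) n) ⟩
      σ n k + σ n (suc k) ∎

    second : ∀ k → (expm1 ⊛ ∂ (power expm1 k)) n ≈ fromℕ k * (σ n (suc k) + σ n k)
    second zero    = trans (⊛-∑ expm1 (∂ one) n) (trans (∑-zero (suc n) λ i → trans (*-congˡ (zeroʳ _)) (zeroʳ _)) (sym (zeroˡ _)))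
    second (suc k) = begin
      (expm1 ⊛ ∂ (power expm1 (suc k))) n
        ≈⟨ ⊛-∑ expm1 (∂ (power expm1 (suc k))) n ⟩
      ∑< (suc n) (λ i → expm1 i * ∂ (power expm1 (suc k)) (n ℕ.∸ i))
        ≈⟨ ∑-cong (suc n) (λ i → trans (*-congˡ (σ-recurrence (n ℕ.∸ i) k))
             (solve 4 (λ e k x y → e :* (k :* (x :+ y)) := k :* (e :* x :+ e :* y)) refl _ _ _ _)) ⟩
      ∑< (suc n) (λ i → fromℕ (suc k) * (expm1 i * σ (n ℕ.∸ i) (suc k) + expm1 i * σ (n ℕ.∸ i) k))
        ≈⟨ ∑-*ˡ (suc n) (fromℕ (suc k)) (λ i → expm1 i * σ (n ℕ.∸ i) (suc k) + expm1 i * σ (n ℕ.∸ i) k) ⟩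
      fromℕ (suc k) * ∑< (suc n) (λ i → expm1 i * σ (n ℕ.∸ i) (suc k) + expm1 i * σ (n ℕ.∸ i) k)
        ≈⟨ *-congˡ (∑-+ (suc n) (λ i → expm1 i * σ (n ℕ.∸ i) (suc k)) (λ i → expm1 i * σ (n ℕ.∸ i) k)) ⟩
      fromℕ (suc k) * (∑< (suc n) (λ i → expm1 i * σ (n ℕ.∸ i) (suc k)) + ∑< (suc n) (λ i → expm1 i * σ (n ℕ.∸ i) k))
        ≈⟨ *-congˡ (+-cong (σ-suc n (suc k)) (σ-suc n k)) ⟨
      fromℕ (suc k) * (σ n (suc (suc k)) + σ n (suc k)) ∎

  -- `expm1` has no constant term, so its `k`-th power starts in degree `k`.
  σ-vanishes : ∀ n k → n ℕ.< k → σ n k ≈ 0#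
  σ-vanishes n (suc k) (s<s n≤k) = begin
    σ n (suc k)                                        ≈⟨ σ-suc n k ⟩
    ∑< (suc n) (λ i → expm1 i * σ (n ℕ.∸ i) k)         ≈⟨ ∑-cong< (suc n) (λ { i (s<s i≤n) → term i i≤n }) ⟩
    ∑< (suc n) (λ _ → 0#)                              ≈⟨ ∑-zero (suc n) (λ _ → refl) ⟩
    0#                                                 ∎
    where
    term : ∀ i → i ℕ.≤ n → expm1 i * σ (n ℕ.∸ i) k ≈ 0#
    term zero    _   = zeroˡ _
    term (suc i) i<n = trans (*-congˡ (σ-vanishes (n ℕ.∸ suc i) k
      (ℕ.<-≤-trans (ℕ.∸-monoʳ-< z<s i<n) n≤k))) (zeroʳ _)

  0≤expm1 : ∀ n → 0# ≤ expm1 n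
  0≤expm1 zero    = ≤-refl
  0≤expm1 (suc n) = 0≤/! (suc n) 0≤1

  0≤σ : ∀ n k → 0# ≤ σ n k
  0≤σ zero    zero    = 0≤1
  0≤σ (suc n) zero    = ≤-refl
  0≤σ n       (suc k) = ≤-respʳ (sym (σ-suc n k)) (0≤∑ (suc n) λ i → 0≤* (0≤expm1 i) (0≤σ (n ℕ.∸ i) k))

  -- e^x - 1 ≥ x + x²/2 coefficientwise.
  σ-lower-bound : ∀ n k → fromℕ 2 * σ (suc n) k + σ n k ≤ fromℕ 2 * σ (suc (suc n)) (suc k)
  σ-lower-bound n k = ≤-by (0≤* (0≤fromℕ 2) 0≤tail) (begin
    fromℕ 2 * σ (suc (suc n)) (suc k) - (fromℕ 2 * σ (suc n) k + σ n k)
      ≈⟨ +-congʳ (*-congˡ expand) ⟩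
    fromℕ 2 * (0# * x + (e₁ * y + (e₂ * z + tail))) - (fromℕ 2 * y + z)
      ≈⟨ solve 6 (λ x y z t e f → con (+ 2) :* (con (+ 0) :* x :+ (e :* y :+ (f :* z :+ t))) :- (con (+ 2) :* y :+ z)
           := con (+ 2) :* t :+ con (+ 2) :* (e :- con (+ 1)) :* y :+ (con (+ 2) :* f :- con (+ 1)) :* z)
           refl x y z tail e₁ e₂ ⟩
    fromℕ 2 * tail + fromℕ 2 * (e₁ - 1#) * y + (fromℕ 2 * e₂ - 1#) * z
      ≈⟨ +-cong (+-congˡ (*-congʳ (*-congˡ (trans (+-congʳ e₁≈1) (-‿inverseʳ 1#)))))
           (*-congʳ (trans (+-congʳ 2e₂≈1) (-‿inverseʳ 1#))) ⟩
    fromℕ 2 * tail + fromℕ 2 * 0# * y + 0# * z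
      ≈⟨ solve 3 (λ y z t → con (+ 2) :* t :+ con (+ 2) :* con (+ 0) :* y :+ con (+ 0) :* z := con (+ 2) :* t)
           refl y z tail ⟩
    fromℕ 2 * tail ∎)
    where
    x = σ (suc (suc n)) k
    y = σ (suc n) k
    z = σ n k
    e₁ = expm1 1
    e₂ = expm1 2
    term : ℕ → ℝ
    term i = expm1 i * σ (suc (suc n) ℕ.∸ i) k
    tail = ∑< n (term ∘ suc ∘ suc ∘ suc)
    0≤tail : 0# ≤ tail
    0≤tail = 0≤∑ n λ i → 0≤* (0≤expm1 (suc (suc (suc i)))) (0≤σ (n ℕ.∸ suc i) k)

    expand : σ (suc (suc n)) (suc k) ≈ 0# * x + (e₁ * y + (e₂ * z + tail))
    expand = trans (σ-suc (suc (suc n)) k) (trans (∑-first (suc (suc n)) term)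
      (+-congˡ (trans (∑-first (suc n) (term ∘ suc)) (+-congˡ (∑-first n (term ∘ suc ∘ suc))))))
    e₁≈1 : e₁ ≈ 1#
    e₁≈1 = trans (solve 1 (λ x → x := (con (+ 1) :+ con (+ 0)) :* x) refl e₁) (trans (/!-suc 1# 0) (x/!0≈x 1#))
    2e₂≈1 : fromℕ 2 * e₂ ≈ 1#
    2e₂≈1 = trans (/!-suc 1# 1) e₁≈1

-- Substitution of `e^z - 1` and the Euler transform.

module EulerTransform {c ℓ₁ ℓ₂ ℓ₃} (R : RealField c ℓ₁ ℓ₂ ℓ₃) where

  open Reals R hiding (zero)
  open Inequalities R
  open SumsAndLimits R
  open StirlingTransforms R
  open ≈-Reasoning setoid

  -- The coefficient of z^n in P(e^z - 1), for P(x) = ∑ pₖ x^k.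
  T : ℕ → Series → ℝ
  T n p = ∑< (suc n) λ k → σ n k * p k

  T-cong : ∀ n {p q : Series} → (∀ k → p k ≈ q k) → T n p ≈ T n q
  T-cong n p≈q = ∑-cong (suc n) λ k → *-congˡ (p≈q k)

  T-* : ∀ n x p → T n (λ k → x * p k) ≈ x * T n p
  T-* n x p = trans
    (∑-cong (suc n) λ k → solve 3 (λ x p s → s :* (x :* p) := x :* (s :* p)) refl x (p k) (σ n k))
    (∑-*ˡ (suc n) x _)

  T-+ : ∀ n p q → T n (λ k → p k + q k) ≈ T n p + T n q
  T-+ n p q = trans (∑-cong (suc n) λ k → distribˡ (σ n k) (p k) (q k)) (∑-+ (suc n) _ _)

  θ shift : Series → Series
  θ p k     = fromℕ k * p k
  shift p k = p (suc k)

  -- T intertwines d/dz with (1 + x) d/dx.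
  T-suc : ∀ n p → fromℕ (suc n) * T (suc n) p ≈ T n (λ k → θ p k + ∂ p k)
  T-suc n p = begin
    fromℕ (suc n) * T (suc n) p
      ≈⟨ *-congˡ (trans (∑-first (suc n) _) (trans (+-congʳ (zeroˡ (p 0))) (+-identityˡ _))) ⟩
    fromℕ (suc n) * ∑< (suc n) (λ k → σ (suc n) (suc k) * p (suc k))
      ≈⟨ ∑-*ˡ (suc n) (fromℕ (suc n)) _ ⟨
    ∑< (suc n) (λ k → fromℕ (suc n) * (σ (suc n) (suc k) * p (suc k)))
      ≈⟨ ∑-cong (suc n) (λ k → trans (sym (*-assoc _ _ _)) (trans (*-congʳ (σ-recurrence n k))
           (solve 4 (λ k s t p → k :* (s :+ t) :* p := s :* (k :* p) :+ t :* (k :* p)) refl _ _ _ _))) ⟩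
    ∑< (suc n) (λ k → h (suc k) + σ n k * ∂ p k)
      ≈⟨ ∑-+ (suc n) (h ∘ suc) (λ k → σ n k * ∂ p k) ⟩
    ∑< (suc n) (h ∘ suc) + T n (∂ p)
      ≈⟨ +-congʳ shifted ⟩
    T n (θ p) + T n (∂ p)
      ≈⟨ T-+ n (θ p) (∂ p) ⟨
    T n (λ k → θ p k + ∂ p k) ∎
    where
    h : ℕ → ℝ
    h k = σ n k * θ p k

    h0≈0 : h 0 ≈ 0#
    h0≈0 = trans (*-congˡ (zeroˡ (p 0))) (zeroʳ _)

    shifted : ∑< (suc n) (h ∘ suc) ≈ T n (θ p)
    shifted = begin
      ∑< (suc n) (h ∘ suc)         ≈⟨ +-identityˡ _ ⟨
      0# + ∑< (suc n) (h ∘ suc)    ≈⟨ +-congʳ h0≈0 ⟨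
      h 0 + ∑< (suc n) (h ∘ suc)   ≈⟨ ∑-first (suc n) h ⟨
      ∑< (suc (suc n)) h           ≈⟨ ∑-last (suc n) h ⟩
      ∑< (suc n) h + h (suc n)     ≈⟨ +-congˡ (trans (*-congʳ (σ-vanishes n (suc n) (ℕ.n<1+n n))) (zeroˡ _)) ⟩
      ∑< (suc n) h + 0#            ≈⟨ +-identityʳ _ ⟩
      T n (θ p)                    ∎

  -- The Euler transform Q(x/(1 + x))/(1 + x).
  euler : Series → Series
  euler q zero    = q 0
  euler q (suc m) = euler (λ k → q (suc k) - q k) m

  euler-cong : ∀ m {p q : Series} → (∀ k → p k ≈ q k) → euler p m ≈ euler q m
  euler-cong zero    p≈q = p≈q 0
  euler-cong (suc m) p≈q = euler-cong m λ k → +-cong (p≈q (suc k)) (-‿cong (p≈q k))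

  euler-+* : ∀ m x p q → euler (λ k → p k + x * q k) m ≈ euler p m + x * euler q m
  euler-+* zero    x p q = refl
  euler-+* (suc m) x p q = trans
    (euler-cong m λ k → solve 5 (λ x p q r s → (p :+ x :* q) :- (r :+ x :* s) := (p :- r) :+ x :* (q :- s))
      refl x (p (suc k)) (q (suc k)) (p k) (q k))
    (euler-+* m x _ _)

  euler-+ : ∀ m p q → euler (λ k → p k + q k) m ≈ euler p m + euler q m
  euler-+ m p q = begin
    euler (λ k → p k + q k) m       ≈⟨ euler-cong m (λ k → +-congˡ (sym (*-identityˡ (q k)))) ⟩
    euler (λ k → p k + 1# * q k) m  ≈⟨ euler-+* m 1# p q ⟩
    euler p m + 1# * euler q m      ≈⟨ +-congˡ (*-identityˡ _) ⟩
    euler p m + euler q m           ∎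

  euler-shift : ∀ m q → euler (shift q) m ≈ euler q (suc m) + euler q m
  euler-shift m q = trans
    (euler-cong m λ k → solve 2 (λ x y → x := (x :- y) :+ y) refl (q (suc k)) (q k))
    (euler-+ m (λ k → q (suc k) - q k) q)

  euler-θ-zero : ∀ q → euler (θ q) 0 ≈ 0#
  euler-θ-zero q = zeroˡ (q 0)

  -- With `y = x/(1 + x)` and `E` the transformed series, `y d/dy` becomes `E ↦ x ((1 + x) E)′`. On
  -- coefficients, `(k+1) q(k+1) - k q(k) = k Δq(k) + q(k+1)`, which allows induction on `m`.
  euler-θ-suc : ∀ m q → euler (θ q) (suc m) ≈ fromℕ (suc m) * (euler q (suc m) + euler q m)
  euler-θ-suc m q = trans
    (euler-cong m λ k → solve 3 (λ k x y → (con (+ 1) :+ k) :* x :- k :* y := k :* (x :- y) :+ x)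
      refl (fromℕ k) (q (suc k)) (q k))
    (trans (euler-+ m (θ Δq) (shift q)) (trans (+-cong (step m) (euler-shift m q)) (collect m)))
    where
    Δq : Series
    Δq k = q (suc k) - q k

    step : ∀ m → euler (θ Δq) m ≈ fromℕ m * (euler q (suc m) + euler q m)
    step zero    = trans (euler-θ-zero Δq) (sym (zeroˡ _))
    step (suc m) = euler-θ-suc m Δq

    collect : ∀ m → fromℕ m * (euler q (suc m) + euler q m) + (euler q (suc m) + euler q m)
              ≈ fromℕ (suc m) * (euler q (suc m) + euler q m)
    collect m = solve 2 (λ k x → k :* x :+ x := (con (+ 1) :+ k) :* x) refl (fromℕ m) _

  -- Q(x/(1 + x)).
  substitute : Series → Series
  substitute q zero    = euler q 0
  substitute q (suc m) = euler q (suc m) + euler q m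

  alternate : Series → Series
  alternate q k = -1^ k * q k

  -- Both sides are the coefficient of z^n in A(1 - e^(-z)), as 1 - e^(-z) = x/(1 + x) for x = e^z - 1.
  T-alternate : ∀ n a → -1^ n * T n (alternate a) ≈ T n (substitute a)
  T-alternate zero    a = trans (*-identityˡ _)
    (∑-cong< 1 λ { zero _ → *-congˡ (*-identityˡ (a 0)) ; (suc _) (s<s ()) })
  T-alternate (suc n) a = *-cancelˡ (fromℕ (suc n)) (fromℕ-suc#0 n) (begin
    fromℕ (suc n) * (-1^ suc n * T (suc n) (alternate a))
      ≈⟨ solve 3 (λ m s t → m :* (:- con (+ 1) :* s :* t) := :- con (+ 1) :* s :* (m :* t)) refl _ _ _ ⟩
    -1^ suc n * (fromℕ (suc n) * T (suc n) (alternate a))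
      ≈⟨ *-congˡ (T-suc n (alternate a)) ⟩
    -1^ suc n * T n (λ k → θ (alternate a) k + ∂ (alternate a) k)
      ≈⟨ *-congˡ (T-cong n λ k → solve 4 (λ k s x y →
           k :* (s :* x) :+ (con (+ 1) :+ k) :* (:- con (+ 1) :* s :* y)
             := :- con (+ 1) :* (s :* ((con (+ 1) :+ k) :* y :+ :- con (+ 1) :* (k :* x))))
           refl (fromℕ k) (-1^ k) (a k) (a (suc k))) ⟩
    -1^ suc n * T n (λ k → - 1# * alternate a′ k)
      ≈⟨ *-congˡ (T-* n (- 1#) (alternate a′)) ⟩
    -1^ suc n * (- 1# * T n (alternate a′))
      ≈⟨ solve 2 (λ s t → :- con (+ 1) :* s :* (:- con (+ 1) :* t) := s :* t) refl _ _ ⟩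
    -1^ n * T n (alternate a′)
      ≈⟨ T-alternate n a′ ⟩
    T n (substitute a′)
      ≈⟨ T-cong n substitute-a′ ⟩
    T n (λ k → θ (substitute a) k + ∂ (substitute a) k)
      ≈⟨ T-suc n (substitute a) ⟨
    fromℕ (suc n) * T (suc n) (substitute a) ∎)
    where
    -- The coefficients of `(1 - y) A′(y)`: for `y = 1 - e^(-z)` one has `dy/dz = 1 - y`, so this is
    -- the derivative of `A` with respect to `z`.
    a′ : Series
    a′ k = ∂ a k + - 1# * θ a k

    euler-a′ : ∀ m → euler a′ m ≈ fromℕ (suc m) * (euler a (suc m) + euler a m)
    euler-a′ m = begin
      euler a′ m                                              ≈⟨ euler-+* m (- 1#) (∂ a) (θ a) ⟩
      euler (shift (θ a)) m + - 1# * euler (θ a) m            ≈⟨ +-congʳ (euler-shift m (θ a)) ⟩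
      (euler (θ a) (suc m) + euler (θ a) m) + - 1# * euler (θ a) m
        ≈⟨ solve 2 (λ x y → (x :+ y) :+ :- con (+ 1) :* y := x) refl _ _ ⟩
      euler (θ a) (suc m)                                     ≈⟨ euler-θ-suc m a ⟩
      fromℕ (suc m) * (euler a (suc m) + euler a m)           ∎

    substitute-a′ : ∀ m → substitute a′ m ≈ θ (substitute a) m + ∂ (substitute a) m
    substitute-a′ zero    = trans (euler-a′ 0) (trans (sym (+-identityˡ _)) (+-congʳ (sym (zeroˡ _))))
    substitute-a′ (suc m) = trans (+-cong (euler-a′ (suc m)) (euler-a′ m)) (+-comm _ _)

  -- (1 - 2y) A′(y) = A(y) + h/(1 - y) becomes (1 - x²) E′(x) = x E(x) + h for E = euler A.
  euler-recurrence : ∀ a h → (∀ k → ∂ a k ≈ (fromℕ 2 * fromℕ k + 1#) * a k + h) →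
    euler a 1 ≈ h × (∀ m → fromℕ (suc (suc m)) * euler a (suc (suc m)) ≈ fromℕ (suc m) * euler a m)
  euler-recurrence a h rec = first , later
    where
    -- The inhomogeneous term `h/(1 - y)` is transformed into the constant `h`.
    euler-constant : ∀ m → euler (λ _ → h) (suc m) ≈ 0#
    euler-constant m = trans (euler-cong m λ _ → -‿inverseʳ h) (zeros m)
      where
      zeros : ∀ m → euler (λ _ → 0#) m ≈ 0#
      zeros zero    = refl
      zeros (suc m) = trans (euler-cong m λ _ → -‿inverseʳ 0#) (zeros m)

    -- The transform of `A′` computed twice: as a shift of `θ a`, and from the assumed recurrence.
    both : ∀ m → euler (θ a) (suc m) + euler (θ a) m
               ≈ fromℕ 2 * euler (θ a) m + euler a m + euler (λ _ → h) m
    both m = begin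
      euler (θ a) (suc m) + euler (θ a) m                              ≈⟨ euler-shift m (θ a) ⟨
      euler (∂ a) m                                                    ≈⟨ euler-cong m rec ⟩
      euler (λ k → (fromℕ 2 * fromℕ k + 1#) * a k + h) m
        ≈⟨ euler-cong m (λ k → solve 3 (λ k a h → (con (+ 2) :* k :+ con (+ 1)) :* a :+ h
             := (a :+ con (+ 2) :* (k :* a)) :+ h) refl (fromℕ k) (a k) h) ⟩
      euler (λ k → (a k + fromℕ 2 * θ a k) + h) m                      ≈⟨ euler-+ m _ _ ⟩
      euler (λ k → a k + fromℕ 2 * θ a k) m + euler (λ _ → h) m        ≈⟨ +-congʳ (euler-+* m (fromℕ 2) a (θ a)) ⟩
      (euler a m + fromℕ 2 * euler (θ a) m) + euler (λ _ → h) m        ≈⟨ +-congʳ (+-comm _ _) ⟩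
      (fromℕ 2 * euler (θ a) m + euler a m) + euler (λ _ → h) m        ∎

    difference : ∀ m → fromℕ (suc m) * (euler a (suc m) + euler a m)
                     ≈ (euler (θ a) m + euler a m) + euler (λ _ → h) m
    difference m = begin
      fromℕ (suc m) * (euler a (suc m) + euler a m)   ≈⟨ euler-θ-suc m a ⟨
      euler (θ a) (suc m)
        ≈⟨ solve 2 (λ x y → x := (x :+ y) :- y) refl _ (euler (θ a) m) ⟩
      (euler (θ a) (suc m) + euler (θ a) m) - euler (θ a) m   ≈⟨ +-congʳ (both m) ⟩
      fromℕ 2 * euler (θ a) m + euler a m + euler (λ _ → h) m - euler (θ a) m
        ≈⟨ solve 3 (λ t e c → (con (+ 2) :* t :+ e :+ c) :- t := (t :+ e) :+ c) refl _ _ _ ⟩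
      (euler (θ a) m + euler a m) + euler (λ _ → h) m ∎

    first : euler a 1 ≈ h
    first = begin
      euler a 1
        ≈⟨ solve 2 (λ x y → x := (con (+ 1) :+ con (+ 0)) :* (x :+ y) :- y) refl (euler a 1) (euler a 0) ⟩
      fromℕ 1 * (euler a 1 + euler a 0) - euler a 0      ≈⟨ +-congʳ (difference 0) ⟩
      ((euler (θ a) 0 + euler a 0) + h) - euler a 0      ≈⟨ +-congʳ (+-congʳ (+-congʳ (euler-θ-zero a))) ⟩
      ((0# + euler a 0) + h) - euler a 0
        ≈⟨ solve 2 (λ x h → (con (+ 0) :+ x) :+ h :- x := h) refl (euler a 0) h ⟩
      h ∎

    later : ∀ m → fromℕ (suc (suc m)) * euler a (suc (suc m)) ≈ fromℕ (suc m) * euler a m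
    later m = begin
      fromℕ (suc (suc m)) * x
        ≈⟨ solve 3 (λ k x y → (con (+ 1) :+ k) :* x := (con (+ 1) :+ k) :* (x :+ y) :- (con (+ 1) :+ k) :* y) refl (fromℕ (suc m)) x y ⟩
      fromℕ (suc (suc m)) * (x + y) - fromℕ (suc (suc m)) * y
        ≈⟨ +-congʳ (difference (suc m)) ⟩
      ((euler (θ a) (suc m) + y) + euler (λ _ → h) (suc m)) - fromℕ (suc (suc m)) * y
        ≈⟨ +-congʳ (+-cong (+-congʳ (euler-θ-suc m a)) (euler-constant m)) ⟩
      ((fromℕ (suc m) * (y + z) + y) + 0#) - fromℕ (suc (suc m)) * y
        ≈⟨ solve 3 (λ k y z → ((k :* (y :+ z) :+ y) :+ con (+ 0)) :- (con (+ 1) :+ k) :* y := k :* z) refl (fromℕ (suc m)) y z ⟩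
      fromℕ (suc m) * z ∎
      where
      x = euler a (suc (suc m))
      y = euler a (suc m)
      z = euler a m

-- Absorption identities for binomial coefficients.

[k+1]*[n+1]C[k+1]≡[n+1]*nCk : ∀ n k → suc k ℕ.* (suc n C suc k) ≡ suc n ℕ.* (n C k)
[k+1]*[n+1]C[k+1]≡[n+1]*nCk n zero = begin
  1 ℕ.* (suc n C 1)         ≡⟨ ℕ.*-identityˡ _ ⟩
  suc n C 1                 ≡⟨ nC1≡n (suc n) ⟩
  suc n                     ≡⟨ ℕ.*-identityʳ (suc n) ⟨
  suc n ℕ.* (n C 0)         ∎
  where open ≡.≡-Reasoning
[k+1]*[n+1]C[k+1]≡[n+1]*nCk zero (suc k) = ≡.trans
  (≡.cong (suc (suc k) ℕ.*_) (k>n⇒nCk≡0 (s<s (z<s {k}))))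
  (≡.trans (ℕ.*-zeroʳ (suc (suc k))) (≡.sym (≡.cong (1 ℕ.*_) (k>n⇒nCk≡0 (z<s {k})))))
[k+1]*[n+1]C[k+1]≡[n+1]*nCk (suc n) (suc k) = begin
  suc (suc k) ℕ.* (suc (suc n) C suc (suc k))
    ≡⟨ ≡.cong (suc (suc k) ℕ.*_) (nCk+nC[k+1]≡[n+1]C[k+1] (suc n) (suc k)) ⟨
  suc (suc k) ℕ.* (suc n C suc k ℕ.+ suc n C suc (suc k))
    ≡⟨ solve 3 (λ k x y → (con 1 :+ k) :* (x :+ y) := x :+ k :* x :+ (con 1 :+ k) :* y) ≡.refl (suc k) (suc n C suc k) (suc n C suc (suc k)) ⟩
  suc n C suc k ℕ.+ suc k ℕ.* (suc n C suc k) ℕ.+ suc (suc k) ℕ.* (suc n C suc (suc k))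
    ≡⟨ ≡.cong₂ (λ x y → suc n C suc k ℕ.+ x ℕ.+ y)
         ([k+1]*[n+1]C[k+1]≡[n+1]*nCk n k) ([k+1]*[n+1]C[k+1]≡[n+1]*nCk n (suc k)) ⟩
  suc n C suc k ℕ.+ suc n ℕ.* (n C k) ℕ.+ suc n ℕ.* (n C suc k)
    ≡⟨ solve 4 (λ n x y z → x :+ n :* y :+ n :* z := x :+ n :* (y :+ z)) ≡.refl (suc n) (suc n C suc k) (n C k) (n C suc k) ⟩
  suc n C suc k ℕ.+ suc n ℕ.* (n C k ℕ.+ n C suc k)
    ≡⟨ ≡.cong (λ x → suc n C suc k ℕ.+ suc n ℕ.* x) (nCk+nC[k+1]≡[n+1]C[k+1] n k) ⟩
  suc (suc n) ℕ.* (suc n C suc k) ∎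
  where
  open ≡.≡-Reasoning
  open +-*-Solver

[k+i]Ck≡[k+i]Ci : ∀ k i → (k ℕ.+ i) C k ≡ (k ℕ.+ i) C i
[k+i]Ck≡[k+i]Ci k i = ≡.trans (nCk≡nC[n∸k] (ℕ.m≤m+n k i)) (≡.cong ((k ℕ.+ i) C_) (ℕ.m+n∸m≡n k i))

-- By symmetry the lower index `k` may be exchanged for `i + 1` and `i`, where absorption applies.
[i+1]*[k+i+1]Ck≡[k+i+1]*[k+i]Ck : ∀ k i →
  suc i ℕ.* ((k ℕ.+ suc i) C k) ≡ suc (k ℕ.+ i) ℕ.* ((k ℕ.+ i) C k)
[i+1]*[k+i+1]Ck≡[k+i+1]*[k+i]Ck k i = begin
  suc i ℕ.* ((k ℕ.+ suc i) C k)         ≡⟨ ≡.cong (suc i ℕ.*_) ([k+i]Ck≡[k+i]Ci k (suc i)) ⟩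
  suc i ℕ.* ((k ℕ.+ suc i) C suc i)     ≡⟨ ≡.cong (λ m → suc i ℕ.* (m C suc i)) (ℕ.+-suc k i) ⟩
  suc i ℕ.* (suc (k ℕ.+ i) C suc i)     ≡⟨ [k+1]*[n+1]C[k+1]≡[n+1]*nCk (k ℕ.+ i) i ⟩
  suc (k ℕ.+ i) ℕ.* ((k ℕ.+ i) C i)     ≡⟨ ≡.cong (suc (k ℕ.+ i) ℕ.*_) ([k+i]Ck≡[k+i]Ci k i) ⟨
  suc (k ℕ.+ i) ℕ.* ((k ℕ.+ i) C k)     ∎
  where open ≡.≡-Reasoning

-- A first-order recurrence for the inner sum of `c-seq`.

module BinomialSums {c ℓ₁ ℓ₂ ℓ₃} (R : RealField c ℓ₁ ℓ₂ ℓ₃) where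

  open Reals R hiding (zero)
  open Inequalities R
  open SumsAndLimits R
  open ≈-Reasoning setoid

  fromℕ-≡ : ∀ {m n} → m ≡ n → fromℕ m ≈ fromℕ n
  fromℕ-≡ m≡n = reflexive (≡.cong fromℕ m≡n)

  -- The binomial coefficient of 2k - j over k, for j ≤ k.
  central : ℕ → ℕ → ℝ
  central k j = fromℕ ((k ℕ.+ (k ℕ.∸ j)) C k)

  2k∸j≡k+[k∸j] : ∀ k j → j ℕ.≤ k → 2 ℕ.* k ℕ.∸ j ≡ k ℕ.+ (k ℕ.∸ j)
  2k∸j≡k+[k∸j] k j j≤k = ≡.trans (≡.cong (λ x → (k ℕ.+ x) ℕ.∸ j) (ℕ.+-identityʳ k)) (ℕ.+-∸-assoc k j≤k)

  -- The coefficient of t^k in V(t)/(1 - t)^(k+1).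
  P : ℕ → Series → ℝ
  P k v = ∑< (suc k) λ j → central k j * v j

  P-+* : ∀ k x u v → P k (λ j → u j + x * v j) ≈ P k u + x * P k v
  P-+* k x u v = trans
    (∑-cong (suc k) λ j → solve 4 (λ x u v c → c :* (u :+ x :* v) := c :* u :+ x :* (c :* v)) refl x (u j) (v j) _)
    (∑-+* (suc k) x _ _)

  P-cong : ∀ k {u v : Series} → (∀ j → u j ≈ v j) → P k u ≈ P k v
  P-cong k u≈v = ∑-cong (suc k) λ j → *-congˡ (u≈v j)

  t[1-t] : Series → Series
  t[1-t] v zero          = 0#
  t[1-t] v (suc zero)    = v 0
  t[1-t] v (suc (suc j)) = v (suc j) - v j

  central-pascal : ∀ k j → central (suc k) (suc j) ≈ central k j + fromℕ ((k ℕ.+ (k ℕ.∸ j)) C suc k)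
  central-pascal k j = trans (fromℕ-≡ (≡.sym (nCk+nC[k+1]≡[n+1]C[k+1] (k ℕ.+ (k ℕ.∸ j)) k)))
    (fromℕ-+ ((k ℕ.+ (k ℕ.∸ j)) C k) ((k ℕ.+ (k ℕ.∸ j)) C suc k))

  -- In `t (1 - t) V / (1 - t)^(k+2)` one power of `1 - t` cancels, and the factor `t` lowers the
  -- degree from `k + 1` to `k`. Pascal's rule carries this out on coefficients.
  P-t[1-t] : ∀ k v → P (suc k) (t[1-t] v) ≈ P k v
  P-t[1-t] k v = begin
    P (suc k) (t[1-t] v)
      ≈⟨ trans (∑-first (suc k) _) (trans (+-congʳ (zeroʳ _)) (+-identityˡ _)) ⟩
    ∑< (suc k) (λ j → central (suc k) (suc j) * t[1-t] v (suc j))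
      ≈⟨ ∑-first k _ ⟩
    central (suc k) 1 * v 0 + ∑< k (λ j → central (suc k) (suc (suc j)) * (v (suc j) - v j))
      ≈⟨ +-congˡ (trans (∑-cong< k term) (∑-+* k (- 1#) _ _)) ⟩
    central (suc k) 1 * v 0 + (∑< k (λ j → central (suc k) (suc (suc j)) * v (suc j)) + - 1# * ∑< k upper)
      ≈⟨ +-assoc _ _ _ ⟨
    (central (suc k) 1 * v 0 + ∑< k (λ j → central (suc k) (suc (suc j)) * v (suc j))) + - 1# * ∑< k upper
      ≈⟨ +-cong (sym (∑-first k _)) (*-congˡ extend) ⟩
    ∑< (suc k) (λ j → central (suc k) (suc j) * v j) + - 1# * ∑< (suc k) upper
      ≈⟨ ∑-+* (suc k) (- 1#) _ upper ⟨
    ∑< (suc k) (λ j → central (suc k) (suc j) * v j + - 1# * upper j)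
      ≈⟨ ∑-cong (suc k) (λ j → trans (+-congʳ (*-congʳ (central-pascal k j)))
           (solve 3 (λ x y v → (x :+ y) :* v :+ :- con (+ 1) :* (y :* v) := x :* v) refl _ _ (v j))) ⟩
    P k v ∎
    where
    upper : ℕ → ℝ
    upper j = fromℕ ((k ℕ.+ (k ℕ.∸ j)) C suc k) * v j

    index : ∀ j → j ℕ.< k → suc k ℕ.+ (k ℕ.∸ suc j) ≡ k ℕ.+ (k ℕ.∸ j)
    index j j<k = ≡.trans (≡.sym (ℕ.+-suc k (k ℕ.∸ suc j))) (≡.cong (k ℕ.+_) (≡.sym (ℕ.+-∸-assoc 1 j<k)))

    term : ∀ j → j ℕ.< k → central (suc k) (suc (suc j)) * (v (suc j) - v j)
                         ≈ central (suc k) (suc (suc j)) * v (suc j) + - 1# * upper j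
    term j j<k = trans
      (solve 3 (λ x u v → x :* (u :- v) := x :* u :+ :- con (+ 1) :* (x :* v)) refl _ _ (v j))
      (+-congˡ (*-congˡ (*-congʳ (fromℕ-≡ (≡.cong (_C suc k) (index j j<k))))))

    extend : ∑< k upper ≈ ∑< (suc k) upper
    extend = sym (trans (∑-last k upper) (trans (+-congˡ (trans (*-congʳ (fromℕ-≡ vanish)) (zeroˡ _))) (+-identityʳ _)))
      where
      vanish : (k ℕ.+ (k ℕ.∸ k)) C suc k ≡ 0
      vanish = k>n⇒nCk≡0 (s≤s (ℕ.≤-reflexive (≡.trans (≡.cong (k ℕ.+_) (ℕ.n∸n≡0 k)) (ℕ.+-identityʳ k))))

  -- Up to the expected factor `2 (2k + 1)`, passing from `k` to `k + 1` leaves a defect divisible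
  -- by `j + 1`; that factor cancels the denominator of the weights in the sum.
  central-absorption : ∀ k j → j ℕ.< k →
    fromℕ (suc k) * central (suc k) (suc j)
      ≈ fromℕ 2 * (fromℕ 2 * fromℕ k + 1#) * central k (suc j)
        + fromℕ (suc j) * (central k j - fromℕ 2 * central k (suc j))
  central-absorption k j j<k = begin
    κ₁ * z
      ≈⟨ *-congˡ (fromℕ-≡ (≡.cong (λ m → suc m C suc k) (≡.cong (k ℕ.+_) k∸j≡1+i))) ⟩
    κ₁ * fromℕ (suc (k ℕ.+ suc i) C suc k)
      ≈⟨ trans (sym (fromℕ-* (suc k) (suc (k ℕ.+ suc i) C suc k)))
           (trans (fromℕ-≡ ([k+1]*[n+1]C[k+1]≡[n+1]*nCk (k ℕ.+ suc i) k)) (fromℕ-* (suc (k ℕ.+ suc i)) ((k ℕ.+ suc i) C k))) ⟩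
    (1# + fromℕ (k ℕ.+ suc i)) * x′
      ≈⟨ *-cong (+-congˡ (trans (fromℕ-+ k (suc i)) (+-congʳ κ≈)))
           (fromℕ-≡ (≡.cong (λ m → (k ℕ.+ m) C k) (≡.sym k∸j≡1+i))) ⟩
    (1# + ((1# + fromℕ j) + ι + (1# + ι))) * x
      ≈⟨ solve 3 (λ j i x → (con (+ 1) :+ ((con (+ 1) :+ j) :+ i :+ (con (+ 1) :+ i))) :* x
           := con (+ 2) :* ((con (+ 1) :+ i) :* x) :+ (con (+ 1) :+ j) :* x) refl (fromℕ j) ι x ⟩
    fromℕ 2 * ((1# + ι) * x) + fromℕ (suc j) * x
      ≈⟨ +-congʳ (*-congˡ absorb) ⟩
    fromℕ 2 * ((1# + (((1# + fromℕ j) + ι) + ι)) * y) + fromℕ (suc j) * x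
      ≈⟨ solve 4 (λ j i x y → con (+ 2) :* ((con (+ 1) :+ (((con (+ 1) :+ j) :+ i) :+ i)) :* y) :+ (con (+ 1) :+ j) :* x
           := con (+ 2) :* (con (+ 2) :* ((con (+ 1) :+ j) :+ i) :+ con (+ 1)) :* y :+ (con (+ 1) :+ j) :* (x :- con (+ 2) :* y))
           refl (fromℕ j) ι x y ⟩
    fromℕ 2 * (fromℕ 2 * ((1# + fromℕ j) + ι) + 1#) * y + fromℕ (suc j) * (x - fromℕ 2 * y)
      ≈⟨ +-congʳ (*-congʳ (*-congˡ (+-congʳ (*-congˡ κ≈)))) ⟨
    fromℕ 2 * (fromℕ 2 * fromℕ k + 1#) * y + fromℕ (suc j) * (x - fromℕ 2 * y) ∎
    where
    i = k ℕ.∸ suc j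
    ι = fromℕ i
    κ₁ = fromℕ (suc k)
    x = central k j
    y = central k (suc j)
    z = central (suc k) (suc j)
    x′ = fromℕ ((k ℕ.+ suc i) C k)

    k∸j≡1+i : k ℕ.∸ j ≡ suc i
    k∸j≡1+i = ℕ.+-∸-assoc 1 j<k

    κ≈ : fromℕ k ≈ (1# + fromℕ j) + ι
    κ≈ = trans (fromℕ-≡ (≡.sym (ℕ.m+[n∸m]≡n j<k))) (fromℕ-+ (suc j) i)

    absorb : (1# + ι) * x ≈ (1# + (((1# + fromℕ j) + ι) + ι)) * y
    absorb = begin
      fromℕ (suc i) * x                           ≈⟨ *-congˡ (fromℕ-≡ (≡.cong (λ m → (k ℕ.+ m) C k) k∸j≡1+i)) ⟩
      fromℕ (suc i) * x′                          ≈⟨ fromℕ-* (suc i) ((k ℕ.+ suc i) C k) ⟨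
      fromℕ (suc i ℕ.* ((k ℕ.+ suc i) C k))       ≈⟨ fromℕ-≡ ([i+1]*[k+i+1]Ck≡[k+i+1]*[k+i]Ck k i) ⟩
      fromℕ (suc (k ℕ.+ i) ℕ.* ((k ℕ.+ i) C k))   ≈⟨ fromℕ-* (suc (k ℕ.+ i)) ((k ℕ.+ i) C k) ⟩
      fromℕ (suc (k ℕ.+ i)) * y                   ≈⟨ *-congʳ (+-congˡ (trans (fromℕ-+ k i) (+-congʳ κ≈))) ⟩
      (1# + (((1# + fromℕ j) + ι) + ι)) * y       ∎

  central-diagonal : ∀ k → central k k ≈ 1#
  central-diagonal k = trans (fromℕ-≡ (≡.trans (≡.cong (_C k)
    (≡.trans (≡.cong (k ℕ.+_) (ℕ.n∸n≡0 k)) (ℕ.+-identityʳ k))) (nCn≡1 k))) (+-identityʳ 1#)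

  -- The hypotheses determine `s j` as the imaginary part of `(1 - i)^j`; the numbers `1 ± i` are
  -- the roots of `X² - 2X + 2`.
  module _ (s : Series) (s-0 : s 0 ≈ 0#) (s-1 : s 1 ≈ - 1#)
           (s-rec : ∀ j → s (suc (suc j)) ≈ fromℕ 2 * (s (suc j) - s j)) where

    v : Series
    v j = s (suc j) - fromℕ 2 * s j

    v-0 : v 0 ≈ - 1#
    v-0 = trans (+-cong s-1 (-‿cong (*-congˡ s-0))) (solve 0 (:- con (+ 1) :- con (+ 2) :* con (+ 0) := :- con (+ 1)) refl)

    v-1 : v 1 ≈ 0#
    v-1 = trans (+-congʳ (trans (s-rec 0) (*-congˡ (+-congˡ (-‿cong s-0)))))
      (solve 1 (λ x → con (+ 2) :* (x :- con (+ 0)) :- con (+ 2) :* x := con (+ 0)) refl (s 1))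

    u : Series
    u zero          = - 1#
    u (suc zero)    = fromℕ 2
    u (suc (suc _)) = 0#

    -- V(t) = (2t - 1)/(1 - 2t(1 - t)), so V = 2t(1 - t)V + 2t - 1.
    v-split : ∀ j → v j ≈ u j + fromℕ 2 * t[1-t] v j
    v-split zero          = trans v-0 (solve 0 (:- con (+ 1) := :- con (+ 1) :+ con (+ 2) :* con (+ 0)) refl)
    v-split (suc zero)    = trans v-1 (trans (solve 0 (con (+ 0) := con (+ 2) :+ con (+ 2) :* :- con (+ 1)) refl)
      (+-congˡ (*-congˡ (sym v-0))))
    v-split (suc (suc j)) = trans (+-cong (s-rec (suc j)) (-‿cong (*-congˡ (s-rec j))))
      (solve 3 (λ x y z → con (+ 2) :* (z :- x) :- con (+ 2) :* (con (+ 2) :* (x :- y))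
         := con (+ 0) :+ con (+ 2) :* ((z :- con (+ 2) :* x) :- (x :- con (+ 2) :* y)))
        refl (s (suc j)) (s j) (s (suc (suc j))))

    -- `u` is the numerator `2t - 1`, and its two contributions cancel because the central binomial
    -- coefficient of `2k + 2` is twice its neighbour in the row above.
    P-u : ∀ k → P (suc k) u ≈ 0#
    P-u k = begin
      P (suc k) u
        ≈⟨ trans (∑-first (suc k) _) (+-congˡ (trans (∑-first k _)
             (+-congˡ (∑-zero k λ j → zeroʳ (central (suc k) (suc (suc j))))))) ⟩
      central (suc k) 0 * - 1# + (central (suc k) 1 * fromℕ 2 + 0#)
        ≈⟨ +-congʳ (*-congʳ double) ⟩
      fromℕ 2 * central (suc k) 1 * - 1# + (central (suc k) 1 * fromℕ 2 + 0#)
        ≈⟨ solve 1 (λ x → con (+ 2) :* x :* :- con (+ 1) :+ (x :* con (+ 2) :+ con (+ 0)) := con (+ 0)) refl (central (suc k) 1) ⟩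
      0# ∎
      where
      double : central (suc k) 0 ≈ fromℕ 2 * central (suc k) 1
      double = begin
        fromℕ ((suc k ℕ.+ suc k) C suc k)       ≈⟨ fromℕ-≡ (nCk+nC[k+1]≡[n+1]C[k+1] (k ℕ.+ suc k) k) ⟨
        fromℕ ((k ℕ.+ suc k) C k ℕ.+ (k ℕ.+ suc k) C suc k)
          ≈⟨ fromℕ-≡ (≡.cong₂ ℕ._+_ (≡.trans ([k+i]Ck≡[k+i]Ci k (suc k)) (≡.cong (_C suc k) (ℕ.+-suc k k))) (≡.cong (_C suc k) (ℕ.+-suc k k))) ⟩
        fromℕ ((suc k ℕ.+ k) C suc k ℕ.+ (suc k ℕ.+ k) C suc k)
          ≈⟨ fromℕ-+ ((suc k ℕ.+ k) C suc k) ((suc k ℕ.+ k) C suc k) ⟩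
        central (suc k) 1 + central (suc k) 1
          ≈⟨ solve 1 (λ x → x :+ x := con (+ 2) :* x) refl (central (suc k) 1) ⟩
        fromℕ 2 * central (suc k) 1 ∎

    -- In `V = 2t(1 - t) V + (2t - 1)` the polynomial part contributes nothing beyond `k = 0`, so
    -- each step merely doubles the value.
    P-v : ∀ k → P k v ≈ - fromℕ (2 ℕ.^ k)
    P-v zero    = trans (trans (∑-first 0 _) (+-congˡ (∑-empty _)))
      (trans (+-congʳ (*-cong (central-diagonal 0) v-0))
        (solve 0 (con (+ 1) :* :- con (+ 1) :+ con (+ 0) := :- (con (+ 1) :+ con (+ 0))) refl))
    P-v (suc k) = begin
      P (suc k) v                                            ≈⟨ P-cong (suc k) v-split ⟩
      P (suc k) (λ j → u j + fromℕ 2 * t[1-t] v j)           ≈⟨ P-+* (suc k) (fromℕ 2) u (t[1-t] v) ⟩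
      P (suc k) u + fromℕ 2 * P (suc k) (t[1-t] v)           ≈⟨ +-cong (P-u k) (*-congˡ (trans (P-t[1-t] k v) (P-v k))) ⟩
      0# + fromℕ 2 * - fromℕ (2 ℕ.^ k)                       ≈⟨ solve 2 (λ x y → con (+ 0) :+ x :* :- y := :- (x :* y)) refl _ _ ⟩
      - (fromℕ 2 * fromℕ (2 ℕ.^ k))                          ≈⟨ -‿cong (fromℕ-* 2 (2 ℕ.^ k)) ⟨
      - fromℕ (2 ℕ.^ suc k)                                  ∎

    module _ (w : Series) (w-s : ∀ j → fromℕ (suc j) * w j ≈ s (suc j)) where

      γ : ℕ → ℝ
      γ k = ∑< k λ j → central k (suc j) * w j

      -- Absorption is applied term by term. By `w-s` the defects turn into values of `s` without
      -- denominators, and together with the new last term they add up to `P k v`.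
      γ-recurrence : ∀ k → fromℕ (suc k) * γ (suc k)
                         ≈ fromℕ 2 * (fromℕ 2 * fromℕ k + 1#) * γ k - fromℕ (2 ℕ.^ k)
      γ-recurrence k = begin
        fromℕ (suc k) * γ (suc k)
          ≈⟨ *-congˡ (∑-last k _) ⟩
        fromℕ (suc k) * (∑< k (λ j → central (suc k) (suc j) * w j) + central (suc k) (suc k) * w k)
          ≈⟨ distribˡ _ _ _ ⟩
        fromℕ (suc k) * ∑< k (λ j → central (suc k) (suc j) * w j) + fromℕ (suc k) * (central (suc k) (suc k) * w k)
          ≈⟨ +-cong (sym (∑-*ˡ k _ _)) last-term ⟩
        ∑< k (λ j → fromℕ (suc k) * (central (suc k) (suc j) * w j)) + central k k * s (suc k)
          ≈⟨ +-congʳ (trans (∑-cong< k term) (trans (∑-+* k x _ _) (+-congʳ (∑-+ k (λ j → central k j * s (suc j)) _)))) ⟩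
        (∑< k (λ j → central k j * s (suc j)) + ∑< k (λ j → - fromℕ 2 * (central k (suc j) * s (suc j))) + x * γ k)
          + central k k * s (suc k)
          ≈⟨ solve 4 (λ a b c d → (a :+ b :+ c) :+ d := (a :+ d) :+ b :+ c) refl _ _ _ _ ⟩
        (∑< k (λ j → central k j * s (suc j)) + central k k * s (suc k))
          + ∑< k (λ j → - fromℕ 2 * (central k (suc j) * s (suc j))) + x * γ k
          ≈⟨ +-congʳ (+-cong (sym (∑-last k _)) (trans (∑-*ˡ k (- fromℕ 2) _) (*-congˡ front))) ⟩
        P k (λ j → s (suc j)) + - fromℕ 2 * P k s + x * γ k
          ≈⟨ +-congʳ (P-+* k (- fromℕ 2) (λ j → s (suc j)) s) ⟨
        P k (λ j → s (suc j) + - fromℕ 2 * s j) + x * γ k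
          ≈⟨ +-congʳ (P-cong k λ j → solve 2 (λ a b → a :+ :- con (+ 2) :* b := a :- con (+ 2) :* b) refl _ (s j)) ⟩
        P k v + x * γ k
          ≈⟨ trans (+-congʳ (P-v k)) (+-comm _ _) ⟩
        x * γ k - fromℕ (2 ℕ.^ k) ∎
        where
        x = fromℕ 2 * (fromℕ 2 * fromℕ k + 1#)

        term : ∀ j → j ℕ.< k → fromℕ (suc k) * (central (suc k) (suc j) * w j)
          ≈ (central k j * s (suc j) + - fromℕ 2 * (central k (suc j) * s (suc j))) + x * (central k (suc j) * w j)
        term j j<k = begin
          fromℕ (suc k) * (central (suc k) (suc j) * w j)
            ≈⟨ *-assoc _ _ _ ⟨
          fromℕ (suc k) * central (suc k) (suc j) * w j
            ≈⟨ *-congʳ (central-absorption k j j<k) ⟩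
          (x * central k (suc j) + fromℕ (suc j) * (central k j - fromℕ 2 * central k (suc j))) * w j
            ≈⟨ solve 5 (λ x a b j w → (x :* b :+ j :* (a :- con (+ 2) :* b)) :* w
                 := (a :* (j :* w) :+ :- con (+ 2) :* (b :* (j :* w))) :+ x :* (b :* w))
                 refl x (central k j) (central k (suc j)) (fromℕ (suc j)) (w j) ⟩
          (central k j * (fromℕ (suc j) * w j) + - fromℕ 2 * (central k (suc j) * (fromℕ (suc j) * w j)))
            + x * (central k (suc j) * w j)
            ≈⟨ +-congʳ (+-cong (*-congˡ (w-s j)) (*-congˡ (*-congˡ (w-s j)))) ⟩
          (central k j * s (suc j) + - fromℕ 2 * (central k (suc j) * s (suc j))) + x * (central k (suc j) * w j) ∎

        last-term : fromℕ (suc k) * (central (suc k) (suc k) * w k) ≈ central k k * s (suc k)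
        last-term = begin
          fromℕ (suc k) * (central (suc k) (suc k) * w k)   ≈⟨ *-congˡ (trans (*-congʳ (central-diagonal (suc k))) (*-identityˡ _)) ⟩
          fromℕ (suc k) * w k                               ≈⟨ w-s k ⟩
          s (suc k)                                         ≈⟨ *-identityˡ _ ⟨
          1# * s (suc k)                                    ≈⟨ *-congʳ (central-diagonal k) ⟨
          central k k * s (suc k)                           ∎

        front : ∑< k (λ j → central k (suc j) * s (suc j)) ≈ P k s
        front = sym (trans (∑-first k _) (trans (+-congʳ (trans (*-congˡ s-0) (zeroʳ _))) (+-identityˡ _)))

-- The sequences `b` and `c-seq` as transforms of explicit series.

module Coefficients {c ℓ₁ ℓ₂ ℓ₃} (R : RealField c ℓ₁ ℓ₂ ℓ₃) where

  open Reals R hiding (zero)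
  open Inequalities R
  open SumsAndLimits R
  open StirlingTransforms R
  open EulerTransform R
  open BinomialSums R
  open ≈-Reasoning setoid

  1/! : ℕ → ℝ
  1/! n = recip (fromℕ-!#0 n)

  -- The shape common to both sequences: the `n!` inside the Stirling numbers cancels the prefactor
  -- `1/n!`, and the remaining signs are those that `T-alternate` removes.
  signed-sum : ∀ n (f a : ℕ → ℝ) → (∀ k → f k ≈ fromℕ (n ℕ.!) * (σ n k * alternate a k)) →
               (-1^ n /! n) * ∑< (suc n) f ≈ T n (substitute a)
  signed-sum n f a f≈ = begin
    (-1^ n /! n) * ∑< (suc n) f
      ≈⟨ *-congˡ (trans (∑-cong (suc n) f≈) (∑-*ˡ (suc n) (fromℕ (n ℕ.!)) _)) ⟩
    (-1^ n * 1/! n) * (fromℕ (n ℕ.!) * T n (alternate a))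
      ≈⟨ solve 4 (λ s i m t → (s :* i) :* (m :* t) := (m :* i) :* (s :* t)) refl (-1^ n) (1/! n) _ _ ⟩
    (fromℕ (n ℕ.!) * 1/! n) * (-1^ n * T n (alternate a))
      ≈⟨ trans (*-congʳ (recip-inverseʳ (fromℕ-!#0 n))) (*-identityˡ _) ⟩
    -1^ n * T n (alternate a)
      ≈⟨ T-alternate n a ⟩
    T n (substitute a) ∎

  -- β k = binomial(2k, k)/2^k, the coefficient of y^k in (1 - 2y)^(-1/2).
  β : Series
  β k = fromℕ (oddDoubleFactorial k) /! k

  b≈T : ∀ n → b n ≈ 1# / 4 * T n (substitute β)
  b≈T n = begin
    1# / 4 * (-1^ n /! n) * ∑₀ n f                ≈⟨ *-congˡ (∑-unfold (suc n) f) ⟩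
    1# / 4 * (-1^ n /! n) * ∑< (suc n) f          ≈⟨ *-assoc _ _ _ ⟩
    1# / 4 * ((-1^ n /! n) * ∑< (suc n) f)        ≈⟨ *-congˡ (signed-sum n f β term) ⟩
    1# / 4 * T n (substitute β)                   ∎
    where
    f : ℕ → ℝ
    f k = -1^ k * S n k * fromℕ (oddDoubleFactorial k)

    term : ∀ k → f k ≈ fromℕ (n ℕ.!) * (σ n k * alternate β k)
    term k = solve 5 (λ s m x i o → s :* (m :* (x :* i)) :* o := m :* (x :* (s :* (o :* i))))
      refl (-1^ k) (fromℕ (n ℕ.!)) (σ n k) (1/! k) (fromℕ (oddDoubleFactorial k))

  -- The equation `(1 - 2y) A′ = A`, with a zero summand to match `euler-recurrence` at `h = 0`.
  ∂-β : ∀ k → ∂ β k ≈ (fromℕ 2 * fromℕ k + 1#) * β k + 0#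
  ∂-β k = begin
    fromℕ (suc k) * (fromℕ (oddDoubleFactorial (suc k)) /! suc k)
      ≈⟨ /!-suc _ k ⟩
    fromℕ (oddDoubleFactorial k ℕ.* suc (2 ℕ.* k)) * 1/! k
      ≈⟨ *-congʳ (trans (fromℕ-* (oddDoubleFactorial k) (suc (2 ℕ.* k))) (*-congˡ (+-congˡ (fromℕ-* 2 k)))) ⟩
    fromℕ (oddDoubleFactorial k) * (1# + fromℕ 2 * fromℕ k) * 1/! k
      ≈⟨ solve 3 (λ o k i → o :* (con (+ 1) :+ con (+ 2) :* k) :* i := (con (+ 2) :* k :+ con (+ 1)) :* (o :* i) :+ con (+ 0))
           refl (fromℕ (oddDoubleFactorial k)) (fromℕ k) (1/! k) ⟩
    (fromℕ 2 * fromℕ k + 1#) * β k + 0# ∎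

  β-0 : β 0 ≈ 1#
  β-0 = trans (x/!0≈x (fromℕ 1)) (+-identityʳ 1#)

  fromℕ-2^#0 : ∀ k → fromℕ (2 ℕ.^ k) # 0#
  fromℕ-2^#0 k = fromℕ#0 (2 ℕ.^ k) {{ℕ.m^n≢0 2 k}}

  1/2^ : ℕ → ℝ
  1/2^ k = recip (fromℕ-2^#0 k)

  2*1/2^suc : ∀ k → fromℕ 2 * 1/2^ (suc k) ≈ 1/2^ k
  2*1/2^suc k = *-cancelˡ (fromℕ (2 ℕ.^ k)) (fromℕ-2^#0 k) (begin
    fromℕ (2 ℕ.^ k) * (fromℕ 2 * 1/2^ (suc k))    ≈⟨ solve 3 (λ a b c → a :* (b :* c) := (b :* a) :* c) refl _ _ _ ⟩
    fromℕ 2 * fromℕ (2 ℕ.^ k) * 1/2^ (suc k)      ≈⟨ *-congʳ (fromℕ-* 2 (2 ℕ.^ k)) ⟨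
    fromℕ (2 ℕ.^ suc k) * 1/2^ (suc k)            ≈⟨ recip-inverseʳ (fromℕ-2^#0 (suc k)) ⟩
    1#                                            ≈⟨ recip-inverseʳ (fromℕ-2^#0 k) ⟨
    fromℕ (2 ℕ.^ k) * 1/2^ k                      ∎)

  2*½≈1 : fromℕ 2 * (1# / 2) ≈ 1#
  2*½≈1 = trans (*-comm _ _) (/-cancel 1# 2)

  2^*1/2^suc : ∀ k → fromℕ (2 ℕ.^ k) * 1/2^ (suc k) ≈ 1# / 2
  2^*1/2^suc k = *-cancelˡ (fromℕ 2) (fromℕ-suc#0 1) (begin
    fromℕ 2 * (fromℕ (2 ℕ.^ k) * 1/2^ (suc k))    ≈⟨ solve 3 (λ a b c → a :* (b :* c) := b :* (a :* c)) refl _ _ _ ⟩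
    fromℕ (2 ℕ.^ k) * (fromℕ 2 * 1/2^ (suc k))    ≈⟨ *-congˡ (2*1/2^suc k) ⟩
    fromℕ (2 ℕ.^ k) * 1/2^ k                      ≈⟨ recip-inverseʳ (fromℕ-2^#0 k) ⟩
    1#                                            ≈⟨ 2*½≈1 ⟨
    fromℕ 2 * (1# / 2)                            ∎)

  module _ (sin : ℝ → ℝ) (π √2 : ℝ) where

    -- The imaginary part of (1 - i)^ℓ.
    rotation : Series
    rotation ℓ = -1^ ℓ * √2 ^ ℓ * sin ((3 ℕ.* ℓ) · π / 4)

    weight : Series
    weight j = -1^ suc j * (√2 ^ suc j / suc j) * sin ((3 ℕ.* suc j) · π / 4)

    weight-rotation : ∀ j → fromℕ (suc j) * weight j ≈ rotation (suc j)
    weight-rotation j = begin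
      fromℕ (suc j) * (-1^ suc j * (√2 ^ suc j / suc j) * sin ((3 ℕ.* suc j) · π / 4))
        ≈⟨ solve 4 (λ k s x y → k :* (s :* x :* y) := s :* (x :* k) :* y) refl _ _ _ _ ⟩
      -1^ suc j * ((√2 ^ suc j / suc j) * fromℕ (suc j)) * sin ((3 ℕ.* suc j) · π / 4)
        ≈⟨ *-congʳ (*-congˡ (/-cancel (√2 ^ suc j) (suc j))) ⟩
      rotation (suc j) ∎

    Γ : ℕ → ℝ
    Γ = c-inner sin π √2

    Γ≈ : ∀ k → Γ k ≈ ∑< k (λ j → central k (suc j) * weight j)
    Γ≈ k = trans (∑-unfold k term) (∑-cong< k λ j j<k → begin
      term j
        ≈⟨ *-congʳ (*-congʳ (*-congˡ (fromℕ-≡ (≡.cong (_C k) (2k∸j≡k+[k∸j] k (suc j) j<k))))) ⟩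
      -1^ suc j * central k (suc j) * (√2 ^ suc j / suc j) * sin ((3 ℕ.* suc j) · π / 4)
        ≈⟨ solve 4 (λ s c x y → s :* c :* x :* y := c :* (s :* x :* y)) refl _ _ _ _ ⟩
      central k (suc j) * weight j ∎)
      where
      term : ℕ → ℝ
      term j = -1^ suc j * fromℕ ((2 ℕ.* k ℕ.∸ suc j) C k) * (√2 ^ suc j / suc j) * sin ((3 ℕ.* suc j) · π / 4)

    -- The minus sign absorbs the extra sign in the prefactor `-1^ suc n` of `c-seq`.
    α : Series
    α k = - (Γ k /2^ k)

    α-0 : α 0 ≈ 0#
    α-0 = solve 1 (λ i → :- (con (+ 0) :* i) := con (+ 0)) refl (1/2^ 0)

    c≈T : ∀ n → c-seq sin π √2 n ≈ T n (substitute α)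
    c≈T n = begin
      (-1^ suc n /! n) * ∑₁ n (λ k → f k)
        -- The sum starts at `k = 1`; a term at `k = 0` may be added because `c-inner 0` is an empty
        -- sum.
        ≈⟨ *-congˡ (trans (∑-unfold n (f ∘ suc)) (trans (sym (+-identityˡ _)) (trans (+-congʳ (sym f0≈0)) (sym (∑-first n f))))) ⟩
      (-1^ suc n /! n) * ∑< (suc n) f
        ≈⟨ solve 3 (λ s i x → :- con (+ 1) :* s :* i :* x := s :* i :* (:- con (+ 1) :* x)) refl (-1^ n) (1/! n) _ ⟩
      (-1^ n /! n) * (- 1# * ∑< (suc n) f)
        ≈⟨ *-congˡ (∑-*ˡ (suc n) (- 1#) f) ⟨
      (-1^ n /! n) * ∑< (suc n) (λ k → - 1# * f k)
        ≈⟨ signed-sum n _ α term ⟩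
      T n (substitute α) ∎
      where
      f : ℕ → ℝ
      f k = -1^ k * S n k * (fromℕ (k ℕ.!) /2^ k) * Γ k

      f0≈0 : f 0 ≈ 0#
      f0≈0 = zeroʳ _

      term : ∀ k → - 1# * f k ≈ fromℕ (n ℕ.!) * (σ n k * alternate α k)
      term k = begin
        - 1# * f k
          ≈⟨ solve 7 (λ s m x i k h g → :- con (+ 1) :* (s :* (m :* (x :* i)) :* (k :* h) :* g)
               := (k :* i) :* (m :* (x :* (s :* :- (g :* h)))))
             refl (-1^ k) (fromℕ (n ℕ.!)) (σ n k) (1/! k) (fromℕ (k ℕ.!)) (1/2^ k) (Γ k) ⟩
        (fromℕ (k ℕ.!) * 1/! k) * (fromℕ (n ℕ.!) * (σ n k * alternate α k))
          ≈⟨ trans (*-congʳ (recip-inverseʳ (fromℕ-!#0 k))) (*-identityˡ _) ⟩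
        fromℕ (n ℕ.!) * (σ n k * alternate α k) ∎

    module _ (rotation-0 : rotation 0 ≈ 0#) (rotation-1 : rotation 1 ≈ - 1#)
             (rotation-rec : ∀ j → rotation (suc (suc j)) ≈ fromℕ 2 * (rotation (suc j) - rotation j)) where

      -- Division by `2^(k+1)` turns the inhomogeneous term `2^k` of `γ-recurrence` into the
      -- constant `1/2`.
      ∂-α : ∀ k → ∂ α k ≈ (fromℕ 2 * fromℕ k + 1#) * α k + 1# / 2
      ∂-α k = begin
        fromℕ (suc k) * - (Γ (suc k) * i′)
          ≈⟨ solve 3 (λ k g i → k :* :- (g :* i) := :- (k :* g :* i)) refl _ _ _ ⟩
        - (fromℕ (suc k) * Γ (suc k) * i′)
          ≈⟨ -‿cong (*-congʳ recurrence) ⟩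
        - ((fromℕ 2 * m * Γ k - fromℕ (2 ℕ.^ k)) * i′)
          ≈⟨ solve 4 (λ m g p i → :- ((con (+ 2) :* m :* g :- p) :* i) := m :* :- (g :* (con (+ 2) :* i)) :+ p :* i)
               refl m (Γ k) (fromℕ (2 ℕ.^ k)) i′ ⟩
        m * - (Γ k * (fromℕ 2 * i′)) + fromℕ (2 ℕ.^ k) * i′
          ≈⟨ +-cong (*-congˡ (-‿cong (*-congˡ (2*1/2^suc k)))) (2^*1/2^suc k) ⟩
        m * α k + 1# / 2 ∎
        where
        i′ = 1/2^ (suc k)
        m = fromℕ 2 * fromℕ k + 1#

        recurrence : fromℕ (suc k) * Γ (suc k) ≈ fromℕ 2 * m * Γ k - fromℕ (2 ℕ.^ k)
        recurrence = trans (*-congˡ (Γ≈ (suc k)))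
          (trans (γ-recurrence rotation rotation-0 rotation-1 rotation-rec weight weight-rotation k)
            (+-congʳ (*-congˡ (sym (Γ≈ k)))))

-- Growth of `b` and comparison with `c-seq` on coefficients.

module Comparison {c ℓ₁ ℓ₂ ℓ₃} (R : RealField c ℓ₁ ℓ₂ ℓ₃) where

  open Reals R hiding (zero)
  open Inequalities R
  open SumsAndLimits R
  open StirlingTransforms R
  open EulerTransform R
  open ≈-Reasoning setoid

  WallisRecurrence : Series → Set ℓ₁
  WallisRecurrence u = ∀ m → fromℕ (suc (suc m)) * u (suc (suc m)) ≈ fromℕ (suc m) * u m

  -- The tool that identifies the Euler transforms with Wallis integrals: agreement in the first two
  -- entries is enough.
  wallis-unique : ∀ {u v} → WallisRecurrence u → WallisRecurrence v → u 0 ≈ v 0 → u 1 ≈ v 1 → ∀ m → u m ≈ v m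
  wallis-unique ru rv u0 u1 zero          = u0
  wallis-unique ru rv u0 u1 (suc zero)    = u1
  wallis-unique ru rv u0 u1 (suc (suc m)) = *-cancelˡ (fromℕ (suc (suc m))) (fromℕ-suc#0 (suc m))
    (trans (ru m) (trans (*-congˡ (wallis-unique ru rv u0 u1 m)) (sym (rv m))))

  wallis-scale : ∀ x {u} → WallisRecurrence u → WallisRecurrence (λ m → x * u m)
  wallis-scale x {u} ru m = trans (swap (fromℕ (suc (suc m))) (u (suc (suc m))))
    (trans (*-congˡ (ru m)) (sym (swap (fromℕ (suc m)) (u m))))
    where
    swap : ∀ k y → k * (x * y) ≈ x * (k * y)
    swap k y = solve 3 (λ x k y → k :* (x :* y) := x :* (k :* y)) refl x k y

  ∣-1^∣≤1 : ∀ k → ∣ -1^ k ∣≤ 1#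
  ∣-1^∣≤1 zero    = 0≤⇒∣∣≤ 0≤1
  ∣-1^∣≤1 (suc k) = ∣∣≤-resp (solve 1 (λ x → :- x := :- con (+ 1) :* x) refl (-1^ k)) refl (∣-∣≤ (∣-1^∣≤1 k))

  -- A factor of period two passes through a two-step recurrence. For `x = 1` it selects the even
  -- indices and for `x = -1` the odd ones.
  wallis-twist : ∀ x {u} → WallisRecurrence u → WallisRecurrence (λ m → (1# + x * -1^ m) * u m)
  wallis-twist x {u} ru m = begin
    fromℕ (suc (suc m)) * ((1# + x * -1^ suc (suc m)) * u (suc (suc m)))
      ≈⟨ solve 4 (λ k x s u → k :* ((con (+ 1) :+ x :* (:- con (+ 1) :* (:- con (+ 1) :* s))) :* u)
           := (con (+ 1) :+ x :* s) :* (k :* u)) refl _ x (-1^ m) _ ⟩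
    (1# + x * -1^ m) * (fromℕ (suc (suc m)) * u (suc (suc m)))
      ≈⟨ *-congˡ (ru m) ⟩
    (1# + x * -1^ m) * (fromℕ (suc m) * u m)
      ≈⟨ solve 3 (λ y k u → y :* (k :* u) := k :* (y :* u)) refl _ _ _ ⟩
    fromℕ (suc m) * ((1# + x * -1^ m) * u m) ∎

  module WeightedRatio (π : ℝ) (0<π : 0# < π) (J : Series) (J-rec : WallisRecurrence J)
           (2J₀≈π : fromℕ 2 * J 0 ≈ π) (J₁≈1 : J 1 ≈ 1#)
           (0≤J : ∀ m → 0# ≤ J m) (J-antitone : ∀ m → J (suc m) ≤ J m)
           (β α : Series)
           (β-0 : euler β 0 ≈ 1#) (β-1 : euler β 1 ≈ 0#) (β-rec : WallisRecurrence (euler β))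
           (α-0 : euler α 0 ≈ 0#) (α-1 : fromℕ 2 * euler α 1 ≈ 1#) (α-rec : WallisRecurrence (euler α))
    where

    -- `g` lists the coefficients of `(1 + x) P′(x)`, which represents `dB/dz`.
    p q g : Series
    p = substitute β
    q = substitute α
    g k = θ p k + ∂ p k

    B C : ℕ → ℝ
    B n = T n p
    C n = T n q

    π-euler-β : ∀ m → π * euler β m ≈ (1# + 1# * -1^ m) * J m
    π-euler-β = wallis-unique (wallis-scale π β-rec) (wallis-twist 1# J-rec)
      (trans (*-congˡ β-0) (trans (*-identityʳ π) (trans (sym 2J₀≈π)
        (solve 1 (λ j → con (+ 2) :* j := (con (+ 1) :+ con (+ 1) :* con (+ 1)) :* j) refl (J 0)))))
      (trans (*-congˡ β-1) (solve 2 (λ x j → x :* con (+ 0)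
        := (con (+ 1) :+ con (+ 1) :* (:- con (+ 1) :* con (+ 1))) :* j) refl π (J 1)))

    4-euler-α : ∀ m → fromℕ 4 * euler α m ≈ (1# + - 1# * -1^ m) * J m
    4-euler-α = wallis-unique (wallis-scale (fromℕ 4) α-rec) (wallis-twist (- 1#) J-rec)
      (trans (*-congˡ α-0) (solve 1 (λ j → con (+ 4) :* con (+ 0)
        := (con (+ 1) :+ :- con (+ 1) :* con (+ 1)) :* j) refl (J 0)))
      (begin
        fromℕ 4 * euler α 1              ≈⟨ solve 1 (λ x → con (+ 4) :* x := con (+ 2) :* (con (+ 2) :* x)) refl (euler α 1) ⟩
        fromℕ 2 * (fromℕ 2 * euler α 1)  ≈⟨ *-congˡ (trans α-1 (sym J₁≈1)) ⟩
        fromℕ 2 * J 1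
          ≈⟨ solve 1 (λ j → con (+ 2) :* j := (con (+ 1) :+ :- con (+ 1) :* (:- con (+ 1) :* con (+ 1))) :* j) refl (J 1) ⟩
        (1# + - 1# * -1^ 1) * J 1        ∎)

    πp : ∀ m → π * p (suc m) ≈ (1# + -1^ m) * J m + (1# - -1^ m) * J (suc m)
    πp m = begin
      π * (euler β (suc m) + euler β m)      ≈⟨ distribˡ _ _ _ ⟩
      π * euler β (suc m) + π * euler β m    ≈⟨ +-cong (π-euler-β (suc m)) (π-euler-β m) ⟩
      (1# + 1# * (- 1# * -1^ m)) * J (suc m) + (1# + 1# * -1^ m) * J m
        ≈⟨ solve 3 (λ s j k → (con (+ 1) :+ con (+ 1) :* (:- con (+ 1) :* s)) :* k :+ (con (+ 1) :+ con (+ 1) :* s) :* j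
             := (con (+ 1) :+ s) :* j :+ (con (+ 1) :- s) :* k) refl (-1^ m) (J m) (J (suc m)) ⟩
      (1# + -1^ m) * J m + (1# - -1^ m) * J (suc m) ∎

    0≤1+-1^ : ∀ m → 0# ≤ 1# + -1^ m
    0≤1+-1^ m = ≤-respʳ (solve 1 (λ s → s :- :- con (+ 1) := con (+ 1) :+ s) refl (-1^ m)) (≤⇒0≤- (proj₁ (∣-1^∣≤1 m)))

    0≤1--1^ : ∀ m → 0# ≤ 1# - -1^ m
    0≤1--1^ m = ≤⇒0≤- (proj₂ (∣-1^∣≤1 m))

    0≤π* : ∀ {x} → 0# ≤ π * x → 0# ≤ x
    0≤π* 0≤πx = *-cancelˡ-≤ π 0<π (≤-respˡ (sym (zeroʳ π)) 0≤πx)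

    0≤p : ∀ m → 0# ≤ p m
    0≤p zero    = ≤-respʳ (sym β-0) 0≤1
    0≤p (suc m) = 0≤π* (≤-respʳ (sym (πp m)) (0≤+ (0≤* (0≤1+-1^ m) (0≤J m)) (0≤* (0≤1--1^ m) (0≤J (suc m)))))

    p₁≈1 : p 1 ≈ 1#
    p₁≈1 = trans (+-cong β-1 β-0) (+-identityˡ 1#)

    -- By `πp` the values come in equal pairs: for odd `m` both `π p (m+1)` and `π p (m+2)` equal
    -- `2 J (m+1)`, and for even `m` the drop is `2 (J m - J (m+2))`.
    p-antitone : ∀ m → p (suc m) ≤ p m
    p-antitone zero    = ≈⇒≤ (trans p₁≈1 (sym β-0))
    p-antitone (suc m) = *-cancelˡ-≤ π 0<π (≤-by
      (0≤* (0≤1+-1^ m) (≤⇒0≤- (≤-trans (J-antitone (suc m)) (J-antitone m))))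
      (trans (+-cong (πp m) (-‿cong (πp (suc m))))
        (solve 4 (λ s x y z → ((con (+ 1) :+ s) :* x :+ (con (+ 1) :- s) :* y)
            :- ((con (+ 1) :+ :- con (+ 1) :* s) :* y :+ (con (+ 1) :- :- con (+ 1) :* s) :* z)
            := (con (+ 1) :+ s) :* (x :- z)) refl (-1^ m) (J m) (J (suc m)) (J (suc (suc m))))))

    -- Represents `4 (π b - c)`. Since `p` comes from the even and `q` from the odd Wallis
    -- integrals, the difference is the single alternating series `2 (1 + x) ∑ (-1)^m J m x^m`.
    d : Series
    d k = π * p k + - fromℕ 4 * q k

    d-suc : ∀ m → d (suc m) ≈ fromℕ 2 * (-1^ m * (J m - J (suc m)))
    d-suc m = begin
      π * p (suc m) + - fromℕ 4 * q (suc m)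
        ≈⟨ +-cong (πp m) (solve 2 (λ x y → :- con (+ 4) :* (x :+ y) := :- (con (+ 4) :* x :+ con (+ 4) :* y)) refl _ _) ⟩
      ((1# + -1^ m) * J m + (1# - -1^ m) * J (suc m)) - (fromℕ 4 * euler α (suc m) + fromℕ 4 * euler α m)
        ≈⟨ +-congˡ (-‿cong (+-cong (4-euler-α (suc m)) (4-euler-α m))) ⟩
      ((1# + -1^ m) * J m + (1# - -1^ m) * J (suc m))
        - ((1# + - 1# * -1^ suc m) * J (suc m) + (1# + - 1# * -1^ m) * J m)
        ≈⟨ solve 3 (λ s x y → ((con (+ 1) :+ s) :* x :+ (con (+ 1) :- s) :* y)
             :- ((con (+ 1) :+ :- con (+ 1) :* (:- con (+ 1) :* s)) :* y :+ (con (+ 1) :+ :- con (+ 1) :* s) :* x)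
             := con (+ 2) :* (s :* (x :- y))) refl (-1^ m) (J m) (J (suc m)) ⟩
      fromℕ 2 * (-1^ m * (J m - J (suc m))) ∎

    -- (m + 1) J m = (m + 2) J (m + 2) ≤ (m + 2) J (m + 1).
    J-decrement : ∀ m → fromℕ (suc m) * (J m - J (suc m)) ≤ J (suc m)
    J-decrement m = ≤-by (0≤* (0≤fromℕ (suc (suc m))) (≤⇒0≤- (J-antitone (suc m)))) (begin
      J (suc m) - fromℕ (suc m) * (J m - J (suc m))
        ≈⟨ solve 3 (λ k x y → y :- k :* (x :- y) := (con (+ 1) :+ k) :* y :- k :* x) refl (fromℕ (suc m)) (J m) (J (suc m)) ⟩
      fromℕ (suc (suc m)) * J (suc m) - fromℕ (suc m) * J m
        ≈⟨ +-congˡ (-‿cong (J-rec m)) ⟨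
      fromℕ (suc (suc m)) * J (suc m) - fromℕ (suc (suc m)) * J (suc (suc m))
        ≈⟨ solve 3 (λ k x y → k :* x :- k :* y := k :* (x :- y)) refl _ _ _ ⟩
      fromℕ (suc (suc m)) * (J (suc m) - J (suc (suc m))) ∎)

    -- The differences in `d-suc` gain a factor `m + 1` by `J-decrement`, and `2 J (m+1)` is at most
    -- `π p (m+1)`.
    d-bound : ∀ m → ∣ fromℕ (suc m) * d (suc m) ∣≤ π * p (suc m)
    d-bound m = ∣∣≤-weaken 2J≤πp (∣∣≤-resp
      (trans (solve 3 (λ k s x → s :* (con (+ 2) :* (k :* x)) := k :* (con (+ 2) :* (s :* x))) refl _ _ _) (*-congˡ (sym (d-suc m))))
      (*-identityˡ _)
      (∣*∣≤ (∣-1^∣≤1 m) (∣∣≤-weaken (*-monoʳ-≤ (fromℕ 2) (0≤fromℕ 2) (J-decrement m))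
        (0≤⇒∣∣≤ (0≤* (0≤fromℕ 2) (0≤* (0≤fromℕ (suc m)) (≤⇒0≤- (J-antitone m))))))))
      where
      2J≤πp : fromℕ 2 * J (suc m) ≤ π * p (suc m)
      2J≤πp = ≤-by (0≤* (0≤1+-1^ m) (≤⇒0≤- (J-antitone m))) (trans (+-congʳ (πp m))
        (solve 3 (λ s x y → ((con (+ 1) :+ s) :* x :+ (con (+ 1) :- s) :* y) :- con (+ 2) :* y
          := (con (+ 1) :+ s) :* (x :- y)) refl (-1^ m) (J m) (J (suc m))))

    T-drop-first : ∀ n f → T (suc n) f ≈ ∑< (suc n) (λ k → σ (suc n) (suc k) * f (suc k))
    T-drop-first n f = trans (∑-first (suc n) _) (trans (+-congʳ (zeroˡ (f 0))) (+-identityˡ _))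

    T-extend : ∀ n f → ∑< (suc (suc n)) (λ k → σ n k * f k) ≈ T n f
    T-extend n f = trans (∑-last (suc n) _)
      (trans (+-congˡ (trans (*-congʳ (σ-vanishes n (suc n) (ℕ.n<1+n n))) (zeroˡ _))) (+-identityʳ _))

    -- The Stirling recurrence trades the factor `n + 1` for `k + 1` in front of `d (k+1)`, where
    -- `d-bound` applies. It produces two sums, each at most `π B n`: in one only the nonnegative
    -- term at index `0` is missing, and the other is bounded by `p-antitone`.
    difference-bound : ∀ n → ∣ fromℕ (suc n) * (π * B (suc n) + - fromℕ 4 * C (suc n)) ∣≤ π * (fromℕ 2 * B n)
    difference-bound n = ∣∣≤-resp (sym expand) refl (∣∣≤-weaken total (∣∑∣≤ (suc n) term))
      where
      expand : fromℕ (suc n) * (π * B (suc n) + - fromℕ 4 * C (suc n))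
             ≈ ∑< (suc n) (λ k → (σ n (suc k) + σ n k) * (fromℕ (suc k) * d (suc k)))
      expand = begin
        fromℕ (suc n) * (π * B (suc n) + - fromℕ 4 * C (suc n))
          ≈⟨ *-congˡ (trans (+-cong (sym (T-* (suc n) π p)) (sym (T-* (suc n) (- fromℕ 4) q))) (sym (T-+ (suc n) _ _))) ⟩
        fromℕ (suc n) * T (suc n) d
          ≈⟨ *-congˡ (T-drop-first n d) ⟩
        fromℕ (suc n) * ∑< (suc n) (λ k → σ (suc n) (suc k) * d (suc k))
          ≈⟨ ∑-*ˡ (suc n) _ _ ⟨
        ∑< (suc n) (λ k → fromℕ (suc n) * (σ (suc n) (suc k) * d (suc k)))
          ≈⟨ ∑-cong (suc n) (λ k → trans (sym (*-assoc _ _ _)) (trans (*-congʳ (σ-recurrence n k))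
               (solve 3 (λ k s x → k :* s :* x := s :* (k :* x)) refl _ _ _))) ⟩
        ∑< (suc n) (λ k → (σ n (suc k) + σ n k) * (fromℕ (suc k) * d (suc k))) ∎

      term : ∀ k → ∣ (σ n (suc k) + σ n k) * (fromℕ (suc k) * d (suc k)) ∣≤ (σ n (suc k) + σ n k) * (π * p (suc k))
      term k = ∣*∣≤ (0≤⇒∣∣≤ (0≤+ (0≤σ n (suc k)) (0≤σ n k))) (d-bound k)

      tail≤B : ∑< (suc n) (λ k → σ n (suc k) * p (suc k)) ≤ B n
      tail≤B = ≤-by (0≤* (0≤σ n 0) (0≤p 0)) (begin
        B n - ∑< (suc n) (λ k → σ n (suc k) * p (suc k))
          ≈⟨ +-congʳ (trans (sym (T-extend n p)) (∑-first (suc n) _)) ⟩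
        (σ n 0 * p 0 + ∑< (suc n) (λ k → σ n (suc k) * p (suc k))) - ∑< (suc n) (λ k → σ n (suc k) * p (suc k))
          ≈⟨ solve 2 (λ x y → (x :+ y) :- y := x) refl (σ n 0 * p 0) _ ⟩
        σ n 0 * p 0 ∎)

      total : ∑< (suc n) (λ k → (σ n (suc k) + σ n k) * (π * p (suc k))) ≤ π * (fromℕ 2 * B n)
      total = ≤-resp
        (sym (trans (∑-cong (suc n) (λ k → solve 4 (λ s t x y → (s :+ t) :* (x :* y) := x :* (s :* y :+ t :* y)) refl _ _ π _))
          (trans (∑-*ˡ (suc n) π _) (*-congˡ (∑-+ (suc n) (λ k → σ n (suc k) * p (suc k)) (λ k → σ n k * p (suc k)))))))
        (*-congˡ (solve 1 (λ x → x :+ x := con (+ 2) :* x) refl (B n)))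
        (*-monoʳ-≤ π (<⇒≤ 0<π) (+-mono-≤ tail≤B (∑-mono (suc n) λ k → *-monoʳ-≤ (σ n k) (0≤σ n k) (p-antitone k))))

    x* : Series → Series
    x* f zero    = 0#
    x* f (suc k) = f k

    -- Here `P = √((1 + x)/(1 - x))`, so `(1 - x²) P′ = P`; for `G = (1 + x) P′` this reads
    -- `G = P + x G`.
    p-rec : ∀ k → g k ≈ p k + x* g k
    p-rec zero    = trans (solve 2 (λ x y → con (+ 0) :* x :+ (con (+ 1) :+ con (+ 0)) :* y := y) refl (p 0) (p 1))
      (trans p₁≈1 (trans (sym β-0) (sym (+-identityʳ _))))
    p-rec (suc k) = trans (+-congˡ (∂p k))
      (solve 3 (λ k x y → (con (+ 1) :+ k) :* x :+ (x :+ k :* y) := x :+ (k :* y :+ (con (+ 1) :+ k) :* x))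
        refl (fromℕ k) (p (suc k)) (p k))
      where
      ∂p : ∀ k → ∂ p (suc k) ≈ p (suc k) + fromℕ k * p k
      ∂p zero    = begin
        fromℕ 2 * (euler β 2 + euler β 1)
          ≈⟨ trans (distribˡ _ _ _) (+-cong (β-rec 0) (trans (*-congˡ β-1) (zeroʳ _))) ⟩
        fromℕ 1 * euler β 0 + 0#
          ≈⟨ solve 1 (λ x → (con (+ 1) :+ con (+ 0)) :* x :+ con (+ 0) := (con (+ 0) :+ x) :+ con (+ 0) :* x) refl (euler β 0) ⟩
        (0# + euler β 0) + 0# * euler β 0
          ≈⟨ +-congʳ (+-congʳ β-1) ⟨
        p 1 + 0# * p 0 ∎
      ∂p (suc k) = begin
        fromℕ (suc (suc (suc k))) * (euler β (suc (suc (suc k))) + y)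
          ≈⟨ trans (distribˡ _ _ _) (+-congʳ (β-rec (suc k))) ⟩
        fromℕ (suc (suc k)) * z + (1# + fromℕ (suc (suc k))) * y
          ≈⟨ solve 4 (λ k y z w → k :* z :+ (con (+ 1) :+ k) :* y := (con (+ 1) :* y) :+ k :* z :+ k :* y) refl _ _ _ y ⟩
        1# * y + fromℕ (suc (suc k)) * z + fromℕ (suc (suc k)) * y
          ≈⟨ +-congˡ (β-rec k) ⟩
        1# * y + (1# + fromℕ (suc k)) * z + fromℕ (suc k) * w
          ≈⟨ solve 4 (λ k y z w → con (+ 1) :* y :+ (con (+ 1) :+ k) :* z :+ k :* w := (y :+ z) :+ k :* (z :+ w)) refl (fromℕ (suc k)) y z w ⟩
        (y + z) + fromℕ (suc k) * (z + w) ∎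
        where
        y = euler β (suc (suc k))
        z = euler β (suc k)
        w = euler β k

    0≤g : ∀ k → 0# ≤ g k
    0≤g k = 0≤+ (0≤* (0≤fromℕ k) (0≤p k)) (0≤* (0≤fromℕ (suc k)) (0≤p (suc k)))

    B-suc : ∀ n → fromℕ (suc n) * B (suc n) ≈ B n + T n (x* g)
    B-suc n = trans (T-suc n p) (trans (T-cong n p-rec) (T-+ n p (x* g)))

    -- Multiplying by `x = e^z - 1` dominates multiplying by `z + z²/2`, as all coefficients are
    -- nonnegative.
    T-x* : ∀ n → fromℕ 2 * T (suc n) g + T n g ≤ fromℕ 2 * T (suc (suc n)) (x* g)
    T-x* n = ≤-resp
      (begin
        ∑< (suc (suc n)) (λ k → (fromℕ 2 * σ (suc n) k + σ n k) * g k)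
          ≈⟨ ∑-cong (suc (suc n)) (λ k → solve 3 (λ s t g → (con (+ 2) :* s :+ t) :* g := t :* g :+ con (+ 2) :* (s :* g)) refl _ _ _) ⟩
        ∑< (suc (suc n)) (λ k → σ n k * g k + fromℕ 2 * (σ (suc n) k * g k))
          ≈⟨ trans (∑-+* (suc (suc n)) (fromℕ 2) _ _) (+-congʳ (T-extend n g)) ⟩
        T n g + fromℕ 2 * T (suc n) g
          ≈⟨ +-comm _ _ ⟩
        fromℕ 2 * T (suc n) g + T n g ∎)
      (trans (∑-cong (suc (suc n)) (λ k → *-assoc (fromℕ 2) _ _))
        (trans (∑-*ˡ (suc (suc n)) (fromℕ 2) _) (*-congˡ (sym (T-drop-first (suc n) (x* g))))))
      (∑-mono (suc (suc n)) λ k → *-monoˡ-≤ (g k) (0≤g k) (σ-lower-bound n k))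

    -- `B-suc` and `T-x*` give `(n+3)(B (n+3) - B (n+2)) ≥ ½ (n+1) B
    -- (n+1)`. The constant `6` works since `(n+1)/(2(n+3))` is at least `1/6`, with equality at `n
    -- = 0`.
    B-growth : ∀ n → fromℕ 6 * B (suc (suc n)) + B (suc n) ≤ fromℕ 6 * B (suc (suc (suc n)))
    B-growth n = *-cancelˡ-≤ (fromℕ (suc (suc (suc n)))) (fromℕ-pos (suc (suc n))) (≤-by
      (0≤+ (0≤* (0≤fromℕ 3) (≤⇒0≤- (T-x* n))) (0≤* (0≤* (0≤fromℕ 2) (0≤fromℕ n)) (0≤B (suc n))))
      (begin
        N * (fromℕ 6 * B (suc (suc (suc n)))) - N * (fromℕ 6 * y + x)
          ≈⟨ solve 4 (λ n z y x → n :* (con (+ 6) :* z) :- n :* (con (+ 6) :* y :+ x) := con (+ 6) :* (n :* z) :- n :* (con (+ 6) :* y :+ x)) refl N _ y x ⟩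
        fromℕ 6 * (N * B (suc (suc (suc n)))) - N * (fromℕ 6 * y + x)
          ≈⟨ +-congʳ (*-congˡ (B-suc (suc (suc n)))) ⟩
        fromℕ 6 * (y + e) - N * (fromℕ 6 * y + x)
          ≈⟨ solve 4 (λ n e y x → con (+ 6) :* (y :+ e) :- (con (+ 1) :+ (con (+ 1) :+ (con (+ 1) :+ n))) :* (con (+ 6) :* y :+ x)
               := con (+ 3) :* (con (+ 2) :* e :- (con (+ 2) :* ((con (+ 1) :+ (con (+ 1) :+ n)) :* y) :+ (con (+ 1) :+ n) :* x))
                  :+ con (+ 2) :* n :* x) refl (fromℕ n) e y x ⟩
        fromℕ 3 * (fromℕ 2 * e - (fromℕ 2 * (fromℕ (suc (suc n)) * y) + fromℕ (suc n) * x)) + fromℕ 2 * fromℕ n * x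
          ≈⟨ +-congʳ (*-congˡ (+-congˡ (-‿cong (+-cong (*-congˡ (T-suc (suc n) p)) (T-suc n p))))) ⟩
        fromℕ 3 * (fromℕ 2 * e - (fromℕ 2 * T (suc n) g + T n g)) + fromℕ 2 * fromℕ n * x ∎))
      where
      N = fromℕ (suc (suc (suc n)))
      x = B (suc n)
      y = B (suc (suc n))
      e = T (suc (suc n)) (x* g)
      0≤B : ∀ n → 0# ≤ B n
      0≤B n = 0≤∑ (suc n) λ k → 0≤* (0≤σ n k) (0≤p k)

    T-0 : ∀ f → T 0 f ≈ f 0
    T-0 f = trans (∑-first 0 _) (trans (+-congˡ (∑-empty _)) (trans (+-identityʳ _) (*-identityˡ (f 0))))

    B₀≈1 : B 0 ≈ 1#
    B₀≈1 = trans (T-0 p) β-0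

    B₁≈1 : B 1 ≈ 1#
    B₁≈1 = begin
      B 1                  ≈⟨ solve 1 (λ x → x := (con (+ 1) :+ con (+ 0)) :* x) refl (B 1) ⟩
      fromℕ 1 * B 1        ≈⟨ B-suc 0 ⟩
      B 0 + T 0 (x* g)     ≈⟨ +-cong B₀≈1 (T-0 (x* g)) ⟩
      1# + 0#              ≈⟨ +-identityʳ 1# ⟩
      1#                   ∎

    B₂≈1 : B 2 ≈ 1#
    B₂≈1 = *-cancelˡ (fromℕ 2) (fromℕ-suc#0 1) (begin
      fromℕ 2 * B 2                      ≈⟨ B-suc 1 ⟩
      B 1 + T 1 (x* g)                   ≈⟨ +-cong B₁≈1 (T-drop-first 0 (x* g)) ⟩
      1# + ∑< 1 (λ k → σ 1 (suc k) * g k)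
        ≈⟨ +-congˡ (trans (∑-first 0 _) (+-cong (*-cong σ₁₁≈1 g₀≈1) (∑-empty _))) ⟩
      1# + (1# * 1# + 0#)                ≈⟨ solve 0 (con (+ 1) :+ (con (+ 1) :* con (+ 1) :+ con (+ 0)) := con (+ 2) :* con (+ 1)) refl ⟩
      fromℕ 2 * 1#                       ∎)
      where
      σ₁₁≈1 : σ 1 1 ≈ 1#
      σ₁₁≈1 = begin
        σ 1 1                       ≈⟨ solve 1 (λ x → x := (con (+ 1) :+ con (+ 0)) :* x) refl (σ 1 1) ⟩
        fromℕ 1 * σ 1 1             ≈⟨ σ-recurrence 0 0 ⟩
        fromℕ 1 * (σ 0 1 + σ 0 0)   ≈⟨ *-congˡ (+-congʳ (σ-vanishes 0 1 z<s)) ⟩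
        fromℕ 1 * (0# + 1#)         ≈⟨ solve 0 ((con (+ 1) :+ con (+ 0)) :* (con (+ 0) :+ con (+ 1)) := con (+ 1)) refl ⟩
        1#                          ∎

      g₀≈1 : g 0 ≈ 1#
      g₀≈1 = trans (p-rec 0) (trans (+-identityʳ _) β-0)

    -- The two bounds support each other: an entry that is at least `1` makes `6 B` grow by at least
    -- `1`, and linear growth keeps the entries at least `1`.
    B-lower-bound : ∀ n → 1# ≤ B (suc n) × fromℕ 6 + fromℕ n ≤ fromℕ 6 * B (suc (suc n))
    B-lower-bound zero    = ≈⇒≤ (sym B₁≈1) , ≈⇒≤ (trans (+-identityʳ _) (sym (trans (*-congˡ B₂≈1) (*-identityʳ _))))
    B-lower-bound (suc n) with B-lower-bound n
    ... | 1≤B , 6+n≤6B =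
      *-cancelˡ-≤ (fromℕ 6) (fromℕ-pos 5) (≤-trans (≤-by (0≤fromℕ n)
        (solve 1 (λ n → (con (+ 6) :+ n) :- con (+ 6) :* con (+ 1) := n) refl (fromℕ n))) 6+n≤6B) ,
      ≤-trans (≤-respˡ (solve 1 (λ n → (con (+ 6) :+ n) :+ con (+ 1) := con (+ 6) :+ (con (+ 1) :+ n)) refl (fromℕ n))
        (+-mono-≤ 6+n≤6B 1≤B)) (B-growth n)

    1≤B : ∀ n → 1# ≤ B n
    1≤B zero    = ≈⇒≤ (sym B₀≈1)
    1≤B (suc n) = proj₁ (B-lower-bound n)

    B-mono : ∀ n → B n ≤ B (suc n)
    B-mono zero          = ≈⇒≤ (trans B₀≈1 (sym B₁≈1))
    B-mono (suc zero)    = ≈⇒≤ (trans B₁≈1 (sym B₂≈1))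
    B-mono (suc (suc n)) = *-cancelˡ-≤ (fromℕ 6) (fromℕ-pos 5) (≤-trans
      (≤-by (≤-trans 0≤1 (1≤B (suc n))) (solve 2 (λ x y → (x :+ y) :- x := y) refl _ (B (suc n)))) (B-growth n))

    B⟶+∞ : ∀ M → ∃ λ N → ∀ n → N ℕ.≤ n → M < B n
    B⟶+∞ M with archimedean (fromℕ 6 * M)
    ... | N , 6M<N = suc (suc N) , above
      where
      above : ∀ n → suc (suc N) ℕ.≤ n → M < B n
      above (suc (suc n)) (s≤s (s≤s N≤n)) = *-cancelˡ-< (fromℕ 6) (fromℕ-pos 5)
        (<-≤-trans 6M<N (≤-trans (fromℕ-mono N≤n) (≤-trans
          (≤-by (0≤fromℕ 6) (solve 2 (λ x y → (y :+ x) :- x := y) refl (fromℕ n) (fromℕ 6)))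
          (proj₂ (B-lower-bound n)))))

    ratio-bound : ∀ n → ∣ fromℕ (suc n) * (π * B (suc n) + - fromℕ 4 * C (suc n)) ∣≤ π * (fromℕ 2 * B (suc n))
    ratio-bound n = ∣∣≤-weaken (*-monoʳ-≤ π (<⇒≤ 0<π) (*-monoʳ-≤ (fromℕ 2) (0≤fromℕ 2) (B-mono n))) (difference-bound n)

-- Differentiation with quadratic error and monotonicity.

module Differentiation {c ℓ₁ ℓ₂ ℓ₃} (R : RealField c ℓ₁ ℓ₂ ℓ₃) where

  open Reals R hiding (zero)
  open Inequalities R
  open ≈-Reasoning setoid

  ∣∣≤-cancel : ∀ k {x a} → 0# < k → ∣ k * x ∣≤ k * a → ∣ x ∣≤ a
  ∣∣≤-cancel k {x} {a} 0<k (p , q) =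
    *-cancelˡ-≤ k 0<k (≤-respˡ (solve 2 (λ k a → :- (k :* a) := k :* :- a) refl k a) p) , *-cancelˡ-≤ k 0<k q

  -- Differentiability on [0, r] with a quadratic error term, which makes the
  -- derivative unique and the mean value inequality constructive.
  record Differentiable (r : ℝ) (f f′ : ℝ → ℝ) : Set (c ⊔ ℓ₃) where
    field
      bound bound′ error : ℝ
      f-bound  : ∀ {x} → 0# ≤ x → x ≤ r → ∣ f x ∣≤ bound
      f′-bound : ∀ {x} → 0# ≤ x → x ≤ r → ∣ f′ x ∣≤ bound′
      approx   : ∀ {x y} → 0# ≤ x → x ≤ r → 0# ≤ y → y ≤ r →
                 ∣ f y - f x - f′ x * (y - x) ∣≤ error * ((y - x) * (y - x))

  differentiable-resp : ∀ {r f f′ g′} → (∀ x → 0# ≤ x → f′ x ≈ g′ x) → Differentiable r f f′ → Differentiable r f g′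
  differentiable-resp f′≈g′ D = record
    { bound    = bound
    ; bound′   = bound′
    ; error    = error
    ; f-bound  = f-bound
    ; f′-bound = λ 0≤x x≤r → ∣∣≤-resp (f′≈g′ _ 0≤x) refl (f′-bound 0≤x x≤r)
    ; approx   = λ 0≤x x≤r 0≤y y≤r → ∣∣≤-resp (+-congˡ (-‿cong (*-congʳ (f′≈g′ _ 0≤x)))) refl (approx 0≤x x≤r 0≤y y≤r)
    }
    where open Differentiable D

  restrict : ∀ {r s f f′} → s ≤ r → Differentiable r f f′ → Differentiable s f f′
  restrict s≤r D = record
    { bound    = bound
    ; bound′   = bound′
    ; error    = error
    ; f-bound  = λ p q → f-bound p (≤-trans q s≤r)
    ; f′-bound = λ p q → f′-bound p (≤-trans q s≤r)
    ; approx   = λ p q u v → approx p (≤-trans q s≤r) u (≤-trans v s≤r)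
    }
    where open Differentiable D

  const-differentiable : ∀ {r} k → Differentiable r (λ _ → k) (λ _ → 0#)
  const-differentiable k = record
    { bound    = 1# + k * k
    ; bound′   = 0#
    ; error    = 0#
    ; f-bound  = λ _ _ → ∣∣≤1+square k
    ; f′-bound = λ _ _ → 0≤⇒∣∣≤ ≤-refl
    ; approx   = λ {x} {y} _ _ _ _ → ∣∣≤-resp
        (solve 3 (λ k x y → con (+ 0) := k :- k :- con (+ 0) :* (y :- x)) refl k x y)
        (sym (zeroˡ _)) (0≤⇒∣∣≤ ≤-refl)
    }

  id-differentiable : ∀ {r} → Differentiable r (λ x → x) (λ _ → 1#)
  id-differentiable {r} = record
    { bound    = r
    ; bound′   = 1#
    ; error    = 0#
    ; f-bound  = λ 0≤x x≤r → ∣∣≤-weaken x≤r (0≤⇒∣∣≤ 0≤x)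
    ; f′-bound = λ _ _ → 0≤⇒∣∣≤ 0≤1
    ; approx   = λ {x} {y} _ _ _ _ → ∣∣≤-resp
        (solve 2 (λ x y → con (+ 0) := y :- x :- con (+ 1) :* (y :- x)) refl x y)
        (sym (zeroˡ _)) (0≤⇒∣∣≤ ≤-refl)
    }

  +-differentiable : ∀ {r f f′ g g′} → Differentiable r f f′ → Differentiable r g g′ →
                     Differentiable r (λ x → f x + g x) (λ x → f′ x + g′ x)
  +-differentiable {f = f} {f′} {g} {g′} D E = record
    { bound    = D.bound + E.bound
    ; bound′   = D.bound′ + E.bound′
    ; error    = D.error + E.error
    ; f-bound  = λ p q → ∣+∣≤ (D.f-bound p q) (E.f-bound p q)
    ; f′-bound = λ p q → ∣+∣≤ (D.f′-bound p q) (E.f′-bound p q)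
    ; approx   = λ {x} {y} p q r s → ∣∣≤-resp
        (solve 7 (λ a b c u v w h → (a :- b :- c :* h) :+ (u :- v :- w :* h) := (a :+ u) :- (b :+ v) :- (c :+ w) :* h)
          refl (f y) (f x) (f′ x) (g y) (g x) (g′ x) (y - x))
        (sym (distribʳ _ _ _)) (∣+∣≤ (D.approx p q r s) (E.approx p q r s))
    }
    where
    module D = Differentiable D
    module E = Differentiable E

  -- With `h = y - x`, the remainder is (remainder of `f`) `g y` + `f x` (remainder of `g`) +
  -- `f′ x h (g y - g x)`. In the last term `g y - g x` is expanded once more, and `h` is bounded by
  -- `r`.
  *-differentiable : ∀ {r f f′ g g′} → Differentiable r f f′ → Differentiable r g g′ →
                     Differentiable r (λ x → f x * g x) (λ x → f′ x * g x + f x * g′ x)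
  *-differentiable {r} {f} {f′} {g} {g′} D E = record
    { bound    = D.bound * E.bound
    ; bound′   = D.bound′ * E.bound + D.bound * E.bound′
    ; error    = D.error * E.bound + D.bound * E.error + D.bound′ * (E.bound′ + r * E.error)
    ; f-bound  = λ p q → ∣*∣≤ (D.f-bound p q) (E.f-bound p q)
    ; f′-bound = λ p q → ∣+∣≤ (∣*∣≤ (D.f′-bound p q) (E.f-bound p q)) (∣*∣≤ (D.f-bound p q) (E.f′-bound p q))
    ; approx   = approx
    }
    where
    module D = Differentiable D
    module E = Differentiable E

    approx : ∀ {x y} → 0# ≤ x → x ≤ r → 0# ≤ y → y ≤ r →
      ∣ f y * g y - f x * g x - (f′ x * g x + f x * g′ x) * (y - x) ∣≤
      (D.error * E.bound + D.bound * E.error + D.bound′ * (E.bound′ + r * E.error)) * ((y - x) * (y - x))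
    approx {x} {y} 0≤x x≤r 0≤y y≤r = ∣∣≤-resp
      (solve 7 (λ a b c u v w h →
         ((a :- b :- c :* h) :* u :+ b :* (u :- v :- w :* h)) :+ c :* (w :* (h :* h) :+ h :* (u :- v :- w :* h))
           := a :* u :- b :* v :- (c :* v :+ b :* w) :* h)
        refl (f y) (f x) (f′ x) (g y) (g x) (g′ x) (y - x))
      (solve 8 (λ a b c u v w r k → ((c :* k) :* u :+ a :* (w :* k)) :+ b :* (v :* k :+ r :* (w :* k))
           := (c :* u :+ a :* w :+ b :* (v :+ r :* w)) :* k)
        refl D.bound D.bound′ D.error E.bound E.bound′ E.error r _)
      (∣+∣≤ (∣+∣≤ (∣*∣≤ (D.approx 0≤x x≤r 0≤y y≤r) (E.f-bound 0≤y y≤r))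
                  (∣*∣≤ (D.f-bound 0≤x x≤r) (E.approx 0≤x x≤r 0≤y y≤r)))
            (∣*∣≤ (D.f′-bound 0≤x x≤r)
              (∣+∣≤ (∣*∣≤ (E.f′-bound 0≤x x≤r) (0≤⇒∣∣≤ (0≤square (y - x))))
                    (∣*∣≤ ∣y-x∣≤r (E.approx 0≤x x≤r 0≤y y≤r)))))
      where
      ∣y-x∣≤r : ∣ y - x ∣≤ r
      ∣y-x∣≤r =
        ≤-by (0≤+ (≤⇒0≤- x≤r) 0≤y) (solve 3 (λ x y r → (y :- x) :- :- r := (r :- x) :+ y) refl x y r) ,
        ≤-by (0≤+ (≤⇒0≤- y≤r) 0≤x) (solve 3 (λ x y r → r :- (y :- x) := (r :- y) :+ x) refl x y r)

  scale-differentiable : ∀ {r f f′} k → Differentiable r f f′ → Differentiable r (λ x → k * f x) (λ x → k * f′ x)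
  scale-differentiable k D = differentiable-resp (λ x _ → trans (+-congʳ (zeroˡ _)) (+-identityˡ _))
    (*-differentiable (const-differentiable k) D)

  -- Reflection maps `[0, r]` to itself, so the addition theorems need no chain rule beyond this
  -- one.
  reflect-differentiable : ∀ {r f f′} → Differentiable r f f′ →
                           Differentiable r (λ x → f (r - x)) (λ x → - f′ (r - x))
  reflect-differentiable {r} {f} {f′} D = record
    { bound    = bound
    ; bound′   = bound′
    ; error    = error
    ; f-bound  = λ p q → f-bound (≤⇒0≤- q) (r-x≤r p)
    ; f′-bound = λ p q → ∣-∣≤ (f′-bound (≤⇒0≤- q) (r-x≤r p))
    ; approx   = λ {x} {y} p q s t → ∣∣≤-resp
        (solve 6 (λ a b c x y r → a :- b :- c :* ((r :- y) :- (r :- x)) := a :- b :- (:- c) :* (y :- x))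
          refl (f (r - y)) (f (r - x)) (f′ (r - x)) x y r)
        (solve 4 (λ e x y r → e :* (((r :- y) :- (r :- x)) :* ((r :- y) :- (r :- x))) := e :* ((y :- x) :* (y :- x)))
          refl error x y r)
        (approx (≤⇒0≤- q) (r-x≤r p) (≤⇒0≤- t) (r-x≤r s))
    }
    where
    open Differentiable D
    r-x≤r : ∀ {x} → 0# ≤ x → r - x ≤ r
    r-x≤r {x} 0≤x = ≤-by 0≤x (solve 2 (λ r x → r :- (r :- x) := x) refl r x)

  -- Over a subdivision into n + 1 steps of length h the quadratic errors add up to at most
  -- error * (b - a) * h, and (n + 1) h = b - a.
  mean-value : ∀ {r f f′ a b} → Differentiable r f f′ → 0# ≤ a → a ≤ b → b ≤ r →
               (∀ x → a ≤ x → x ≤ b → 0# ≤ f′ x) → (∀ {x y} → x ≈ y → f x ≈ f y) → f a ≤ f b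
  mean-value {r} {f} {f′} {a} {b} D 0≤a a≤b b≤r 0≤f′ f-cong =
    ≤-by (≤-respʳ (solve 2 (λ x y → con (+ 0) :- (x :- y) := y :- x) refl (f a) (f b)) (≤⇒0≤- limit)) refl
    where
    open Differentiable D

    module Subdivision (n : ℕ) where
      N = fromℕ (suc n)
      h = divide (b - a) N (fromℕ-suc#0 n)
      Nh≈b-a : N * h ≈ b - a
      Nh≈b-a = trans (*-comm _ _) (divide-cancel (b - a) (fromℕ-suc#0 n))

      0≤h : 0# ≤ h
      0≤h = 0≤* (≤⇒0≤- a≤b) (<⇒≤ (0<recip (fromℕ-suc#0 n) (fromℕ-pos n)))

      point : ℕ → ℝ
      point i = a + fromℕ i * h

      point-step : ∀ i → point (suc i) - point i ≈ h
      point-step i = solve 3 (λ a i h → (a :+ (con (+ 1) :+ i) :* h) :- (a :+ i :* h) := h) refl a (fromℕ i) h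

      a≤point : ∀ i → a ≤ point i
      a≤point i = ≤-by (0≤* (0≤fromℕ i) 0≤h) (solve 2 (λ a x → (a :+ x) :- a := x) refl a _)

      last-point : point (suc n) ≈ b
      last-point = trans (+-congˡ Nh≈b-a) (solve 2 (λ a b → a :+ (b :- a) := b) refl a b)

      point≤b : ∀ {i} → i ℕ.≤ suc n → point i ≤ b
      point≤b i≤N = ≤-respʳ last-point (+-mono-≤ ≤-refl (*-monoˡ-≤ h 0≤h (fromℕ-mono i≤N)))

      step : ∀ i → i ℕ.≤ n → f (point i) - error * (h * h) ≤ f (point (suc i))
      step i i≤n = ≤-by (0≤+ (≤⇒0≤- (proj₁ close)) (0≤* (0≤f′ (point i) (a≤point i) pᵢ≤b) 0≤h))
        (solve 4 (λ u v w e → v :- (u :- e) := ((v :- u :- w) :- (:- e)) :+ w)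
          refl (f (point i)) (f (point (suc i))) (f′ (point i) * h) (error * (h * h)))
        where
        pᵢ≤b = point≤b (ℕ.≤-trans i≤n (ℕ.n≤1+n n))
        0≤pᵢ = ≤-trans 0≤a (a≤point i)
        close : ∣ f (point (suc i)) - f (point i) - f′ (point i) * h ∣≤ error * (h * h)
        close = ∣∣≤-resp (+-congˡ (-‿cong (*-congˡ (point-step i)))) (*-congˡ (*-cong (point-step i) (point-step i)))
          (approx 0≤pᵢ (≤-trans pᵢ≤b b≤r) (≤-trans 0≤a (a≤point (suc i))) (≤-trans (point≤b (s≤s i≤n)) b≤r))

      total : ∀ i → i ℕ.≤ suc n → f a - fromℕ i * (error * (h * h)) ≤ f (point i)
      total zero    _         = ≈⇒≤ (trans (solve 2 (λ x y → x :- con (+ 0) :* y := x) refl (f a) _)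
        (f-cong (solve 2 (λ a h → a := a :+ con (+ 0) :* h) refl a h)))
      total (suc i) (s≤s i≤n) = ≤-trans (≤-respˡ
        (solve 3 (λ x k e → (x :- k :* e) :+ :- e := x :- (con (+ 1) :+ k) :* e) refl (f a) (fromℕ i) _)
        (+-mono-≤ (total i (ℕ.≤-trans i≤n (ℕ.n≤1+n n))) ≤-refl)) (step i i≤n)

      scaled : N * (f a - f b) ≤ error * ((b - a) * (b - a))
      scaled = ≤-resp refl error-eq (*-monoʳ-≤ N (0≤fromℕ (suc n)) (≤-by (≤⇒0≤- (total (suc n) ℕ.≤-refl))
        (trans
          (solve 3 (λ x y e → e :- (x :- y) := y :- (x :- e)) refl (f a) (f b) _)
          (+-congʳ (f-cong (sym last-point))))))
        where
        error-eq : N * (N * (error * (h * h))) ≈ error * ((b - a) * (b - a))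
        error-eq = trans (solve 3 (λ n e h → n :* (n :* (e :* (h :* h))) := e :* ((n :* h) :* (n :* h))) refl N error h)
          (*-congˡ (*-cong Nh≈b-a Nh≈b-a))

    limit : f a - f b ≤ 0#
    -- After multiplication by the number of steps the bound no longer depends on that number; for
    -- zero steps it only has to be nonnegative.
    limit = bounded-multiples (f a - f b) (error * ((b - a) * (b - a))) λ where
      zero    → ≤-respˡ (sym (zeroˡ _)) (∣∣≤⇒0≤ (approx 0≤a (≤-trans a≤b b≤r) (≤-trans 0≤a a≤b) b≤r))
      (suc n) → Subdivision.scaled n

-- Series with coefficients dominated by the exponential series.

module ExponentialSeries {c ℓ₁ ℓ₂ ℓ₃} (R : RealField c ℓ₁ ℓ₂ ℓ₃) where

  open Reals R hiding (zero)
  open Inequalities R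
  open SumsAndLimits R
  open StirlingTransforms R
  open EulerTransform R using (shift)
  open Differentiation R
  open ≈-Reasoning setoid

  t : ℕ → ℝ → ℝ
  t n x = x ^ n /! n

  t-suc : ∀ n x → fromℕ (suc n) * t (suc n) x ≈ x * t n x
  t-suc n x = trans (/!-suc (x ^ suc n) n) (*-assoc x (x ^ n) _)

  t-cong : ∀ n {x y} → x ≈ y → t n x ≈ t n y
  t-cong zero    x≈y = refl
  t-cong (suc n) {x} {y} x≈y = *-cancelˡ (fromℕ (suc n)) (fromℕ-suc#0 n)
    (trans (t-suc n x) (trans (*-cong x≈y (t-cong n x≈y)) (sym (t-suc n y))))

  t-0 : ∀ x → t 0 x ≈ 1#
  t-0 x = x/!0≈x 1#

  0≤t : ∀ n {r} → 0# ≤ r → 0# ≤ t n r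
  0≤t zero    0≤r = 0≤/! 0 0≤1
  0≤t (suc n) {r} 0≤r = *-cancelˡ-≤ (fromℕ (suc n)) (fromℕ-pos n)
    (≤-resp (sym (zeroʳ _)) (sym (t-suc n r)) (0≤* 0≤r (0≤t n 0≤r)))

  ∣t∣≤ : ∀ n {x r} → ∣ x ∣≤ r → ∣ t n x ∣≤ t n r
  ∣t∣≤ zero    x≤r = 0≤⇒∣∣≤ (0≤/! 0 0≤1)
  ∣t∣≤ (suc n) {x} {r} x≤r = ∣∣≤-cancel (fromℕ (suc n)) (fromℕ-pos n)
    (∣∣≤-resp (sym (t-suc n x)) (sym (t-suc n r)) (∣*∣≤ x≤r (∣t∣≤ n x≤r)))

  -- The exponential series at `r` controls every series used later: the coefficients of sine,
  -- cosine and their derivatives all lie between `-1` and `1`.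
  module Majorant {r} (0≤r : 0# ≤ r) where

    E : ℕ → ℝ
    E n = ∑< n λ k → t k r

    threshold : ℕ
    threshold = proj₁ (archimedean (fromℕ 2 * r))

    -- Beyond the threshold tₙ₊₁ ≤ tₙ/2, so this upper bound of the series is decreasing.
    V : ℕ → ℝ
    V n = E n + fromℕ 2 * t n r

    V-decreases : ∀ n → threshold ℕ.≤ n → V (suc n) ≤ V n
    V-decreases n m≤n = *-cancelˡ-≤ (fromℕ (suc n)) (fromℕ-pos n) (≤-by
      (0≤* (≤⇒0≤- 2r≤1+n) (0≤t n 0≤r))
      (begin
        k * (E n + fromℕ 2 * t n r) - k * (E (suc n) + fromℕ 2 * t (suc n) r)
          ≈⟨ +-congˡ (-‿cong (*-congˡ (+-congʳ (∑-last n _)))) ⟩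
        k * (E n + fromℕ 2 * t n r) - k * ((E n + t n r) + fromℕ 2 * t (suc n) r)
          ≈⟨ solve 4 (λ k e x y → k :* (e :+ con (+ 2) :* x) :- k :* ((e :+ x) :+ con (+ 2) :* y)
               := k :* x :- con (+ 2) :* (k :* y)) refl k (E n) (t n r) _ ⟩
        k * t n r - fromℕ 2 * (k * t (suc n) r)
          ≈⟨ +-congˡ (-‿cong (*-congˡ (t-suc n r))) ⟩
        k * t n r - fromℕ 2 * (r * t n r)
          ≈⟨ solve 3 (λ k r x → k :* x :- con (+ 2) :* (r :* x) := (k :- con (+ 2) :* r) :* x) refl k r (t n r) ⟩
        (k - fromℕ 2 * r) * t n r ∎))
      where
      k = fromℕ (suc n)
      2r≤1+n : fromℕ 2 * r ≤ fromℕ (suc n)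
      2r≤1+n = ≤-trans (<⇒≤ (proj₂ (archimedean (fromℕ 2 * r))))
        (fromℕ-mono (ℕ.≤-trans m≤n (ℕ.n≤1+n n)))

    V-antitone : ∀ {m n} → threshold ℕ.≤ m → m ℕ.≤′ n → V n ≤ V m
    V-antitone m₀≤m ℕ.≤′-refl        = ≤-refl
    V-antitone m₀≤m (ℕ.≤′-step m≤n) =
      ≤-trans (V-decreases _ (ℕ.≤-trans m₀≤m (ℕ.≤′⇒≤ m≤n))) (V-antitone m₀≤m m≤n)

    E≤V : ∀ n → E n ≤ V n
    E≤V n = ≤-by (0≤* (0≤fromℕ 2) (0≤t n 0≤r)) (solve 2 (λ e x → (e :+ x) :- e := x) refl (E n) _)

    opaque
      K : ℝ
      K = V threshold

      E≤K : ∀ n → E n ≤ K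
      E≤K n = ≤-trans (∑-mono-bound (λ k → 0≤t k 0≤r) (ℕ.m≤m⊔n n threshold))
        (≤-trans (E≤V (n ℕ.⊔ threshold)) (V-antitone ℕ.≤-refl (ℕ.≤⇒≤′ (ℕ.m≤n⊔m n threshold))))

    t≤K : ∀ n → t n r ≤ K
    t≤K n = ≤-trans (≤-by (0≤∑ n λ k → 0≤t k 0≤r)
      (trans (+-congʳ (∑-last n _)) (solve 2 (λ e x → (e :+ x) :- x := e) refl (E n) (t n r)))) (E≤K (suc n))

    tail-bound : ∀ {m n} → threshold ℕ.≤ m → m ℕ.≤ n → E n - E m ≤ fromℕ 2 * t m r
    tail-bound {m} {n} m₀≤m m≤n = ≤-by (≤⇒0≤- (≤-trans (E≤V n) (V-antitone m₀≤m (ℕ.≤⇒≤′ m≤n))))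
      (solve 3 (λ x e f → x :- (f :- e) := (e :+ x) :- f) refl (fromℕ 2 * t m r) (E m) (E n))

    -- By the recurrence, (n + 1) tₙ₊₁ ≤ r K.
    t-vanishes : ∀ ε → 0# < ε → ∃ λ N → threshold ℕ.≤ N × fromℕ 4 * t N r < ε
    t-vanishes ε 0<ε = suc M , ℕ.≤-trans (ℕ.m≤n⊔m n threshold) (ℕ.n≤1+n M) ,
      *-cancelˡ-< (fromℕ (suc M)) (fromℕ-pos M) (≤-<-trans below (<-≤-trans above
        (*-monoˡ-≤ ε (<⇒≤ 0<ε) (fromℕ-mono (ℕ.≤-trans (ℕ.m≤m⊔n n threshold) (ℕ.n≤1+n M))))))
      where
      large = archimedean (fromℕ 4 * (r * K) * recip (>⇒#0 0<ε))
      n = proj₁ large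
      M = n ℕ.⊔ threshold

      below : fromℕ (suc M) * (fromℕ 4 * t (suc M) r) ≤ fromℕ 4 * (r * K)
      below = ≤-respˡ (trans (*-congˡ (sym (t-suc M r))) (solve 2 (λ k x → con (+ 4) :* (k :* x) := k :* (con (+ 4) :* x)) refl _ _))
        (*-monoʳ-≤ (fromℕ 4) (0≤fromℕ 4) (*-monoʳ-≤ r 0≤r (t≤K M)))

      above : fromℕ 4 * (r * K) < fromℕ n * ε
      above = <-respˡ-≈ (trans (*-comm _ _) (divide-cancel _ (>⇒#0 0<ε))) (<-respʳ-≈ (*-comm ε _) (*-monoʳ-< ε 0<ε (proj₂ large)))

  Bounded : Series → Set ℓ₃
  Bounded u = ∀ k → ∣ u k ∣≤ 1#

  partial : Series → ℕ → ℝ → ℝ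
  partial u n x = ∑< n λ k → u k * t k x

  partial-cong : ∀ u n {x y} → x ≈ y → partial u n x ≈ partial u n y
  partial-cong u n x≈y = ∑-cong n λ k → *-congˡ (t-cong k x≈y)

  module _ {u : Series} (u-bounded : Bounded u) where

    module _ {x r} (x≤r : ∣ x ∣≤ r) (0≤r : 0# ≤ r) where

      open Majorant 0≤r

      term-bound : ∀ k → ∣ u k * t k x ∣≤ t k r
      term-bound k = ∣∣≤-resp refl (*-identityˡ _) (∣*∣≤ (u-bounded k) (∣t∣≤ k x≤r))

      partial-bound : ∀ n → ∣ partial u n x ∣≤ K
      partial-bound n = ∣∣≤-weaken (E≤K n) (∣∑∣≤ n term-bound)

      partial-difference : ∀ {m n} → m ℕ.≤′ n → ∣ partial u n x - partial u m x ∣≤ E n - E m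
      partial-difference {m} ℕ.≤′-refl = ∣∣≤-resp (sym (-‿inverseʳ _)) (sym (-‿inverseʳ _)) (0≤⇒∣∣≤ ≤-refl)
      partial-difference {m} {suc n} (ℕ.≤′-step m≤n) = ∣∣≤-resp
        (trans (solve 3 (λ a b d → (a :- b) :+ d := (a :+ d) :- b) refl _ _ _) (+-congʳ (sym (∑-last n _))))
        (trans (solve 3 (λ a b d → (a :- b) :+ d := (a :+ d) :- b) refl _ _ _) (+-congʳ (sym (∑-last n _))))
        (∣+∣≤ (partial-difference m≤n) (term-bound n))

      partial-cauchy : Cauchy (λ n → partial u n x)
      partial-cauchy ε 0<ε = N , λ m n N≤m N≤n → close N≤m N≤n
        where
        small = t-vanishes ε 0<ε
        N = proj₁ small
        m₀≤N = proj₁ (proj₂ small)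
        4t<ε = proj₂ (proj₂ small)

        near : ∀ {n} → N ℕ.≤ n → ∣ partial u n x - partial u N x ∣≤ fromℕ 2 * t N r
        near N≤n = ∣∣≤-weaken (tail-bound m₀≤N N≤n) (partial-difference (ℕ.≤⇒≤′ N≤n))

        -- Each partial sum is within `2 t N r` of the `N`-th one, hence the factor `4` in
        -- `t-vanishes`.
        both : ∀ {m n} → N ℕ.≤ m → N ℕ.≤ n → ∣ partial u m x - partial u n x ∣≤ fromℕ 4 * t N r
        both N≤m N≤n = ∣∣≤-resp
          (solve 3 (λ a b d → (a :- d) :+ :- (b :- d) := a :- b) refl _ _ _)
          (solve 1 (λ x → con (+ 2) :* x :+ con (+ 2) :* x := con (+ 4) :* x) refl (t N r))
          (∣+∣≤ (near N≤m) (∣-∣≤ (near N≤n)))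

        close : ∀ {m n} → N ℕ.≤ m → N ℕ.≤ n → Within ε (partial u m x) (partial u n x)
        close N≤m N≤n =
          <-≤-trans (<-by (<⇒0<- 4t<ε) (solve 2 (λ x e → :- x :- :- e := e :- x) refl _ ε)) (proj₁ (both N≤m N≤n)) ,
          ≤-<-trans (proj₂ (both N≤m N≤n)) 4t<ε

    limit : ∀ x → ∃ λ l → (λ n → partial u n x) ⟶ l
    -- `1 + x²` serves as a radius containing `x`.
    limit x = complete _ (partial-cauchy (∣∣≤1+square x) (<⇒≤ (0<1+square x)))

    opaque
      L : ℝ → ℝ
      L x = proj₁ (limit x)

      L-limit : ∀ x → (λ n → partial u n x) ⟶ L x
      L-limit x = proj₂ (limit x)

    L-cong : ∀ {x y} → x ≈ y → L x ≈ L y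
    L-cong {x} {y} x≈y = lim-unique (L-limit x) (lim-cong (λ n → sym (partial-cong u n x≈y)) (L-limit y))

  t′ : ℕ → ℝ → ℝ
  t′ zero    x = 0#
  t′ (suc n) x = t n x

  x*t′ : ∀ n x → x * t′ n x ≈ fromℕ n * t n x
  x*t′ zero    x = trans (zeroʳ x) (sym (zeroˡ _))
  x*t′ (suc n) x = sym (t-suc n x)

  t-error : ℕ → ℝ → ℝ → ℝ
  t-error n x y = t n y - t n x - t′ n x * (y - x)

  -- The recursion `(n+1) t (n+1) x = x t n x` passes to Taylor remainders, so they can be bounded
  -- by induction on the degree.
  t-error-suc : ∀ n x y → fromℕ (suc n) * t-error (suc n) x y ≈ y * t-error n x y + t′ n x * ((y - x) * (y - x))
  t-error-suc n x y = begin
    k * (t (suc n) y - t (suc n) x - t n x * (y - x))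
      ≈⟨ solve 5 (λ k a b c h → k :* (a :- b :- c :* h) := k :* a :- k :* b :- k :* (c :* h)) refl k _ _ _ _ ⟩
    k * t (suc n) y - k * t (suc n) x - k * (t n x * (y - x))
      ≈⟨ +-congʳ (+-cong (t-suc n y) (-‿cong (t-suc n x))) ⟩
    y * t n y - x * t n x - (1# + fromℕ n) * (t n x * (y - x))
      ≈⟨ solve 5 (λ n x y a b → y :* b :- x :* a :- (con (+ 1) :+ n) :* (a :* (y :- x))
           := y :* (b :- a) :- (n :* a) :* (y :- x)) refl (fromℕ n) x y (t n x) (t n y) ⟩
    y * (t n y - t n x) - (fromℕ n * t n x) * (y - x)
      ≈⟨ +-congˡ (-‿cong (*-congʳ (x*t′ n x))) ⟨
    y * (t n y - t n x) - (x * t′ n x) * (y - x)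
      ≈⟨ solve 5 (λ x y a b c → y :* (b :- a) :- (x :* c) :* (y :- x)
           := y :* (b :- a :- c :* (y :- x)) :+ c :* ((y :- x) :* (y :- x))) refl x y (t n x) (t n y) (t′ n x) ⟩
    y * t-error n x y + t′ n x * ((y - x) * (y - x)) ∎
    where
    k = fromℕ (suc n)

  t″ : ℕ → ℝ → ℝ
  t″ zero          x = 0#
  t″ (suc zero)    x = 0#
  t″ (suc (suc n)) x = t n x

  t″-suc : ∀ n {r} → 0# ≤ r → r * t″ n r + t′ n r ≤ fromℕ (suc n) * t″ (suc n) r
  t″-suc zero          {r} 0≤r = ≈⇒≤ (solve 1 (λ r → r :* con (+ 0) :+ con (+ 0) := (con (+ 1) :+ con (+ 0)) :* con (+ 0)) refl r)
  t″-suc (suc zero)    {r} 0≤r = ≤-by (0≤t 0 0≤r)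
    (solve 2 (λ r x → con (+ 2) :* x :- (r :* con (+ 0) :+ x) := x) refl r (t 0 r))
  t″-suc (suc (suc n)) {r} 0≤r = ≤-by (0≤t (suc n) 0≤r)
    (trans (+-congˡ (-‿cong (+-congʳ (sym (t-suc n r)))))
      (solve 2 (λ n x → (con (+ 1) :+ (con (+ 1) :+ (con (+ 1) :+ n))) :* x :- ((con (+ 1) :+ n) :* x :+ x) := x)
        refl (fromℕ n) (t (suc n) r)))

  ∣t′∣≤ : ∀ n {x r} → ∣ x ∣≤ r → ∣ t′ n x ∣≤ t′ n r
  ∣t′∣≤ zero    x≤r = 0≤⇒∣∣≤ ≤-refl
  ∣t′∣≤ (suc n) x≤r = ∣t∣≤ n x≤r

  -- The bounds `t″ n r` were chosen to satisfy the recursion of the remainders, and they are again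
  -- terms of the exponential series at `r`.
  t-error-bound : ∀ n {x y r} → 0# ≤ r → ∣ x ∣≤ r → ∣ y ∣≤ r → ∣ t-error n x y ∣≤ t″ n r * ((y - x) * (y - x))
  t-error-bound zero    {x} {y} 0≤r x≤r y≤r = ∣∣≤-resp
    (solve 3 (λ a x y → con (+ 0) := a :- a :- con (+ 0) :* (y :- x)) refl (t 0 x) x y) (sym (zeroˡ _)) (0≤⇒∣∣≤ ≤-refl)
  t-error-bound (suc n) {x} {y} {r} 0≤r x≤r y≤r = ∣∣≤-cancel (fromℕ (suc n)) (fromℕ-pos n)
    (∣∣≤-resp (sym (t-error-suc n x y)) refl (∣∣≤-weaken
      (≤-resp (solve 4 (λ r a b h → (r :* a :+ b) :* h := r :* (a :* h) :+ b :* h) refl r _ _ _) (*-assoc _ _ _)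
        (*-monoˡ-≤ ((y - x) * (y - x)) (0≤square (y - x)) (t″-suc n 0≤r)))
      (∣+∣≤ (∣*∣≤ y≤r (t-error-bound n 0≤r x≤r y≤r)) (∣*∣≤ (∣t′∣≤ n x≤r) (0≤⇒∣∣≤ (0≤square (y - x)))))))

  partial-t′ : ∀ u n x → ∑< (suc n) (λ k → u k * t′ k x) ≈ partial (shift u) n x
  partial-t′ u n x = trans (∑-first n _) (trans (+-congʳ (zeroʳ (u 0))) (+-identityˡ _))

  -- The remainders of the terms add up to at most `K h²` for every partial sum. This bound is
  -- inherited by the limit, so no two limits are interchanged.
  L-differentiable : ∀ {u r} (u-bounded : Bounded u) (u′-bounded : Bounded (shift u)) → 0# ≤ r →
                     Differentiable r (L u-bounded) (L u′-bounded)
  L-differentiable {u} {r} u-bounded u′-bounded 0≤r = record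
    { bound    = K
    ; bound′   = K
    ; error    = K
    ; f-bound  = λ 0≤x x≤r → L-bound u-bounded (within 0≤x x≤r)
    ; f′-bound = λ 0≤x x≤r → L-bound u′-bounded (within 0≤x x≤r)
    ; approx   = λ 0≤x x≤r 0≤y y≤r → approx (within 0≤x x≤r) (within 0≤y y≤r)
    }
    where
    open Majorant 0≤r

    within : ∀ {x} → 0# ≤ x → x ≤ r → ∣ x ∣≤ r
    within 0≤x x≤r = ∣∣≤-weaken x≤r (0≤⇒∣∣≤ 0≤x)

    L-bound : ∀ {v} (v-bounded : Bounded v) {x} → ∣ x ∣≤ r → ∣ L v-bounded x ∣≤ K
    L-bound {v} v-bounded {x} x≤r = lim-∣∣≤ {u = λ n → partial v n x} {b = K} (L-limit v-bounded x) 0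
      λ n _ → partial-bound v-bounded x≤r 0≤r n

    ∑t″≤K : ∀ n → ∑< (suc n) (λ k → t″ k r) ≤ K
    ∑t″≤K zero    = ≤-respˡ (sym (trans (∑-first 0 _) (trans (+-identityˡ _) (∑-empty _)))) (≤-trans (0≤t 0 0≤r) (t≤K 0))
    ∑t″≤K (suc n) = ≤-respˡ
      (sym (trans (∑-first (suc n) _) (trans (+-identityˡ _) (trans (∑-first n _) (+-identityˡ _))))) (E≤K n)

    module _ {x y} (x≤r : ∣ x ∣≤ r) (y≤r : ∣ y ∣≤ r) where

      h = y - x

      difference : ℕ → ℝ
      -- Differentiation removes the constant term, so `n + 1` terms of `u` face `n` terms of
      -- `shift u`.
      difference n = (partial u (suc n) y + - 1# * partial u (suc n) x) + - h * partial (shift u) n x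

      difference-limit : difference ⟶ (L u-bounded y + - 1# * L u-bounded x) + - h * L u′-bounded x
      difference-limit = lim-+* (- h) (lim-+* (- 1#) (tail y) (tail x)) (L-limit u′-bounded x)
        where
        tail : ∀ z → (λ n → partial u (suc n) z) ⟶ L u-bounded z
        tail z = lim-subsequence suc ℕ.n≤1+n (L-limit u-bounded z)

      collect : ∀ n → ∑< (suc n) (λ k → u k * t-error k x y) ≈ difference n
      collect n = begin
        ∑< (suc n) (λ k → u k * t-error k x y)
          ≈⟨ ∑-cong (suc n) (λ k → solve 5 (λ u a b d h → u :* (a :- b :- d :* h)
               := (u :* a :+ :- con (+ 1) :* (u :* b)) :+ :- h :* (u :* d)) refl (u k) (t k y) (t k x) (t′ k x) h) ⟩
        ∑< (suc n) (λ k → (u k * t k y + - 1# * (u k * t k x)) + - h * (u k * t′ k x))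
          ≈⟨ trans (∑-+* (suc n) (- h) _ _) (+-congʳ (∑-+* (suc n) (- 1#) _ _)) ⟩
        (partial u (suc n) y + - 1# * partial u (suc n) x) + - h * ∑< (suc n) (λ k → u k * t′ k x)
          ≈⟨ +-congˡ (*-congˡ (partial-t′ u n x)) ⟩
        difference n ∎

      term-error : ∀ k → ∣ u k * t-error k x y ∣≤ (h * h) * t″ k r
      term-error k = ∣∣≤-resp refl (trans (*-identityˡ _) (*-comm (t″ k r) (h * h)))
        (∣*∣≤ (u-bounded k) (t-error-bound k 0≤r x≤r y≤r))

      difference-bound : ∀ n → ∣ difference n ∣≤ K * (h * h)
      difference-bound n = ∣∣≤-resp (collect n) refl (∣∣≤-weaken
        (≤-resp (sym (∑-*ˡ (suc n) (h * h) (λ k → t″ k r))) (*-comm (h * h) K)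
          (*-monoʳ-≤ (h * h) (0≤square h) (∑t″≤K n)))
        (∣∑∣≤ (suc n) term-error))

      limit-bound : ∣ (L u-bounded y + - 1# * L u-bounded x) + - h * L u′-bounded x ∣≤ K * (h * h)
      limit-bound = lim-∣∣≤ {u = difference} {b = K * (h * h)} difference-limit 0 λ n _ → difference-bound n

      approx : ∣ L u-bounded y - L u-bounded x - L u′-bounded x * h ∣≤ K * (h * h)
      approx = ∣∣≤-resp {a = K * (h * h)} (rearrange (L u-bounded y) (L u-bounded x) (L u′-bounded x) h) refl limit-bound
        where
        rearrange : ∀ a b d h → (a + - 1# * b) + - h * d ≈ a - b - d * h
        rearrange = solve 4 (λ a b d h → (a :+ :- con (+ 1) :* b) :+ :- h :* d := a :- b :- d :* h) refl

-- Sine and cosine on the nonnegative half-line.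

module Trigonometry {c ℓ₁ ℓ₂ ℓ₃} (R : RealField c ℓ₁ ℓ₂ ℓ₃) where

  open Reals R hiding (zero)
  open Inequalities R
  open SumsAndLimits R
  open EulerTransform R using (shift)
  open Differentiation R
  open ExponentialSeries R
  open ≈-Reasoning setoid

  -- The sequence 0, 1, 0, -1, ... of derivatives at zero. Differentiation is a shift, so one shift
  -- gives the cosine and two give minus the sine.
  sinCoefficient : Series
  sinCoefficient 0             = 0#
  sinCoefficient 1             = 1#
  sinCoefficient (suc (suc n)) = - sinCoefficient n

  sin-bounded : Bounded sinCoefficient
  sin-bounded 0             = ∣∣≤-weaken 0≤1 (0≤⇒∣∣≤ ≤-refl)
  sin-bounded 1             = 0≤⇒∣∣≤ 0≤1
  sin-bounded (suc (suc n)) = ∣-∣≤ (sin-bounded n)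

  cos-bounded : Bounded (shift sinCoefficient)
  cos-bounded n = sin-bounded (suc n)

  Sin Cos : ℝ → ℝ
  Sin = L sin-bounded
  Cos = L cos-bounded

  Sin-cong : ∀ {x y} → x ≈ y → Sin x ≈ Sin y
  Sin-cong = L-cong sin-bounded

  Cos-cong : ∀ {x y} → x ≈ y → Cos x ≈ Cos y
  Cos-cong = L-cong cos-bounded

  Sin-differentiable : ∀ {r} → 0# ≤ r → Differentiable r Sin Cos
  Sin-differentiable = L-differentiable sin-bounded cos-bounded

  Cos-differentiable : ∀ {r} → 0# ≤ r → Differentiable r Cos (λ x → - Sin x)
  Cos-differentiable 0≤r = differentiable-resp (λ x _ → L≈-Sin x) (L-differentiable cos-bounded (λ n → sin-bounded (suc (suc n))) 0≤r)
    where
    L≈-Sin : ∀ x → L {shift (shift sinCoefficient)} (λ n → sin-bounded (suc (suc n))) x ≈ - Sin x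
    L≈-Sin x = lim-unique (L-limit (λ n → sin-bounded (suc (suc n))) x) (lim-cong negate (lim-neg (L-limit sin-bounded x)))
      where
      negate : ∀ n → - partial sinCoefficient n x ≈ partial (shift (shift sinCoefficient)) n x
      negate n = begin
        - partial sinCoefficient n x
          ≈⟨ solve 1 (λ y → :- y := :- con (+ 1) :* y) refl _ ⟩
        - 1# * partial sinCoefficient n x
          ≈⟨ ∑-*ˡ n (- 1#) (λ k → sinCoefficient k * t k x) ⟨
        ∑< n (λ k → - 1# * (sinCoefficient k * t k x))
          ≈⟨ ∑-cong n (λ k → solve 2 (λ s y → :- con (+ 1) :* (s :* y) := :- s :* y) refl (sinCoefficient k) (t k x)) ⟩
        partial (shift (shift sinCoefficient)) n x ∎

  -- Unlike `2 ℕ.* n`, this reduces to two successors, which the recursion of `sinCoefficient`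
  -- needs.
  double : ℕ → ℕ
  double zero    = zero
  double (suc n) = suc (suc (double n))

  double≡2* : ∀ n → double n ≡ 2 ℕ.* n
  double≡2* zero    = ≡.refl
  double≡2* (suc n) = ≡.trans (≡.cong (suc ∘ suc) (double≡2* n)) (≡.cong suc (≡.sym (ℕ.+-suc n (n ℕ.+ 0))))

  n≤double : ∀ n → n ℕ.≤ double n
  n≤double zero    = z≤n
  n≤double (suc n) = s≤s (ℕ.≤-trans (n≤double n) (ℕ.n≤1+n _))

  sinCoefficient-even : ∀ n → sinCoefficient (double n) ≈ 0#
  sinCoefficient-even zero    = refl
  sinCoefficient-even (suc n) = trans (-‿cong (sinCoefficient-even n)) (solve 0 (:- con (+ 0) := con (+ 0)) refl)

  sinCoefficient-odd : ∀ n → sinCoefficient (suc (double n)) ≈ -1^ n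
  sinCoefficient-odd zero    = refl
  sinCoefficient-odd (suc n) = trans (-‿cong (sinCoefficient-odd n)) (solve 1 (λ s → :- s := :- con (+ 1) :* s) refl (-1^ n))

  partial-sin : ∀ n x → partial sinCoefficient (double n) x ≈ ∑< n (λ k → -1^ k * (x ^ suc (2 ℕ.* k) /! suc (2 ℕ.* k)))
  partial-sin zero    x = trans (∑-empty _) (sym (∑-empty _))
  partial-sin (suc n) x = begin
    partial sinCoefficient (suc (suc m)) x
      ≈⟨ trans (∑-last (suc m) _) (+-congʳ (∑-last m _)) ⟩
    partial sinCoefficient m x + sinCoefficient m * t m x + sinCoefficient (suc m) * t (suc m) x
      ≈⟨ +-cong (+-cong (partial-sin n x) (trans (*-congʳ (sinCoefficient-even n)) (zeroˡ _))) (*-cong (sinCoefficient-odd n) index) ⟩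
    ∑< n (λ k → -1^ k * (x ^ suc (2 ℕ.* k) /! suc (2 ℕ.* k))) + 0# + -1^ n * (x ^ suc (2 ℕ.* n) /! suc (2 ℕ.* n))
      ≈⟨ trans (+-congʳ (+-identityʳ _)) (sym (∑-last n _)) ⟩
    ∑< (suc n) (λ k → -1^ k * (x ^ suc (2 ℕ.* k) /! suc (2 ℕ.* k))) ∎
    where
    m = double n
    index : t (suc m) x ≈ x ^ suc (2 ℕ.* n) /! suc (2 ℕ.* n)
    index = reflexive (≡.cong (λ i → t (suc i) x) (double≡2* n))

  IsSine⇒Sin : ∀ {sin} → IsSine sin → ∀ x → sin x ≈ Sin x
  IsSine⇒Sin isSine x = lim-unique (isSine x) (lim-cong
    (λ n → trans (partial-sin (suc n) x) (sym (∑-unfold (suc n) (λ k → -1^ k * (x ^ suc (2 ℕ.* k) /! suc (2 ℕ.* k))))))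
    -- `∑₀ n` has `n + 1` summands, so it corresponds to `double (suc n)` terms of the full series.
    (lim-subsequence (λ n → double (suc n)) (λ n → ℕ.≤-trans (ℕ.n≤1+n n) (n≤double (suc n))) (L-limit sin-bounded x)))

  L-0 : ∀ {u} (u-bounded : Bounded u) → L u-bounded 0# ≈ u 0
  L-0 {u} u-bounded = lim-unique (lim-subsequence suc ℕ.n≤1+n (L-limit u-bounded 0#)) (lim-cong first (lim-const (u 0)))
    where
    t-suc-0 : ∀ k → t (suc k) 0# ≈ 0#
    t-suc-0 k = *-cancelˡ (fromℕ (suc k)) (fromℕ-suc#0 k) (trans (t-suc k 0#) (trans (zeroˡ _) (sym (zeroʳ _))))

    first : ∀ n → u 0 ≈ partial u (suc n) 0#
    first n = sym (trans (∑-first n _) (trans (+-cong (trans (*-congˡ (t-0 0#)) (*-identityʳ _))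
      (∑-zero n λ k → trans (*-congˡ (t-suc-0 k)) (zeroʳ _))) (+-identityʳ _)))

  Sin-0 : Sin 0# ≈ 0#
  Sin-0 = L-0 sin-bounded

  Cos-0 : Cos 0# ≈ 1#
  Cos-0 = L-0 cos-bounded

  -- `mean-value` applied to `f` and to `-f`.
  zero-derivative : ∀ {r f f′} → Differentiable r f f′ → 0# ≤ r → (∀ x → f′ x ≈ 0#) →
                    (∀ {x y} → x ≈ y → f x ≈ f y) → f 0# ≈ f r
  zero-derivative {r} {f} {f′} D 0≤r f′≈0 f-cong = ≮⇒≈
    (mean-value D ≤-refl 0≤r ≤-refl (λ x _ _ → ≈⇒≤ (sym (f′≈0 x))) f-cong)
    (≤-resp (negate (f r)) (negate (f 0#)) (neg-mono-≤ (mean-value (scale-differentiable (- 1#) D) ≤-refl 0≤r ≤-refl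
      (λ x _ _ → ≈⇒≤ (sym (trans (*-congˡ (f′≈0 x)) (zeroʳ _)))) (*-congˡ ∘ f-cong))))
    where
    negate : ∀ x → - (- 1# * x) ≈ x
    negate = solve 1 (λ x → :- (:- con (+ 1) :* x) := x) refl

  -- The left side has derivative zero and value `1` at zero. The restriction to nonnegative
  -- arguments comes from the domain `[0, r]` of `Differentiable`.
  pythagoras : ∀ {x} → 0# ≤ x → Sin x * Sin x + Cos x * Cos x ≈ 1#
  pythagoras {x} 0≤x = begin
    Sin x * Sin x + Cos x * Cos x
      ≈⟨ zero-derivative (+-differentiable (*-differentiable sinD sinD) (*-differentiable cosD cosD)) 0≤x
           (λ y → solve 2 (λ s c → (c :* s :+ s :* c) :+ (:- s :* c :+ c :* :- s) := con (+ 0)) refl (Sin y) (Cos y))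
           (λ e → +-cong (*-cong (Sin-cong e) (Sin-cong e)) (*-cong (Cos-cong e) (Cos-cong e))) ⟨
    Sin 0# * Sin 0# + Cos 0# * Cos 0#
      ≈⟨ +-cong (*-cong Sin-0 Sin-0) (*-cong Cos-0 Cos-0) ⟩
    0# * 0# + 1# * 1#
      ≈⟨ solve 0 (con (+ 0) :* con (+ 0) :+ con (+ 1) :* con (+ 1) := con (+ 1)) refl ⟩
    1# ∎
    where
    sinD = Sin-differentiable 0≤x
    cosD = Cos-differentiable 0≤x

  module _ {a b} (0≤a : 0# ≤ a) (0≤b : 0# ≤ b) where

    private
      r = a + b
      0≤r : 0# ≤ r
      0≤r = 0≤+ 0≤a 0≤b
      r-0≈r : r - 0# ≈ r
      r-0≈r = solve 1 (λ r → r :- con (+ 0) := r) refl r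
      r-b≈a : r - b ≈ a
      r-b≈a = solve 2 (λ a b → (a :+ b) :- b := a) refl a b
      b≤r : b ≤ r
      b≤r = ≤-by 0≤a r-b≈a

      sinD  = Sin-differentiable 0≤r
      cosD  = Cos-differentiable 0≤r
      sinD⁻ = reflect-differentiable sinD
      cosD⁻ = reflect-differentiable cosD

    -- x ↦ sin (r - x) cos x + cos (r - x) sin x is constant.
    Sin-+ : Sin (a + b) ≈ Sin a * Cos b + Cos a * Sin b
    Sin-+ = begin
      Sin r
        ≈⟨ solve 2 (λ s c → s := s :* con (+ 1) :+ c :* con (+ 0)) refl (Sin r) (Cos r) ⟩
      Sin r * 1# + Cos r * 0#
        ≈⟨ +-cong (*-cong (Sin-cong r-0≈r) Cos-0) (*-cong (Cos-cong r-0≈r) Sin-0) ⟨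
      f 0#
        ≈⟨ constant ⟩
      f b
        ≈⟨ +-cong (*-congʳ (Sin-cong r-b≈a)) (*-congʳ (Cos-cong r-b≈a)) ⟩
      Sin a * Cos b + Cos a * Sin b ∎
      where
      f : ℝ → ℝ
      f x = Sin (r - x) * Cos x + Cos (r - x) * Sin x
      f-cong : ∀ {x y} → x ≈ y → f x ≈ f y
      f-cong e = +-cong (*-cong (Sin-cong (+-congˡ (-‿cong e))) (Cos-cong e)) (*-cong (Cos-cong (+-congˡ (-‿cong e))) (Sin-cong e))
      D : Differentiable r f _
      D = +-differentiable (*-differentiable sinD⁻ cosD) (*-differentiable cosD⁻ sinD)
      constant : f 0# ≈ f b
      constant = zero-derivative (restrict b≤r D) 0≤b
        (λ x → solve 4 (λ s c s′ c′ → (:- c′ :* c :+ s′ :* :- s) :+ (:- (:- s′) :* s :+ c′ :* c) := con (+ 0))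
          refl (Sin x) (Cos x) (Sin (r - x)) (Cos (r - x))) f-cong

    Cos-+ : Cos (a + b) ≈ Cos a * Cos b - Sin a * Sin b
    Cos-+ = begin
      Cos r
        ≈⟨ solve 2 (λ s c → c := c :* con (+ 1) :+ :- con (+ 1) :* (s :* con (+ 0))) refl (Sin r) (Cos r) ⟩
      Cos r * 1# + - 1# * (Sin r * 0#)
        ≈⟨ +-cong (*-cong (Cos-cong r-0≈r) Cos-0) (*-congˡ (*-cong (Sin-cong r-0≈r) Sin-0)) ⟨
      f 0#
        ≈⟨ constant ⟩
      f b
        ≈⟨ +-cong (*-congʳ (Cos-cong r-b≈a)) (*-congˡ (*-congʳ (Sin-cong r-b≈a))) ⟩
      Cos a * Cos b + - 1# * (Sin a * Sin b)
        ≈⟨ solve 2 (λ x y → x :+ :- con (+ 1) :* y := x :- y) refl _ _ ⟩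
      Cos a * Cos b - Sin a * Sin b ∎
      where
      f : ℝ → ℝ
      f x = Cos (r - x) * Cos x + - 1# * (Sin (r - x) * Sin x)
      f-cong : ∀ {x y} → x ≈ y → f x ≈ f y
      f-cong e = +-cong (*-cong (Cos-cong (+-congˡ (-‿cong e))) (Cos-cong e))
        (*-congˡ (*-cong (Sin-cong (+-congˡ (-‿cong e))) (Sin-cong e)))
      D : Differentiable r f _
      D = +-differentiable (*-differentiable cosD⁻ cosD) (scale-differentiable (- 1#) (*-differentiable sinD⁻ sinD))
      constant : f 0# ≈ f b
      constant = zero-derivative (restrict b≤r D) 0≤b
        (λ x → solve 4 (λ s c s′ c′ → (:- (:- s′) :* c :+ c′ :* :- s) :+ :- con (+ 1) :* (:- c′ :* s :+ s′ :* c) := con (+ 0))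
          refl (Sin x) (Cos x) (Sin (r - x)) (Cos (r - x))) f-cong

  square≤1⇒≤1 : ∀ {x} → x * x ≤ 1# → x ≤ 1#
  square≤1⇒≤1 {x} xx≤1 1<x = xx≤1 (<-trans 1<x (<-respˡ-≈ (*-identityʳ x) (*-monoʳ-< x (<-trans 0<1 1<x) 1<x)))

  Sin≤1 : ∀ {x} → 0# ≤ x → Sin x ≤ 1#
  Sin≤1 {x} 0≤x = square≤1⇒≤1 (≤-by (0≤square (Cos x))
    (trans (+-congʳ (sym (pythagoras 0≤x))) (solve 2 (λ s c → (s :+ c) :- s := c) refl _ _)))

  -1≤Sin : ∀ {x} → 0# ≤ x → 0# ≤ 1# + Sin x
  -1≤Sin {x} 0≤x = ≤-respʳ (solve 1 (λ s → con (+ 1) :- :- s := con (+ 1) :+ s) refl (Sin x)) (≤⇒0≤-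
    (square≤1⇒≤1 (≤-by (0≤square (Cos x)) (trans (+-congʳ (sym (pythagoras 0≤x)))
      (solve 2 (λ s c → (s :* s :+ c) :- (:- s) :* (:- s) := c) refl (Sin x) _)))))

  Cos≤1 : ∀ {x} → 0# ≤ x → Cos x ≤ 1#
  Cos≤1 {x} 0≤x = square≤1⇒≤1 (≤-by (0≤square (Sin x))
    (trans (+-congʳ (sym (pythagoras 0≤x))) (solve 2 (λ s c → (s :+ c) :- c := s) refl _ _)))

-- Construction of `π/2` as a zero of the cosine.

module HalfPi {c ℓ₁ ℓ₂ ℓ₃} (R : RealField c ℓ₁ ℓ₂ ℓ₃) where

  open Reals R hiding (zero)
  open Inequalities R
  open SumsAndLimits R
  open Differentiation R
  open Trigonometry R
  open ≈-Reasoning setoid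

  Sin≤id : ∀ {x} → 0# ≤ x → Sin x ≤ x
  Sin≤id {x} 0≤x = ≤-by (≤-respˡ f0≈0 f0≤fx) (solve 2 (λ x s → x :- s := x :+ :- con (+ 1) :* s) refl x (Sin x))
    where
    f0≈0 : 0# + - 1# * Sin 0# ≈ 0#
    f0≈0 = trans (+-congˡ (*-congˡ Sin-0)) (solve 0 (con (+ 0) :+ :- con (+ 1) :* con (+ 0) := con (+ 0)) refl)
    f0≤fx : 0# + - 1# * Sin 0# ≤ x + - 1# * Sin x
    f0≤fx = mean-value (+-differentiable id-differentiable (scale-differentiable (- 1#) (Sin-differentiable 0≤x)))
      ≤-refl 0≤x ≤-refl
      (λ y 0≤y _ → ≤-respʳ (solve 1 (λ c → con (+ 1) :- c := con (+ 1) :+ :- con (+ 1) :* c) refl (Cos y)) (≤⇒0≤- (Cos≤1 0≤y)))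
      (λ e → +-cong e (*-congˡ (Sin-cong e)))

  -- `2 cos x + x²` has derivative `2 (x - sin x) ≥ 0` and starts at `2`, so `2 cos x ≥ 2 - x² ≥ 1`.
  1≤2Cos : ∀ {x} → 0# ≤ x → x ≤ 1# → 1# ≤ fromℕ 2 * Cos x
  1≤2Cos {x} 0≤x x≤1 = ≤-by (0≤+ (≤⇒0≤- (≤-respˡ f0≈2 f0≤fx)) (≤⇒0≤- xx≤1))
    (solve 2 (λ x y → x :- con (+ 1) := (x :+ y) :- con (+ 2) :+ (con (+ 1) :- y)) refl _ (x * x))
    where
    xx≤1 : x * x ≤ 1#
    xx≤1 = ≤-respʳ (*-identityʳ 1#) (*-mono-≤ 0≤x 0≤1 x≤1 x≤1)
    f0≈2 : fromℕ 2 * Cos 0# + 0# * 0# ≈ fromℕ 2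
    f0≈2 = trans (+-congʳ (*-congˡ Cos-0)) (solve 0 (con (+ 2) :* con (+ 1) :+ con (+ 0) :* con (+ 0) := con (+ 2)) refl)
    f0≤fx : fromℕ 2 * Cos 0# + 0# * 0# ≤ fromℕ 2 * Cos x + x * x
    f0≤fx = mean-value (+-differentiable (scale-differentiable (fromℕ 2) (Cos-differentiable 0≤x))
        (*-differentiable id-differentiable id-differentiable)) ≤-refl 0≤x ≤-refl
      (λ y 0≤y _ → ≤-respʳ
        (solve 2 (λ s y → con (+ 2) :* (y :- s) := con (+ 2) :* (:- s) :+ (con (+ 1) :* y :+ y :* con (+ 1))) refl (Sin y) y)
        (0≤* (0≤fromℕ 2) (≤⇒0≤- (Sin≤id 0≤y))))
      (λ e → +-cong (*-congˡ (Cos-cong e)) (*-cong e e))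

  -- `2 sin x - x` has derivative `2 cos x - 1`, nonnegative by the previous bound.
  id≤2Sin : ∀ {x} → 0# ≤ x → x ≤ 1# → x ≤ fromℕ 2 * Sin x
  id≤2Sin {x} 0≤x x≤1 = ≤-by (≤-respˡ f0≈0 f0≤fx) (solve 2 (λ x s → s :- x := s :+ :- con (+ 1) :* x) refl x _)
    where
    f0≈0 : fromℕ 2 * Sin 0# + - 1# * 0# ≈ 0#
    f0≈0 = trans (+-congʳ (*-congˡ Sin-0)) (solve 0 (con (+ 2) :* con (+ 0) :+ :- con (+ 1) :* con (+ 0) := con (+ 0)) refl)
    f0≤fx : fromℕ 2 * Sin 0# + - 1# * 0# ≤ fromℕ 2 * Sin x + - 1# * x
    f0≤fx = mean-value (+-differentiable (scale-differentiable (fromℕ 2) (Sin-differentiable 0≤x))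
        (scale-differentiable (- 1#) id-differentiable)) ≤-refl 0≤x ≤-refl
      (λ y 0≤y y≤x → ≤-respʳ (solve 1 (λ c → c :- con (+ 1) := c :+ :- con (+ 1) :* con (+ 1)) refl _)
        (≤⇒0≤- (1≤2Cos 0≤y (≤-trans y≤x x≤1))))
      (λ e → +-cong (*-congˡ (Sin-cong e)) (*-congˡ e))

  id+Cos-mono : ∀ {x y} → 0# ≤ x → x ≤ y → x + Cos x ≤ y + Cos y
  id+Cos-mono 0≤x x≤y = mean-value (+-differentiable id-differentiable (Cos-differentiable (≤-trans 0≤x x≤y)))
    0≤x x≤y ≤-refl (λ z x≤z _ → ≤⇒0≤- (Sin≤1 (≤-trans 0≤x x≤z))) (λ e → +-cong e (Cos-cong e))

  id-Cos-mono : ∀ {x y} → 0# ≤ x → x ≤ y → x + - 1# * Cos x ≤ y + - 1# * Cos y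
  id-Cos-mono 0≤x x≤y = mean-value
    (+-differentiable id-differentiable (scale-differentiable (- 1#) (Cos-differentiable (≤-trans 0≤x x≤y))))
    0≤x x≤y ≤-refl
    (λ z x≤z _ → ≤-respʳ (solve 1 (λ s → con (+ 1) :+ s := con (+ 1) :+ :- con (+ 1) :* :- s) refl (Sin z)) (-1≤Sin (≤-trans 0≤x x≤z)))
    (λ e → +-cong e (*-congˡ (Cos-cong e)))

  Sin-mono : ∀ {x y} → 0# ≤ x → x ≤ y → (∀ z → 0# ≤ z → z ≤ y → 0# ≤ Cos z) → Sin x ≤ Sin y
  Sin-mono 0≤x x≤y 0≤Cos = mean-value (Sin-differentiable (≤-trans 0≤x x≤y)) 0≤x x≤y ≤-refl
    (λ z x≤z z≤y → 0≤Cos z (≤-trans 0≤x x≤z) z≤y) Sin-cong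

  1≤2Sin : ∀ {x} → 1# ≤ x → (∀ z → 0# ≤ z → z ≤ x → 0# ≤ Cos z) → 1# ≤ fromℕ 2 * Sin x
  1≤2Sin 1≤x 0≤Cos = ≤-trans (id≤2Sin 0≤1 ≤-refl) (*-monoʳ-≤ (fromℕ 2) (0≤fromℕ 2) (Sin-mono 0≤1 1≤x 0≤Cos))

  -- The zero of the cosine is the limit of this increasing sequence: |cos′| ≤ 1
  -- keeps cos ≥ 0 on [0, X n], and sin ≥ 1/2 beyond 1 halves cos at each step.
  X : ℕ → ℝ
  X zero    = 1#
  X (suc n) = X n + Cos (X n)

  -- The sign is recorded on the whole interval because monotonicity of the sine up to `x` depends
  -- on it.
  record Below (x : ℝ) : Set (c ⊔ ℓ₃) where
    field
      1≤    : 1# ≤ x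
      0≤Cos : ∀ z → 0# ≤ z → z ≤ x → 0# ≤ Cos z

    0≤ : 0# ≤ x
    0≤ = ≤-trans 0≤1 1≤

  open Below

  0≤2*⇒0≤ : ∀ {x} → 0# ≤ fromℕ 2 * x → 0# ≤ x
  0≤2*⇒0≤ p = *-cancelˡ-≤ (fromℕ 2) (fromℕ-pos 1) (≤-respˡ (sym (zeroʳ _)) p)

  X-below : ∀ n → Below (X n)
  X-below zero    = record
    { 1≤    = ≤-refl
    ; 0≤Cos = λ z 0≤z z≤1 → 0≤2*⇒0≤ (≤-trans 0≤1 (1≤2Cos 0≤z z≤1))
    }
  X-below (suc n) = record
    { 1≤    = ≤-respˡ (+-identityʳ 1#) (+-mono-≤ (1≤ IH) (0≤Cos IH (X n) (0≤ IH) ≤-refl))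
    ; 0≤Cos = λ z 0≤z z≤X → ≤-cases z (X n) (0≤Cos IH z 0≤z)
        -- For `z` between `X n` and `X (n+1)`: `z + cos z ≥ X n + cos (X n) = X (n+1) ≥ z`.
        (λ X≤z → ≤-by (0≤+ (≤⇒0≤- (id+Cos-mono (0≤ IH) X≤z)) (≤⇒0≤- z≤X))
          (solve 3 (λ c z x → c :- con (+ 0) := (z :+ c) :- x :+ (x :- z)) refl (Cos z) z (X (suc n))))
    }
    where
    IH = X-below n

  0≤X : ∀ n → 0# ≤ X n
  0≤X n = 0≤ (X-below n)

  0≤Cos-X : ∀ n → 0# ≤ Cos (X n)
  0≤Cos-X n = 0≤Cos (X-below n) (X n) (0≤X n) ≤-refl

  X-increases : ∀ n → X n ≤ X (suc n)
  X-increases n = ≤-by (0≤Cos-X n) (solve 2 (λ x c → (x :+ c) :- x := c) refl (X n) (Cos (X n)))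

  -- An upper companion of `X`: beyond `1` the function `x + 2 cos x` has derivative
  -- `1 - 2 sin x ≤ 0` as long as the cosine is nonnegative. The zero is thus enclosed in
  -- `[X n, Y n]`, of width `2 cos (X n)`.
  Y : ℕ → ℝ
  Y n = X n + fromℕ 2 * Cos (X n)

  Y-decreases : ∀ n → Y (suc n) ≤ Y n
  Y-decreases n = ≤-by (≤⇒0≤- f-mono)
    (solve 4 (λ x y c d → (x :+ con (+ 2) :* c) :- (y :+ con (+ 2) :* d)
      := (:- con (+ 1) :* y :+ :- con (+ 2) :* d) :- (:- con (+ 1) :* x :+ :- con (+ 2) :* c))
      refl (X n) (X (suc n)) (Cos (X n)) (Cos (X (suc n))))
    where
    f-mono : - 1# * X n + - fromℕ 2 * Cos (X n) ≤ - 1# * X (suc n) + - fromℕ 2 * Cos (X (suc n))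
    f-mono = mean-value (+-differentiable (scale-differentiable (- 1#) id-differentiable)
        (scale-differentiable (- fromℕ 2) (Cos-differentiable (0≤X (suc n))))) (0≤X n) (X-increases n) ≤-refl
      (λ z X≤z z≤X → ≤-respʳ
        (solve 1 (λ s → con (+ 2) :* s :- con (+ 1) := :- con (+ 1) :* con (+ 1) :+ :- con (+ 2) :* :- s) refl (Sin z))
        (≤⇒0≤- (1≤2Sin (≤-trans (1≤ (X-below n)) X≤z)
          (λ w 0≤w w≤z → 0≤Cos (X-below (suc n)) w 0≤w (≤-trans w≤z z≤X)))))
      (λ e → +-cong (*-congˡ e) (*-congˡ (Cos-cong e)))

  X-mono : ∀ {m n} → m ℕ.≤′ n → X m ≤ X n
  X-mono ℕ.≤′-refl       = ≤-refl
  X-mono {n = suc n} (ℕ.≤′-step m≤n) = ≤-trans (X-mono m≤n) (X-increases n)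

  Y-antitone : ∀ {m n} → m ℕ.≤′ n → Y n ≤ Y m
  Y-antitone ℕ.≤′-refl       = ≤-refl
  Y-antitone {n = suc n} (ℕ.≤′-step m≤n) = ≤-trans (Y-decreases n) (Y-antitone m≤n)

  X≤Y : ∀ n → X n ≤ Y n
  X≤Y n = ≤-by (0≤* (0≤fromℕ 2) (0≤Cos-X n)) (solve 2 (λ x c → (x :+ c) :- x := c) refl (X n) _)

  -- `Y-decreases` unfolds to `2 cos (X (n+1)) ≤ cos (X n)`, and `cos (X n)` is nonnegative.
  Cos-X-decreases : ∀ n → Cos (X (suc n)) ≤ Cos (X n)
  Cos-X-decreases n = *-cancelˡ-≤ (fromℕ 2) (fromℕ-pos 1) (≤-by (0≤+ (≤⇒0≤- (Y-decreases n)) (0≤Cos-X n))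
    (solve 3 (λ x c d → con (+ 2) :* c :- con (+ 2) :* d := ((x :+ con (+ 2) :* c) :- ((x :+ c) :+ con (+ 2) :* d)) :+ c)
      refl (X n) (Cos (X n)) (Cos (X (suc n)))))

  -- `X n - 1` is the sum of the first `n` cosines, which decrease and so are all at least
  -- `cos (X n)`.
  n*Cos-X≤X-1 : ∀ n → fromℕ n * Cos (X n) ≤ X n - 1#
  n*Cos-X≤X-1 zero    = ≈⇒≤ (solve 1 (λ c → con (+ 0) :* c := con (+ 1) :- con (+ 1)) refl (Cos (X 0)))
  n*Cos-X≤X-1 (suc n) = ≤-trans (*-monoʳ-≤ (fromℕ (suc n)) (0≤fromℕ (suc n)) (Cos-X-decreases n))
    (≤-by (≤⇒0≤- (n*Cos-X≤X-1 n))
      (solve 3 (λ x c n → ((x :+ c) :- con (+ 1)) :- (con (+ 1) :+ n) :* c := (x :- con (+ 1)) :- n :* c)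
        refl (X n) (Cos (X n)) (fromℕ n)))

  -- The constant comes from `X n ≤ Y 0 = 1 + 2 cos 1 ≤ 3`.
  n*Cos-X≤2 : ∀ n → fromℕ n * Cos (X n) ≤ fromℕ 2
  n*Cos-X≤2 n = ≤-trans (n*Cos-X≤X-1 n) (≤-by
    (0≤+ (≤⇒0≤- (≤-trans (X≤Y n) (Y-antitone (ℕ.≤⇒≤′ (z≤n {n}))))) (0≤* (0≤fromℕ 2) (≤⇒0≤- (Cos≤1 0≤1))))
    (solve 2 (λ x c → con (+ 2) :- (x :- con (+ 1)) := ((con (+ 1) :+ con (+ 2) :* c) :- x) :+ con (+ 2) :* (con (+ 1) :- c))
      refl (X n) (Cos 1#)))

  X-cauchy : Cauchy X
  X-cauchy ε 0<ε = N , λ m n N≤m N≤n → close N≤m N≤n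
    where
    -- From index `N` on, all terms lie in `[X N, Y N]`, whose width `2 cos (X N)` is at most `4/N`.
    large = archimedean (fromℕ 4 * recip (>⇒#0 0<ε))
    M = proj₁ large
    N = suc M

    4<Nε : fromℕ 4 < fromℕ N * ε
    4<Nε = <-≤-trans
      (<-respˡ-≈ (trans (*-comm _ _) (divide-cancel (fromℕ 4) (>⇒#0 0<ε))) (*-monoʳ-< ε 0<ε (proj₂ large)))
      (≤-respʳ (*-comm ε _) (*-monoʳ-≤ ε (<⇒≤ 0<ε) (fromℕ-mono (ℕ.n≤1+n M))))

    2Cos<ε : fromℕ 2 * Cos (X N) < ε
    2Cos<ε = *-cancelˡ-< (fromℕ N) (fromℕ-pos M) (≤-<-trans (≤-resp
      (solve 2 (λ n c → con (+ 2) :* (n :* c) := n :* (con (+ 2) :* c)) refl (fromℕ N) (Cos (X N)))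
      (solve 0 (con (+ 2) :* con (+ 2) := con (+ 4)) refl)
      (*-monoʳ-≤ (fromℕ 2) (0≤fromℕ 2) (n*Cos-X≤2 N))) 4<Nε)

    below : ∀ {m n} → N ℕ.≤ m → N ℕ.≤ n → X m - X n < ε
    below {m} {n} N≤m N≤n = ≤-<-trans (≤-by
      (0≤+ (≤⇒0≤- (≤-trans (X≤Y m) (Y-antitone (ℕ.≤⇒≤′ N≤m)))) (≤⇒0≤- (X-mono (ℕ.≤⇒≤′ N≤n))))
      (solve 4 (λ x y z c → c :- (x :- y) := ((z :+ c) :- x) :+ (y :- z)) refl (X m) (X n) (X N) (fromℕ 2 * Cos (X N)))) 2Cos<ε

    close : ∀ {m n} → N ℕ.≤ m → N ℕ.≤ n → Within ε (X m) (X n)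
    close {m} {n} N≤m N≤n =
      <-by (<⇒0<- (below N≤n N≤m)) (solve 3 (λ x y e → (x :- y) :- :- e := e :- (y :- x)) refl (X m) (X n) ε) ,
      below N≤m N≤n

  opaque
    p : ℝ
    p = proj₁ (complete X X-cauchy)

    X⟶p : X ⟶ p
    X⟶p = proj₂ (complete X X-cauchy)

  X≤p : ∀ n → X n ≤ p
  X≤p n = lim-≥ X⟶p n λ m n≤m → X-mono (ℕ.≤⇒≤′ n≤m)

  p≤Y : ∀ n → p ≤ Y n
  p≤Y n = lim-≤ X⟶p n λ m n≤m → ≤-trans (X≤Y m) (Y-antitone (ℕ.≤⇒≤′ n≤m))

  1≤p : 1# ≤ p
  1≤p = X≤p 0

  0≤p : 0# ≤ p
  0≤p = ≤-trans 0≤1 1≤p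

  0<p : 0# < p
  0<p = <-≤-trans 0<1 1≤p

  -- Expresses that `cos (X n)` tends to zero: the hypothesis and `n*Cos-X≤2` bound `n x` by `2k`.
  multiples-of-Cos-X : ∀ {x} k → (∀ n → x ≤ fromℕ k * Cos (X n)) → x ≤ 0#
  multiples-of-Cos-X {x} k x≤kC = bounded-multiples x (fromℕ k * fromℕ 2) λ n → ≤-trans
    (*-monoʳ-≤ (fromℕ n) (0≤fromℕ n) (x≤kC n))
    (≤-respˡ (solve 3 (λ k n c → k :* (n :* c) := n :* (k :* c)) refl (fromℕ k) (fromℕ n) (Cos (X n)))
      (*-monoʳ-≤ (fromℕ k) (0≤fromℕ k) (n*Cos-X≤2 n)))

  -- Continuity is not invoked. Monotonicity of `x - cos x` and `x + cos x`, with
  -- `p - X n ≤ 2 cos (X n)`, encloses `cos p` between `-cos (X n)` and `3 cos (X n)`.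
  Cos-p : Cos p ≈ 0#
  Cos-p = ≮⇒≈
    (multiples-of-Cos-X 3 λ n → ≤-by (0≤+ (≤⇒0≤- (id-Cos-mono (0≤X n) (X≤p n))) (≤⇒0≤- (p≤Y n)))
      (solve 4 (λ c d x p → con (+ 3) :* c :- d
        := ((p :+ :- con (+ 1) :* d) :- (x :+ :- con (+ 1) :* c)) :+ ((x :+ con (+ 2) :* c) :- p))
        refl (Cos (X n)) (Cos p) (X n) p))
    (≤-by (≤⇒0≤- (multiples-of-Cos-X 1 λ n → ≤-by (0≤+ (≤⇒0≤- (id+Cos-mono (0≤X n) (X≤p n))) (≤⇒0≤- (p≤Y n)))
        (solve 4 (λ c d x p → (con (+ 1) :+ con (+ 0)) :* c :- (:- d)
          := ((p :+ d) :- (x :+ c)) :+ ((x :+ con (+ 2) :* c) :- p))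
          refl (Cos (X n)) (Cos p) (X n) p)))
      (solve 1 (λ d → d :- con (+ 0) := con (+ 0) :- :- d) refl (Cos p)))

  Cos-nonneg : ∀ z → 0# ≤ z → z ≤ p → 0# ≤ Cos z
  Cos-nonneg z 0≤z z≤p = ≤-by (≤⇒0≤- (multiples-of-Cos-X 2 λ n → ≤-cases z (X n)
      (λ z≤X → ≤-by (0≤+ (0≤Cos (X-below n) z 0≤z z≤X) (0≤* (0≤fromℕ 2) (0≤Cos-X n)))
        (solve 2 (λ c d → d :- :- c := c :+ d) refl (Cos z) _))
      (λ X≤z → ≤-by (0≤+ (0≤+ (≤⇒0≤- (id+Cos-mono (0≤X n) X≤z)) (≤⇒0≤- z≤p)) (0≤+ (≤⇒0≤- (p≤Y n)) (0≤Cos-X n)))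
        (solve 5 (λ c d x z p → con (+ 2) :* d :- :- c
          := ((z :+ c) :- (x :+ d) :+ (p :- z)) :+ (((x :+ con (+ 2) :* d) :- p) :+ d))
          refl (Cos z) (Cos (X n)) (X n) z p))))
    (solve 1 (λ c → c :- con (+ 0) := con (+ 0) :- :- c) refl (Cos z))

  Sin-nonneg : ∀ {x} → 0# ≤ x → x ≤ p → 0# ≤ Sin x
  Sin-nonneg {x} 0≤x x≤p = ≤-respˡ Sin-0
    (Sin-mono ≤-refl 0≤x λ z 0≤z z≤x → Cos-nonneg z 0≤z (≤-trans z≤x x≤p))

  -- Strict positivity needs an explicit lower bound, and the comparison of `x` with `1` is only
  -- available for a goal of the form `≤`. The bound `x ≤ 2 (1 + x) sin x` holds in both cases: from
  -- `x ≤ 2 sin x` below `1`, and from `1 ≤ 2 sin x` above.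
  Sin-pos : ∀ {x} → 0# < x → x ≤ p → 0# < Sin x
  Sin-pos {x} 0<x x≤p = *-cancelˡ-< (1# + x) 0<1+x (*-cancelˡ-< (fromℕ 2) (fromℕ-pos 1)
    (<-respˡ-≈ (solve 1 (λ x → con (+ 0) := con (+ 2) :* ((con (+ 1) :+ x) :* con (+ 0))) refl x)
      (<-≤-trans 0<x (≤-cases x 1# small large))))
    where
    0≤x = <⇒≤ 0<x
    0<1+x : 0# < 1# + x
    0<1+x = 0<+ 0<1 0≤x
    small : x ≤ 1# → x ≤ fromℕ 2 * ((1# + x) * Sin x)
    small x≤1 = ≤-by (0≤+ (≤⇒0≤- (id≤2Sin 0≤x x≤1)) (0≤* (0≤fromℕ 2) (0≤* 0≤x (Sin-nonneg 0≤x x≤p))))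
      (solve 2 (λ x s → con (+ 2) :* ((con (+ 1) :+ x) :* s) :- x := (con (+ 2) :* s :- x) :+ con (+ 2) :* (x :* s))
        refl x (Sin x))
    large : 1# ≤ x → x ≤ fromℕ 2 * ((1# + x) * Sin x)
    large 1≤x = ≤-by (0≤+ (0≤* (<⇒≤ 0<1+x) (≤⇒0≤- (1≤2Sin 1≤x λ z 0≤z z≤x → Cos-nonneg z 0≤z (≤-trans z≤x x≤p)))) 0≤1)
      (solve 2 (λ x s → con (+ 2) :* ((con (+ 1) :+ x) :* s) :- x := (con (+ 1) :+ x) :* (con (+ 2) :* s :- con (+ 1)) :+ con (+ 1))
        refl x (Sin x))

  square≈1⇒≈1 : ∀ {x} → 0# < x → x * x ≈ 1# → x ≈ 1#
  square≈1⇒≈1 {x} 0<x xx≈1 = begin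
    x               ≈⟨ solve 1 (λ x → x := (x :- con (+ 1)) :+ con (+ 1)) refl x ⟩
    (x - 1#) + 1#   ≈⟨ +-congʳ x-1≈0 ⟩
    0# + 1#         ≈⟨ +-identityˡ 1# ⟩
    1#              ∎
    where
    x-1≈0 : x - 1# ≈ 0#
    x-1≈0 = *-cancelˡ (1# + x) (>⇒#0 (0<+ 0<1 (<⇒≤ 0<x))) (begin
      (1# + x) * (x - 1#)   ≈⟨ solve 1 (λ x → (con (+ 1) :+ x) :* (x :- con (+ 1)) := x :* x :- con (+ 1)) refl x ⟩
      x * x - 1#            ≈⟨ trans (+-congʳ xx≈1) (-‿inverseʳ 1#) ⟩
      0#                    ≈⟨ zeroʳ _ ⟨
      (1# + x) * 0#         ∎)

  Sin-p : Sin p ≈ 1#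
  Sin-p = square≈1⇒≈1 (Sin-pos 0<p ≤-refl) (begin
    Sin p * Sin p                    ≈⟨ +-identityʳ _ ⟨
    Sin p * Sin p + 0#               ≈⟨ +-congˡ (trans (*-congʳ Cos-p) (zeroˡ _)) ⟨
    Sin p * Sin p + Cos p * Cos p    ≈⟨ pythagoras 0≤p ⟩
    1#                               ∎)

  -- cos x = sin (p - x).
  Cos-pos : ∀ {x} → 0# ≤ x → x < p → 0# < Cos x
  Cos-pos {x} 0≤x x<p = <-respʳ-≈ (sym complement) (Sin-pos 0<y (≤-by 0≤x (solve 2 (λ p x → p :- (p :- x) := x) refl p x)))
    where
    y = p - x
    0<y : 0# < y
    0<y = <⇒0<- x<p
    y+x≈p : y + x ≈ p
    y+x≈p = solve 2 (λ p x → (p :- x) :+ x := p) refl p x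

    complement : Cos x ≈ Sin y
    complement = begin
      Cos x
        ≈⟨ solve 1 (λ c → c := con (+ 1) :* c :- con (+ 0)) refl (Cos x) ⟩
      1# * Cos x - 0#
        ≈⟨ +-cong (*-congʳ (trans (sym Sin-p) (trans (Sin-cong (sym y+x≈p)) (Sin-+ (<⇒≤ 0<y) 0≤x))))
             (-‿cong (trans (sym (zeroˡ (Sin x))) (*-congʳ (trans (sym Cos-p) (trans (Cos-cong (sym y+x≈p)) (Cos-+ (<⇒≤ 0<y) 0≤x)))))) ⟩
      (Sin y * Cos x + Cos y * Sin x) * Cos x - (Cos y * Cos x - Sin y * Sin x) * Sin x
        ≈⟨ solve 4 (λ s c u v → (u :* c :+ v :* s) :* c :- (v :* c :- u :* s) :* s := u :* (s :* s :+ c :* c))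
             refl (Sin x) (Cos x) (Sin y) (Cos y) ⟩
      Sin y * (Sin x * Sin x + Cos x * Cos x)
        ≈⟨ trans (*-congˡ (pythagoras 0≤x)) (*-identityʳ _) ⟩
      Sin y ∎

  -- `p + p` is a positive zero of the sine, so `least` excludes `p + p < π`. If `π < p + p`, then
  -- `u = π/2` lies in `(0, p)`, where sine and cosine are positive, and `sin π = 2 sin u cos u` is
  -- not zero.
  π≈2p : ∀ {sin π} → IsSine sin → IsPi sin π → π ≈ p + p
  π≈2p {sin} {π} isSine isPi = ≮⇒≈ (IsPi.least isPi (p + p) (0<+ 0<p 0≤p) sin2p≈0) π≮2p
    where
    sin2p≈0 : sin (p + p) ≈ 0#
    sin2p≈0 = begin
      sin (p + p)                      ≈⟨ IsSine⇒Sin isSine (p + p) ⟩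
      Sin (p + p)                      ≈⟨ Sin-+ 0≤p 0≤p ⟩
      Sin p * Cos p + Cos p * Sin p    ≈⟨ +-cong (trans (*-congˡ Cos-p) (zeroʳ _)) (trans (*-congʳ Cos-p) (zeroˡ _)) ⟩
      0# + 0#                          ≈⟨ +-identityʳ 0# ⟩
      0#                               ∎

    u = π / 2
    u+u≈π : u + u ≈ π
    u+u≈π = trans (solve 1 (λ u → u :+ u := u :* con (+ 2)) refl u) (/-cancel π 2)

    double-< : ∀ {x y} → x + x < y + y → x < y
    double-< {x} {y} x+x<y+y = *-cancelˡ-< (fromℕ 2) (fromℕ-pos 1)
      (<-respˡ-≈ (twice x) (<-respʳ-≈ (twice y) x+x<y+y))
      where
      twice : ∀ x → x + x ≈ fromℕ 2 * x
      twice = solve 1 (λ x → x :+ x := con (+ 2) :* x) refl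

    0<u : 0# < u
    0<u = double-< (<-respˡ-≈ (sym (+-identityʳ 0#)) (<-respʳ-≈ (sym u+u≈π) (IsPi.positive isPi)))

    π≮2p : ¬ (π < p + p)
    π≮2p π<2p = <-irrefl (sym sinπ≈) (0<+ (*-pos 0<Sin 0<Cos) (<⇒≤ (*-pos 0<Cos 0<Sin)))
      where
      u<p : u < p
      u<p = double-< (<-respˡ-≈ (sym u+u≈π) π<2p)
      0<Sin = Sin-pos 0<u (<⇒≤ u<p)
      0<Cos = Cos-pos (<⇒≤ 0<u) u<p
      sinπ≈ : Sin u * Cos u + Cos u * Sin u ≈ 0#
      sinπ≈ = begin
        Sin u * Cos u + Cos u * Sin u   ≈⟨ Sin-+ (<⇒≤ 0<u) (<⇒≤ 0<u) ⟨
        Sin (u + u)                     ≈⟨ Sin-cong u+u≈π ⟩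
        Sin π                           ≈⟨ IsSine⇒Sin isSine π ⟨
        sin π                           ≈⟨ IsPi.zero-sin isPi ⟩
        0#                              ∎

-- Wallis integrals by their reduction formula.

module WallisIntegrals {c ℓ₁ ℓ₂ ℓ₃} (R : RealField c ℓ₁ ℓ₂ ℓ₃) where

  open Reals R hiding (zero)
  open Inequalities R
  open Differentiation R
  open Trigonometry R
  open HalfPi R
  open Comparison R using (WallisRecurrence)
  open ≈-Reasoning setoid

  ^-cong : ∀ k {x y} → x ≈ y → x ^ k ≈ y ^ k
  ^-cong zero    x≈y = refl
  ^-cong (suc k) x≈y = *-cong x≈y (^-cong k x≈y)

  Cos^-differentiable : ∀ {r} → 0# ≤ r → ∀ k →
    Differentiable r (λ x → Cos x ^ suc k) (λ x → fromℕ (suc k) * (Cos x ^ k * - Sin x))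
  Cos^-differentiable 0≤r zero    = differentiable-resp
    (λ x _ → solve 2 (λ s c → :- s :* con (+ 1) :+ c :* con (+ 0) := (con (+ 1) :+ con (+ 0)) :* (con (+ 1) :* :- s))
      refl (Sin x) (Cos x))
    (*-differentiable (Cos-differentiable 0≤r) (const-differentiable 1#))
  Cos^-differentiable 0≤r (suc k) = differentiable-resp
    (λ x _ → solve 4 (λ s c q k → :- s :* (c :* q) :+ c :* ((con (+ 1) :+ k) :* (q :* :- s))
        := (con (+ 1) :+ (con (+ 1) :+ k)) :* ((c :* q) :* :- s))
      refl (Sin x) (Cos x) (Cos x ^ k) (fromℕ k))
    (*-differentiable (Cos-differentiable 0≤r) (Cos^-differentiable 0≤r k))

  -- F k x is the integral of cosᵏ over [0, x].
  F : ℕ → ℝ → ℝ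
  F 0             x = x
  F 1             x = Sin x
  F (suc (suc k)) x = recip (fromℕ-suc#0 (suc k)) * (Cos x ^ suc k * Sin x + fromℕ (suc k) * F k x)

  F-cong : ∀ k {x y} → x ≈ y → F k x ≈ F k y
  F-cong 0             x≈y = x≈y
  F-cong 1             x≈y = Sin-cong x≈y
  F-cong (suc (suc k)) x≈y = *-congˡ (+-cong (*-cong (^-cong (suc k) (Cos-cong x≈y)) (Sin-cong x≈y)) (*-congˡ (F-cong k x≈y)))

  F-0 : ∀ k → F k 0# ≈ 0#
  F-0 0             = refl
  F-0 1             = Sin-0
  F-0 (suc (suc k)) = trans (*-congˡ (+-cong (trans (*-congˡ Sin-0) (zeroʳ _)) (trans (*-congˡ (F-0 k)) (zeroʳ _))))
    (solve 1 (λ x → x :* (con (+ 0) :+ con (+ 0)) := con (+ 0)) refl _)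

  F-suc-suc : ∀ k x → fromℕ (suc (suc k)) * F (suc (suc k)) x ≈ Cos x ^ suc k * Sin x + fromℕ (suc k) * F k x
  F-suc-suc k x = trans (sym (*-assoc _ _ _)) (trans (*-congʳ (recip-inverseʳ (fromℕ-suc#0 (suc k)))) (*-identityˡ _))

  -- This justifies the reduction formula: after differentiation, `pythagoras` leaves only the power
  -- of the cosine.
  F-differentiable : ∀ {r} → 0# ≤ r → ∀ k → Differentiable r (F k) (λ x → Cos x ^ k)
  F-differentiable 0≤r 0             = id-differentiable
  F-differentiable 0≤r 1             = differentiable-resp (λ x _ → sym (*-identityʳ (Cos x))) (Sin-differentiable 0≤r)
  F-differentiable 0≤r (suc (suc k)) = differentiable-resp derivative
    (scale-differentiable i (+-differentiable
      (*-differentiable (Cos^-differentiable 0≤r k) (Sin-differentiable 0≤r))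
      (scale-differentiable (fromℕ (suc k)) (F-differentiable 0≤r k))))
    where
    i = recip (fromℕ-suc#0 (suc k))
    κ = fromℕ (suc k)

    derivative : ∀ x → 0# ≤ x →
      i * ((κ * (Cos x ^ k * - Sin x) * Sin x + Cos x ^ suc k * Cos x) + κ * Cos x ^ k) ≈ Cos x ^ suc (suc k)
    derivative x 0≤x = begin
      i * ((κ * (Cos x ^ k * - Sin x) * Sin x + Cos x ^ suc k * Cos x) + κ * Cos x ^ k)
        ≈⟨ solve 5 (λ i κ q s c → i :* ((κ :* (q :* :- s) :* s :+ (c :* q) :* c) :+ κ :* q)
             := i :* κ :* q :* (con (+ 1) :- (s :* s :+ c :* c)) :+ ((con (+ 1) :+ κ) :* i) :* (c :* (c :* q)))
             refl i κ (Cos x ^ k) (Sin x) (Cos x) ⟩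
      i * κ * Cos x ^ k * (1# - (Sin x * Sin x + Cos x * Cos x)) + fromℕ (suc (suc k)) * i * Cos x ^ suc (suc k)
        ≈⟨ +-cong (*-congˡ (trans (+-congˡ (-‿cong (pythagoras 0≤x))) (-‿inverseʳ 1#)))
             (*-congʳ (recip-inverseʳ (fromℕ-suc#0 (suc k)))) ⟩
      i * κ * Cos x ^ k * 0# + 1# * Cos x ^ suc (suc k)
        ≈⟨ solve 2 (λ x y → x :* con (+ 0) :+ con (+ 1) :* y := y) refl _ _ ⟩
      Cos x ^ suc (suc k) ∎

  J : ℕ → ℝ
  J k = F k p

  -- The boundary term of the reduction formula contains `Cos p`, which is zero.
  J-recurrence : WallisRecurrence J
  J-recurrence k = trans (F-suc-suc k p) (trans (+-congʳ (trans (*-congʳ (trans (*-congʳ Cos-p) (zeroˡ _))) (zeroˡ _))) (+-identityˡ _))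

  0≤Cos^ : ∀ k x → 0# ≤ x → x ≤ p → 0# ≤ Cos x ^ k
  0≤Cos^ zero    x _   _   = 0≤1
  0≤Cos^ (suc k) x 0≤x x≤p = 0≤* (Cos-nonneg x 0≤x x≤p) (0≤Cos^ k x 0≤x x≤p)

  0≤J : ∀ k → 0# ≤ J k
  0≤J k = ≤-respˡ (F-0 k) (mean-value (F-differentiable 0≤p k) ≤-refl 0≤p ≤-refl (0≤Cos^ k) (F-cong k))

  -- The difference of the antiderivatives has derivative `cosᵏ x (1 - cos x)`, nonnegative up to
  -- `p`.
  J-antitone : ∀ k → J (suc k) ≤ J k
  J-antitone k = ≤-by (≤-respˡ difference-0 (mean-value
      (+-differentiable (F-differentiable 0≤p k) (scale-differentiable (- 1#) (F-differentiable 0≤p (suc k))))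
      ≤-refl 0≤p ≤-refl
      (λ x 0≤x x≤p → ≤-respʳ (solve 2 (λ q c → q :* (con (+ 1) :- c) := q :+ :- con (+ 1) :* (c :* q)) refl _ (Cos x))
        (0≤* (0≤Cos^ k x 0≤x x≤p) (≤⇒0≤- (Cos≤1 0≤x))))
      (λ e → +-cong (F-cong k e) (*-congˡ (F-cong (suc k) e)))))
    (solve 2 (λ x y → x :- y := x :+ :- con (+ 1) :* y) refl (J k) (J (suc k)))
    where
    difference-0 : F k 0# + - 1# * F (suc k) 0# ≈ 0#
    difference-0 = trans (+-cong (F-0 k) (*-congˡ (F-0 (suc k)))) (solve 0 (con (+ 0) :+ :- con (+ 1) :* con (+ 0) := con (+ 0)) refl)

-- Sine at the multiples of `3π/4`.

module EighthTurns {c ℓ₁ ℓ₂ ℓ₃} (R : RealField c ℓ₁ ℓ₂ ℓ₃) where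

  open Reals R hiding (zero)
  open Inequalities R
  open Trigonometry R
  open HalfPi R
  open Coefficients R using (rotation)
  open ≈-Reasoning setoid

  module _ {sin : ℝ → ℝ} {π √2 : ℝ} (isSine : IsSine sin) (isPi : IsPi sin π) (isSqrt : IsSqrt (fromℕ 2) √2) where

    u : ℝ
    u = p / 2

    u+u≈p : u + u ≈ p
    u+u≈p = trans (solve 1 (λ u → u :+ u := u :* con (+ 2)) refl u) (/-cancel p 2)

    0<u : 0# < u
    0<u = *-cancelˡ-< (fromℕ 2) (fromℕ-pos 1) (<-respˡ-≈ (sym (zeroʳ _))
      (<-respʳ-≈ (sym (trans (*-comm _ _) (/-cancel p 2))) 0<p))

    0≤u : 0# ≤ u
    0≤u = <⇒≤ 0<u

    u<p : u < p
    u<p = <-by 0<u (trans (+-congʳ (sym u+u≈p)) (solve 1 (λ u → (u :+ u) :- u := u) refl u))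

    0<Sin-u : 0# < Sin u
    0<Sin-u = Sin-pos 0<u (<⇒≤ u<p)

    0<Cos-u : 0# < Cos u
    0<Cos-u = Cos-pos 0≤u u<p

    -- `0 = cos (2u) = (cos u + sin u)(cos u - sin u)`, and the first factor is positive.
    Cos-u≈Sin-u : Cos u ≈ Sin u
    Cos-u≈Sin-u = begin
      Cos u                       ≈⟨ solve 2 (λ c s → c := (c :- s) :+ s) refl (Cos u) (Sin u) ⟩
      (Cos u - Sin u) + Sin u     ≈⟨ +-congʳ (*-cancelˡ (Cos u + Sin u) (>⇒#0 (0<+ 0<Cos-u (<⇒≤ 0<Sin-u))) product) ⟩
      0# + Sin u                  ≈⟨ +-identityˡ _ ⟩
      Sin u                       ∎
      where
      product : (Cos u + Sin u) * (Cos u - Sin u) ≈ (Cos u + Sin u) * 0#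
      product = begin
        (Cos u + Sin u) * (Cos u - Sin u)    ≈⟨ solve 2 (λ c s → (c :+ s) :* (c :- s) := c :* c :- s :* s) refl (Cos u) (Sin u) ⟩
        Cos u * Cos u - Sin u * Sin u        ≈⟨ Cos-+ 0≤u 0≤u ⟨
        Cos (u + u)                          ≈⟨ trans (Cos-cong u+u≈p) Cos-p ⟩
        0#                                   ≈⟨ zeroʳ _ ⟨
        (Cos u + Sin u) * 0#                 ∎

    √2*Sin-u≈1 : √2 * Sin u ≈ 1#
    √2*Sin-u≈1 = square≈1⇒≈1 (*-pos (IsSqrt.positive isSqrt) 0<Sin-u) (begin
      √2 * Sin u * (√2 * Sin u)        ≈⟨ solve 2 (λ r s → r :* s :* (r :* s) := (r :* r) :* (s :* s)) refl √2 (Sin u) ⟩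
      √2 * √2 * (Sin u * Sin u)        ≈⟨ *-congʳ (IsSqrt.square isSqrt) ⟩
      fromℕ 2 * (Sin u * Sin u)        ≈⟨ solve 1 (λ s → con (+ 2) :* (s :* s) := s :* s :+ s :* s) refl (Sin u) ⟩
      Sin u * Sin u + Sin u * Sin u    ≈⟨ +-congˡ (*-cong Cos-u≈Sin-u Cos-u≈Sin-u) ⟨
      Sin u * Sin u + Cos u * Cos u    ≈⟨ pythagoras 0≤u ⟩
      1#                               ∎)

    w : ℝ
    w = p + u

    0≤w : 0# ≤ w
    0≤w = 0≤+ 0≤p 0≤u

    √2*Sin-w≈1 : √2 * Sin w ≈ 1#
    √2*Sin-w≈1 = trans (*-congˡ (begin
      Sin w                            ≈⟨ Sin-+ 0≤p 0≤u ⟩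
      Sin p * Cos u + Cos p * Sin u    ≈⟨ +-cong (*-cong Sin-p Cos-u≈Sin-u) (*-congʳ Cos-p) ⟩
      1# * Sin u + 0# * Sin u          ≈⟨ solve 1 (λ s → con (+ 1) :* s :+ con (+ 0) :* s := s) refl (Sin u) ⟩
      Sin u                            ∎)) √2*Sin-u≈1

    √2*Cos-w≈-1 : √2 * Cos w ≈ - 1#
    √2*Cos-w≈-1 = begin
      √2 * Cos w                             ≈⟨ *-congˡ (Cos-+ 0≤p 0≤u) ⟩
      √2 * (Cos p * Cos u - Sin p * Sin u)   ≈⟨ *-congˡ (+-cong (*-congʳ Cos-p) (-‿cong (*-congʳ Sin-p))) ⟩
      √2 * (0# * Cos u - 1# * Sin u)
        ≈⟨ solve 3 (λ r c s → r :* (con (+ 0) :* c :- con (+ 1) :* s) := :- (r :* s)) refl √2 (Cos u) (Sin u) ⟩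
      - (√2 * Sin u)                         ≈⟨ -‿cong √2*Sin-u≈1 ⟩
      - 1#                                   ∎

    ·≈fromℕ* : ∀ n x → n · x ≈ fromℕ n * x
    ·≈fromℕ* zero    x = sym (zeroˡ x)
    ·≈fromℕ* (suc n) x = trans (+-congˡ (·≈fromℕ* n x)) (solve 2 (λ n x → x :+ n :* x := (con (+ 1) :+ n) :* x) refl (fromℕ n) x)

    angle : ∀ ℓ → (3 ℕ.* ℓ) · π / 4 ≈ fromℕ ℓ * w
    angle ℓ = *-cancelˡ (fromℕ 4) (fromℕ-suc#0 3) (begin
      fromℕ 4 * ((3 ℕ.* ℓ) · π / 4)      ≈⟨ trans (*-comm _ _) (/-cancel ((3 ℕ.* ℓ) · π) 4) ⟩
      (3 ℕ.* ℓ) · π                      ≈⟨ ·≈fromℕ* (3 ℕ.* ℓ) π ⟩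
      fromℕ (3 ℕ.* ℓ) * π                ≈⟨ *-cong (fromℕ-* 3 ℓ) (π≈2p isSine isPi) ⟩
      fromℕ 3 * fromℕ ℓ * (p + p)
        ≈⟨ solve 2 (λ l p → con (+ 3) :* l :* (p :+ p) := con (+ 4) :* l :* p :+ con (+ 2) :* l :* p) refl (fromℕ ℓ) p ⟩
      fromℕ 4 * fromℕ ℓ * p + fromℕ 2 * fromℕ ℓ * p
        ≈⟨ +-congˡ (*-congˡ (sym u+u≈p)) ⟩
      fromℕ 4 * fromℕ ℓ * p + fromℕ 2 * fromℕ ℓ * (u + u)
        ≈⟨ solve 3 (λ l p u → con (+ 4) :* l :* p :+ con (+ 2) :* l :* (u :+ u) := con (+ 4) :* (l :* (p :+ u))) refl (fromℕ ℓ) p u ⟩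
      fromℕ 4 * (fromℕ ℓ * w) ∎)

    -- The parts of `(1 - i)^ℓ`: since `w` is `3π/4`, the number `-√2 e^(i w)` equals `1 - i`. The
    -- addition theorems at `w` then amount to multiplication by `1 - i`.
    im re : ℕ → ℝ
    im ℓ = -1^ ℓ * √2 ^ ℓ * Sin (fromℕ ℓ * w)
    re ℓ = -1^ ℓ * √2 ^ ℓ * Cos (fromℕ ℓ * w)

    rotation≈im : ∀ ℓ → rotation sin π √2 ℓ ≈ im ℓ
    rotation≈im ℓ = *-congˡ (trans (IsSine⇒Sin isSine _) (Sin-cong (angle ℓ)))

    next : ∀ ℓ → fromℕ (suc ℓ) * w ≈ fromℕ ℓ * w + w
    next ℓ = solve 2 (λ l w → (con (+ 1) :+ l) :* w := l :* w :+ w) refl (fromℕ ℓ) w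

    0≤ℓw : ∀ ℓ → 0# ≤ fromℕ ℓ * w
    0≤ℓw ℓ = 0≤* (0≤fromℕ ℓ) 0≤w

    im-suc : ∀ ℓ → im (suc ℓ) ≈ im ℓ - re ℓ
    im-suc ℓ = begin
      -1^ suc ℓ * √2 ^ suc ℓ * Sin (fromℕ (suc ℓ) * w)
        ≈⟨ *-congˡ (trans (Sin-cong (next ℓ)) (Sin-+ (0≤ℓw ℓ) 0≤w)) ⟩
      -1^ suc ℓ * √2 ^ suc ℓ * (Sin (fromℕ ℓ * w) * Cos w + Cos (fromℕ ℓ * w) * Sin w)
        ≈⟨ solve 7 (λ n r q a b c s → :- con (+ 1) :* n :* (r :* q) :* (a :* c :+ b :* s)
             := :- con (+ 1) :* (n :* q :* (a :* (r :* c) :+ b :* (r :* s))))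
             refl (-1^ ℓ) √2 (√2 ^ ℓ) _ _ (Cos w) (Sin w) ⟩
      - 1# * (-1^ ℓ * √2 ^ ℓ * (Sin (fromℕ ℓ * w) * (√2 * Cos w) + Cos (fromℕ ℓ * w) * (√2 * Sin w)))
        ≈⟨ *-congˡ (*-congˡ (+-cong (*-congˡ √2*Cos-w≈-1) (*-congˡ √2*Sin-w≈1))) ⟩
      - 1# * (-1^ ℓ * √2 ^ ℓ * (Sin (fromℕ ℓ * w) * - 1# + Cos (fromℕ ℓ * w) * 1#))
        ≈⟨ solve 3 (λ x a b → :- con (+ 1) :* (x :* (a :* :- con (+ 1) :+ b :* con (+ 1))) := x :* a :- x :* b)
             refl (-1^ ℓ * √2 ^ ℓ) _ _ ⟩
      im ℓ - re ℓ ∎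

    re-suc : ∀ ℓ → re (suc ℓ) ≈ re ℓ + im ℓ
    re-suc ℓ = begin
      -1^ suc ℓ * √2 ^ suc ℓ * Cos (fromℕ (suc ℓ) * w)
        ≈⟨ *-congˡ (trans (Cos-cong (next ℓ)) (Cos-+ (0≤ℓw ℓ) 0≤w)) ⟩
      -1^ suc ℓ * √2 ^ suc ℓ * (Cos (fromℕ ℓ * w) * Cos w - Sin (fromℕ ℓ * w) * Sin w)
        ≈⟨ solve 7 (λ n r q a b c s → :- con (+ 1) :* n :* (r :* q) :* (b :* c :- a :* s)
             := :- con (+ 1) :* (n :* q :* (b :* (r :* c) :- a :* (r :* s))))
             refl (-1^ ℓ) √2 (√2 ^ ℓ) _ _ (Cos w) (Sin w) ⟩
      - 1# * (-1^ ℓ * √2 ^ ℓ * (Cos (fromℕ ℓ * w) * (√2 * Cos w) - Sin (fromℕ ℓ * w) * (√2 * Sin w)))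
        ≈⟨ *-congˡ (*-congˡ (+-cong (*-congˡ √2*Cos-w≈-1) (-‿cong (*-congˡ √2*Sin-w≈1)))) ⟩
      - 1# * (-1^ ℓ * √2 ^ ℓ * (Cos (fromℕ ℓ * w) * - 1# - Sin (fromℕ ℓ * w) * 1#))
        ≈⟨ solve 3 (λ x a b → :- con (+ 1) :* (x :* (b :* :- con (+ 1) :- a :* con (+ 1))) := x :* b :+ x :* a)
             refl (-1^ ℓ * √2 ^ ℓ) _ _ ⟩
      re ℓ + im ℓ ∎

    im-0 : im 0 ≈ 0#
    im-0 = trans (*-congˡ (trans (Sin-cong (zeroˡ w)) Sin-0)) (zeroʳ _)

    re-0 : re 0 ≈ 1#
    re-0 = trans (*-congˡ (trans (Cos-cong (zeroˡ w)) Cos-0)) (solve 0 (con (+ 1) :* con (+ 1) :* con (+ 1) := con (+ 1)) refl)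

    rotation-0 : rotation sin π √2 0 ≈ 0#
    rotation-0 = trans (rotation≈im 0) im-0

    rotation-1 : rotation sin π √2 1 ≈ - 1#
    rotation-1 = trans (rotation≈im 1) (trans (im-suc 0) (trans (+-cong im-0 (-‿cong re-0)) (+-identityˡ _)))

    rotation-recurrence : ∀ ℓ → rotation sin π √2 (suc (suc ℓ)) ≈ fromℕ 2 * (rotation sin π √2 (suc ℓ) - rotation sin π √2 ℓ)
    rotation-recurrence ℓ = begin
      rotation sin π √2 (suc (suc ℓ))             ≈⟨ rotation≈im (suc (suc ℓ)) ⟩
      im (suc (suc ℓ))                            ≈⟨ im-suc (suc ℓ) ⟩
      im (suc ℓ) - re (suc ℓ)                     ≈⟨ +-cong (im-suc ℓ) (-‿cong (re-suc ℓ)) ⟩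
      (im ℓ - re ℓ) - (re ℓ + im ℓ)
        ≈⟨ solve 2 (λ x y → (x :- y) :- (y :+ x) := con (+ 2) :* ((x :- y) :- x)) refl (im ℓ) (re ℓ) ⟩
      fromℕ 2 * ((im ℓ - re ℓ) - im ℓ)            ≈⟨ *-congˡ (+-congʳ (im-suc ℓ)) ⟨
      fromℕ 2 * (im (suc ℓ) - im ℓ)               ≈⟨ *-congˡ (+-cong (rotation≈im (suc ℓ)) (-‿cong (rotation≈im ℓ))) ⟨
      fromℕ 2 * (rotation sin π √2 (suc ℓ) - rotation sin π √2 ℓ) ∎

-- The limits of `b`, `c-seq` and their quotient.

module Limits {c ℓ₁ ℓ₂ ℓ₃} (R : RealField c ℓ₁ ℓ₂ ℓ₃) where

  open Reals R hiding (zero)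
  open Inequalities R
  open Differentiation R using (∣∣≤-cancel)
  open EulerTransform R
  open Coefficients R
  open Comparison R
  open HalfPi R hiding (p)
  open WallisIntegrals R
  open EighthTurns R
  open ≈-Reasoning setoid

  module Sequences {sin : ℝ → ℝ} (isSine : IsSine sin) {π : ℝ} (isPi : IsPi sin π)
                   {√2 : ℝ} (isSqrt : IsSqrt (fromℕ 2) √2) where

    private
      0<π = IsPi.positive isPi

      c′ : ℕ → ℝ
      c′ = c-seq sin π √2

      α′ : Series
      α′ = α sin π √2

      2J₀≈π : fromℕ 2 * J 0 ≈ π
      2J₀≈π = trans (solve 1 (λ p → con (+ 2) :* p := p :+ p) refl (J 0)) (sym (π≈2p isSine isPi))

      β-euler = euler-recurrence β 0# ∂-β
      α-euler = euler-recurrence α′ (1# / 2) (∂-α sin π √2 (rotation-0 isSine isPi isSqrt)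
        (rotation-1 isSine isPi isSqrt) (rotation-recurrence isSine isPi isSqrt))

      2α₁≈1 : fromℕ 2 * euler α′ 1 ≈ 1#
      2α₁≈1 = trans (*-congˡ (proj₁ α-euler)) 2*½≈1

    -- The initial values fit: `J 0` is `p`, half of `π`, and `J 1` is `Sin p`, which is `1`.
    open WeightedRatio π 0<π J J-recurrence 2J₀≈π Sin-p 0≤J J-antitone β α′
      β-0 (proj₁ β-euler) (proj₂ β-euler) (α-0 sin π √2) 2α₁≈1 (proj₂ α-euler)

    4b≈B : ∀ n → fromℕ 4 * b n ≈ B n
    4b≈B n = begin
      fromℕ 4 * b n                    ≈⟨ *-congˡ (b≈T n) ⟩
      fromℕ 4 * (1# / 4 * B n)         ≈⟨ solve 3 (λ x y z → x :* (y :* z) := (y :* x) :* z) refl _ _ _ ⟩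
      (1# / 4) * fromℕ 4 * B n         ≈⟨ *-congʳ (/-cancel 1# 4) ⟩
      1# * B n                         ≈⟨ *-identityˡ _ ⟩
      B n                              ∎

    0<b : ∀ n → 0# < b n
    0<b n = *-cancelˡ-< (fromℕ 4) (fromℕ-pos 3)
      (<-respˡ-≈ (sym (zeroʳ _)) (<-respʳ-≈ (sym (4b≈B n)) (<-≤-trans 0<1 (1≤B n))))

    b#0 : ∀ n → b n # 0#
    b#0 n = >⇒#0 (0<b n)

    b⟶+∞ : b ⟶+∞
    b⟶+∞ M = proj₁ large , λ n N≤n → *-cancelˡ-< (fromℕ 4) (fromℕ-pos 3)
      (<-respʳ-≈ (sym (4b≈B n)) (proj₂ large n N≤n))
      where
      large = B⟶+∞ (fromℕ 4 * M)

    πb-c-bound : ∀ n → ∣ fromℕ (suc n) * (π * b (suc n) - c′ (suc n)) ∣≤ fromℕ 2 * π * b (suc n)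
    πb-c-bound n = ∣∣≤-cancel (fromℕ 4) (fromℕ-pos 3) (∣∣≤-resp
      (begin
        fromℕ (suc n) * (π * B (suc n) + - fromℕ 4 * C (suc n))
          ≈⟨ *-congˡ (+-cong (*-congˡ (sym (4b≈B (suc n)))) (*-congˡ (sym (c≈T sin π √2 (suc n))))) ⟩
        fromℕ (suc n) * (π * (fromℕ 4 * b (suc n)) + - fromℕ 4 * c′ (suc n))
          ≈⟨ solve 4 (λ n π x y → n :* (π :* (con (+ 4) :* x) :+ :- con (+ 4) :* y) := con (+ 4) :* (n :* (π :* x :- y)))
               refl (fromℕ (suc n)) π (b (suc n)) (c′ (suc n)) ⟩
        fromℕ 4 * (fromℕ (suc n) * (π * b (suc n) - c′ (suc n))) ∎)
      (trans (*-congˡ (*-congˡ (sym (4b≈B (suc n)))))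
        (solve 2 (λ π x → π :* (con (+ 2) :* (con (+ 4) :* x)) := con (+ 4) :* (con (+ 2) :* π :* x)) refl π (b (suc n))))
      (ratio-bound n))

    ratio : ℕ → ℝ
    ratio n = divide (c′ n) (b n) (b#0 n)

    ratio-π-bound : ∀ n → ∣ fromℕ (suc n) * (ratio (suc n) - π) ∣≤ fromℕ 2 * π
    ratio-π-bound n = ∣∣≤-cancel (b (suc n)) (0<b (suc n)) (∣∣≤-resp
      (begin
        - (fromℕ (suc n) * (π * x - c′ (suc n)))
          ≈⟨ -‿cong (*-congˡ (+-congˡ (-‿cong (divide-cancel (c′ (suc n)) (b#0 (suc n)))))) ⟨
        - (fromℕ (suc n) * (π * x - ratio (suc n) * x))
          ≈⟨ rearrange (fromℕ (suc n)) x (ratio (suc n)) ⟩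
        x * (fromℕ (suc n) * (ratio (suc n) - π)) ∎)
      (*-comm (fromℕ 2 * π) x)
      (∣-∣≤ (πb-c-bound n)))
      where
      x = b (suc n)
      rearrange : ∀ n x r → - (n * (π * x - r * x)) ≈ x * (n * (r - π))
      rearrange n x r = solve 4 (λ n π x r → :- (n :* (π :* x :- r :* x)) := x :* (n :* (r :- π))) refl n π x r

    ratio⟶π : ratio ⟶ π
    ratio⟶π ε 0<ε = suc M , close
      where
      -- Beyond `2π/ε` the error bound `2π/n` from `ratio-π-bound` is smaller than `ε`.
      large = archimedean (fromℕ 2 * π * recip (>⇒#0 0<ε))
      M = proj₁ large

      2π<nε : ∀ {n} → M ℕ.≤ n → fromℕ 2 * π < fromℕ (suc n) * ε
      2π<nε {n} M≤n = <-≤-trans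
        (<-respˡ-≈ (trans (*-comm _ _) (divide-cancel (fromℕ 2 * π) (>⇒#0 0<ε))) (*-monoʳ-< ε 0<ε (proj₂ large)))
        (≤-respʳ (*-comm ε _) (*-monoʳ-≤ ε (<⇒≤ 0<ε) (fromℕ-mono (ℕ.≤-trans M≤n (ℕ.n≤1+n n)))))

      close : ∀ n → suc M ℕ.≤ n → Within ε (ratio n) π
      close (suc n) (s≤s M≤n) =
        *-cancelˡ-< (fromℕ (suc n)) (fromℕ-pos n) (<-≤-trans
          (<-by (<⇒0<- (2π<nε M≤n)) (solve 3 (λ n e x → :- x :- n :* :- e := n :* e :- x) refl (fromℕ (suc n)) ε (fromℕ 2 * π)))
          (proj₁ (ratio-π-bound n))) ,
        *-cancelˡ-< (fromℕ (suc n)) (fromℕ-pos n) (≤-<-trans (proj₂ (ratio-π-bound n)) (2π<nε M≤n))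

    2≤π : fromℕ 2 ≤ π
    2≤π = ≤-resp (*-identityʳ _) 2J₀≈π (*-monoʳ-≤ (fromℕ 2) (0≤fromℕ 2) 1≤p)

    -- n c ≥ (n - 2) π b ≥ n b for n ≥ 4, as π ≥ 2.
    b≤c : ∀ n → 4 ℕ.≤ n → b n ≤ c′ n
    b≤c (suc (suc (suc (suc n)))) (s≤s (s≤s (s≤s (s≤s z≤n)))) = *-cancelˡ-≤ k (fromℕ-pos (suc (suc (suc n)))) (≤-by
      (0≤+ (0≤+ (≤⇒0≤- (proj₂ (πb-c-bound (suc (suc (suc n))))))
        (0≤* (0≤* (0≤fromℕ (suc (suc n))) (≤⇒0≤- 2≤π)) (<⇒≤ (0<b m))))
        (0≤* (0≤fromℕ n) (<⇒≤ (0<b m))))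
      (rearrange (fromℕ n) (b m) (c′ m)))
      where
      m = suc (suc (suc (suc n)))
      k = fromℕ m
      rearrange : ∀ n x y →
        (1# + (1# + (1# + (1# + n)))) * y - (1# + (1# + (1# + (1# + n)))) * x
          ≈ (fromℕ 2 * π * x - (1# + (1# + (1# + (1# + n)))) * (π * x - y)) + (1# + (1# + n)) * (π - fromℕ 2) * x + n * x
      rearrange n x y = solve 4 (λ n x y π →
        (con (+ 1) :+ (con (+ 1) :+ (con (+ 1) :+ (con (+ 1) :+ n)))) :* y
          :- (con (+ 1) :+ (con (+ 1) :+ (con (+ 1) :+ (con (+ 1) :+ n)))) :* x
          := (con (+ 2) :* π :* x :- (con (+ 1) :+ (con (+ 1) :+ (con (+ 1) :+ (con (+ 1) :+ n)))) :* (π :* x :- y))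
             :+ (con (+ 1) :+ (con (+ 1) :+ n)) :* (π :- con (+ 2)) :* x :+ n :* x) refl n x y π

    c⟶+∞ : c′ ⟶+∞
    c⟶+∞ M = N ℕ.⊔ 4 , λ n N≤n → <-≤-trans (proj₂ (b⟶+∞ M) n (ℕ.m⊔n≤o⇒m≤o N 4 N≤n)) (b≤c n (ℕ.m⊔n≤o⇒n≤o N 4 N≤n))
      where
      N = proj₁ (b⟶+∞ M)

theorem6p3 :
    ∀ {a ℓ₁ ℓ₂ ℓ₃} (R : RealField a ℓ₁ ℓ₂ ℓ₃) → let open Reals R in
    (sin : ℝ → ℝ) → IsSine sin →
    (π : ℝ) → IsPi sin π →
    (√2 : ℝ) → IsSqrt (fromℕ 2) √2 →
    let c : ℕ → ℝ
        c = c-seq sin π √2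
    in
    (b ⟶+∞)
    × Σ (∀ n → b n # 0#) (λ b#0 → (λ n → divide (c n) (b n) (b#0 n)) ⟶ π)
    × (c ⟶+∞)
theorem6p3 R sin isSine π isPi √2 isSqrt = b⟶+∞ , (b#0 , ratio⟶π) , c⟶+∞
  where
  open Limits.Sequences R isSine isPi isSqrt
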